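{- Let $d,k,r$ be positive integers with $k<\min\{d,r\}$. Then, as $n\to\infty$, $L(n,d,k,r)=\Theta(l_{d,k,r}(n))$, where $$l_{d,k,r}(n) = \begin{cases} n^{k\cdot\max\{r,d\}}, & \text{if } r\ne d,\\ n^{kd}\log n, & \text{otherwise.}\end{cases}$$
   Context: $[n]=\{1,\dots,n\}$. $L(n,d,k,r)$ is the number of ordered $r$-tuples of (not necessarily distinct) points in $[n]^d$ that lie in a common $k$-dimensional linear subspace of $\mathbb{R}^d$; equivalently, the number of $d\times r$ matrices with entries in $[n]$ of rank at most $k$. Here $d,k,r$ are fixed and implied constants may depend on them. -}

module Defs where

import Algebra.Properties.Semiring.Sum as SemiringSum
open import Algebra.Bundles using (CommutativeRing)
open import Data.Bool.Base using (if_then_else_)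
open import Data.Fin.Base using (Fin; zero; suc)
open import Data.Fin.Properties using (any?)
open import Data.Fin.Subset using (Subset; inside; outside; _∈_; _∉_; ∣_∣)
open import Data.Fin.Subset.Properties using (drop-there)
import Data.Integer.Base as ℤ
open import Data.List.Base as List using (List; []; _∷_; length; filter; upTo; cartesianProductWith)
open import Data.List.Extrema.Nat using (max)
open import Data.Nat.Base as ℕ using (ℕ; zero; suc; _^_; _⊔_)
open import Data.Nat.Logarithm using (⌊log₂_⌋)
import Data.Nat.Properties as ℕ
open import Data.Product.Base using (∃-syntax; _×_; _,_)
open import Data.Rational.Base using (ℚ; 0ℚ; 1ℚ; _+_; _*_; -_; _/_; 1/_; _<_; _≤_; ≢-nonZero)
open import Data.Rational.Properties
  using (_≟_; 1≢0; +-identityˡ; +-identityʳ; *-assoc; *-comm; *-identityˡ; *-inverseˡ;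
         *-zeroˡ; *-zeroʳ; +-*-commutativeRing)
open import Data.Rational.Solver using (module +-*-Solver)
open import Data.Vec.Base using (Vec; []; _∷_; lookup; here; there)
import Data.Vec.Functional as Vector
open Vector using (Vector)
open import Function.Base using (_∘_)
open import Relation.Binary.PropositionalEquality
  using (_≡_; _≢_; refl; sym; trans; cong; cong₂; module ≡-Reasoning)
open import Relation.Nullary using (¬_; Dec; yes; no; does; ¬?; contradiction)
open import Relation.Nullary.Decidable using (map′; decidable-stable)

open SemiringSum (CommutativeRing.semiring +-*-commutativeRing)
  using (sum; sum-cong-≗; sum-replicate-zero; *-distribˡ-sum; ∑-distrib-+)

fromℕ : ℕ → ℚ
fromℕ m = ℤ.+ m / 1

combination : ∀ {d m} → (Fin m → Vector ℚ d) → Vector ℚ m → Vector ℚ d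
combination v c i = sum (λ j → c j * v j i)

-- Linear independence of the subfamily (v j) for j ∈ S: a linear combination of
-- this subfamily is a combination of all of v whose coefficients vanish off S.
LinearlyIndependent : ∀ {d m} → (Fin m → Vector ℚ d) → Subset m → Set
LinearlyIndependent v S =
  ∀ c → (∀ j → j ∉ S → c j ≡ 0ℚ) → (∀ i → combination v c i ≡ 0ℚ) → ∀ j → c j ≡ 0ℚ

private
  *-cancel-zero : ∀ {a} → a ≢ 0ℚ → ∀ x → a * x ≡ 0ℚ → x ≡ 0ℚ
  *-cancel-zero {a} a≢0 x ax≡0 = begin
    x              ≡⟨ *-identityˡ x ⟨
    1ℚ * x         ≡⟨ cong (_* x) (*-inverseˡ a) ⟨
    1/ a * a * x   ≡⟨ *-assoc (1/ a) a x ⟩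
    1/ a * (a * x) ≡⟨ cong (1/ a *_) ax≡0 ⟩
    1/ a * 0ℚ      ≡⟨ *-zeroʳ (1/ a) ⟩
    0ℚ             ∎
    where
    open ≡-Reasoning
    instance a-nonZero = ≢-nonZero a≢0

  sum-zero : ∀ {m} (f : Vector ℚ m) → (∀ j → f j ≡ 0ℚ) → sum f ≡ 0ℚ
  sum-zero {m} f f≡0 = trans (sum-cong-≗ f≡0) (sum-replicate-zero m)

  0*+ : ∀ {a} x {s} → a ≡ 0ℚ → a * x + s ≡ s
  0*+ x {s} refl = trans (cong (_+ s) (*-zeroˡ x)) (+-identityˡ s)

  combination-scale : ∀ {d m} (v : Fin m → Vector ℚ d) a c i →
    combination v (λ j → a * c j) i ≡ a * combination v c i
  combination-scale v a c i = sym (trans (*-distribˡ-sum a (λ j → c j * v j i))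
    (sum-cong-≗ (λ j → sym (*-assoc a (c j) (v j i)))))

  -- Fraction-free elimination of the first vector using the pivot coordinate p.
  eliminate : ∀ {d m} → (Fin (suc m) → Vector ℚ d) → Fin d → Fin m → Vector ℚ d
  eliminate v p j i = v zero p * v (suc j) i + (- v zero i) * v (suc j) p

  combination-eliminate : ∀ {d m} (v : Fin (suc m) → Vector ℚ d) p c i →
    combination (eliminate v p) c i
      ≡ v zero p * combination (v ∘ suc) c i + (- v zero i) * combination (v ∘ suc) c p
  combination-eliminate v p c i = begin
    sum (λ j → c j * (a * w j i + b * w j p))
      ≡⟨ sum-cong-≗ (λ j → lemma (c j) a (w j i) b (w j p)) ⟩
    sum (λ j → a * (c j * w j i) + b * (c j * w j p))
      ≡⟨ ∑-distrib-+ (λ j → a * (c j * w j i)) (λ j → b * (c j * w j p)) ⟩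
    sum (λ j → a * (c j * w j i)) + sum (λ j → b * (c j * w j p))
      ≡⟨ cong₂ _+_ (*-distribˡ-sum a (λ j → c j * w j i)) (*-distribˡ-sum b (λ j → c j * w j p)) ⟨
    a * combination w c i + b * combination w c p
      ∎
    where
    open ≡-Reasoning
    a = v zero p
    b = - v zero i
    w = v ∘ suc
    lemma : ∀ c a x b y → c * (a * x + b * y) ≡ a * (c * x) + b * (c * y)
    lemma = solve 5 (λ c a x b y → c :* (a :* x :+ b :* y) := a :* (c :* x) :+ b :* (c :* y)) refl
      where open +-*-Solver

  outside⁺ : ∀ {d m} (v : Fin (suc m) → Vector ℚ d) {S} →
    LinearlyIndependent (v ∘ suc) S → LinearlyIndependent v (outside ∷ S)
  outside⁺ v ind c c∉ vc≡0 = λ where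
      zero    → c₀≡0
      (suc j) → ind (c ∘ suc) (λ j j∉S → c∉ (suc j) (j∉S ∘ drop-there))
                  (λ i → trans (sym (0*+ (v zero i) c₀≡0)) (vc≡0 i)) j
    where
    c₀≡0 : c zero ≡ 0ℚ
    c₀≡0 = c∉ zero λ ()

  outside⁻ : ∀ {d m} (v : Fin (suc m) → Vector ℚ d) {S} →
    LinearlyIndependent v (outside ∷ S) → LinearlyIndependent (v ∘ suc) S
  outside⁻ v ind c c∉ vc≡0 j = ind (0ℚ Vector.∷ c)
    (λ { zero _ → refl ; (suc j) j∉ → c∉ j (j∉ ∘ there) })
    (λ i → trans (0*+ (v zero i) refl) (vc≡0 i)) (suc j)

  zero-dependent : ∀ {d m} (v : Fin (suc m) → Vector ℚ d) {S} →
    (∀ i → v zero i ≡ 0ℚ) → ¬ LinearlyIndependent v (inside ∷ S)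
  zero-dependent v v₀≡0 ind = 1≢0 (ind (1ℚ Vector.∷ λ _ → 0ℚ)
    (λ { zero 0∉ → contradiction here 0∉ ; (suc _) _ → refl })
    (λ i → cong₂ _+_ (trans (*-identityˡ (v zero i)) (v₀≡0 i))
             (sum-zero (λ j → 0ℚ * v (suc j) i) (λ j → *-zeroˡ (v (suc j) i)))) zero)

  inside⁺ : ∀ {d m} (v : Fin (suc m) → Vector ℚ d) {S} p → v zero p ≢ 0ℚ →
    LinearlyIndependent (eliminate v p) S → LinearlyIndependent v (inside ∷ S)
  inside⁺ v p a≢0 ind c c∉ vc≡0 = λ where
      zero    → *-cancel-zero a≢0 (c zero) (begin
        a * c zero                       ≡⟨ *-comm a (c zero) ⟩
        c zero * a                       ≡⟨ +-identityʳ (c zero * a) ⟨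
        c zero * a + 0ℚ                  ≡⟨ cong (c zero * a +_) tail≡0 ⟨
        c zero * a + combination w c′ p  ≡⟨ vc≡0 p ⟩
        0ℚ                               ∎)
      (suc j) → c′≡0 j
    where
    open ≡-Reasoning
    a = v zero p
    w = v ∘ suc
    c′ = c ∘ suc
    lemma : ∀ a b c x y → a * x + (- b) * y ≡ a * (c * b + x) + (- b) * (c * a + y)
    lemma = solve 5 (λ a b c x y → a :* x :+ (:- b) :* y
                       := a :* (c :* b :+ x) :+ (:- b) :* (c :* a :+ y)) refl
      where open +-*-Solver
    c′≡0 : ∀ j → c′ j ≡ 0ℚ
    c′≡0 = ind c′ (λ j j∉S → c∉ (suc j) (j∉S ∘ drop-there)) λ i → begin
      combination (eliminate v p) c′ i
        ≡⟨ combination-eliminate v p c′ i ⟩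
      a * combination w c′ i + (- v zero i) * combination w c′ p
        ≡⟨ lemma a (v zero i) (c zero) (combination w c′ i) (combination w c′ p) ⟩
      a * combination v c i + (- v zero i) * combination v c p
        ≡⟨ cong₂ (λ x y → a * x + (- v zero i) * y) (vc≡0 i) (vc≡0 p) ⟩
      a * 0ℚ + (- v zero i) * 0ℚ
        ≡⟨ cong₂ _+_ (*-zeroʳ a) (*-zeroʳ (- v zero i)) ⟩
      0ℚ ∎
    tail≡0 : combination w c′ p ≡ 0ℚ
    tail≡0 = sum-zero (λ j → c′ j * w j p)
      (λ j → trans (cong (_* w j p) (c′≡0 j)) (*-zeroˡ (w j p)))

  inside⁻ : ∀ {d m} (v : Fin (suc m) → Vector ℚ d) {S} p → v zero p ≢ 0ℚ →
    LinearlyIndependent v (inside ∷ S) → LinearlyIndependent (eliminate v p) S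
  inside⁻ v p a≢0 ind c c∉ ec≡0 j = *-cancel-zero a≢0 (c j) (ind c⁺
    (λ { zero 0∉ → contradiction here 0∉
       ; (suc j) j∉ → trans (cong (a *_) (c∉ j (j∉ ∘ there))) (*-zeroʳ a) })
    (λ i → begin
      - combination w c p * v zero i + combination w (λ j → a * c j) i
        ≡⟨ cong (- combination w c p * v zero i +_) (combination-scale w a c i) ⟩
      - combination w c p * v zero i + a * combination w c i
        ≡⟨ lemma a (v zero i) (combination w c i) (combination w c p) ⟩
      a * combination w c i + (- v zero i) * combination w c p
        ≡⟨ combination-eliminate v p c i ⟨
      combination (eliminate v p) c i
        ≡⟨ ec≡0 i ⟩
      0ℚ ∎) (suc j))
    where
    open ≡-Reasoning
    a = v zero p
    w = v ∘ suc
    c⁺ = (- combination w c p) Vector.∷ (λ j → a * c j)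
    lemma : ∀ a b x y → (- y) * b + a * x ≡ a * x + (- b) * y
    lemma = solve 4 (λ a b x y → (:- y) :* b :+ a :* x := a :* x :+ (:- b) :* y) refl
      where open +-*-Solver

linearlyIndependent? : ∀ {d m} (v : Fin m → Vector ℚ d) S → Dec (LinearlyIndependent v S)
linearlyIndependent? v []            = yes λ _ _ _ ()
linearlyIndependent? v (outside ∷ S) = map′ (outside⁺ v) (outside⁻ v) (linearlyIndependent? (v ∘ suc) S)
linearlyIndependent? v (inside ∷ S) with any? (λ i → ¬? (v zero i ≟ 0ℚ))
... | yes (p , a≢0) = map′ (inside⁺ v p a≢0) (inside⁻ v p a≢0) (linearlyIndependent? (eliminate v p) S)
... | no  ∄pivot    = no (zero-dependent v λ i →
                        decidable-stable (v zero i ≟ 0ℚ) (λ a≢0 → ∄pivot (i , a≢0)))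

vectorsOver : ∀ {A : Set} → List A → ∀ m → List (Vec A m)
vectorsOver xs zero    = [] ∷ []
vectorsOver xs (suc m) = cartesianProductWith _∷_ xs (vectorsOver xs m)

-- A d × r matrix is the r-tuple of its columns.
Matrix : ℕ → ℕ → Set
Matrix d r = Vec (Vec ℕ d) r

columns : ∀ {d r} → Matrix d r → Fin r → Vector ℚ d
columns M j i = fromℕ (lookup (lookup M j) i)

-- The largest number of linearly independent columns. Rank does not change under
-- field extension, so for these integer matrices the rank over ℚ is the rank over ℝ.
rank : ∀ {d r} → Matrix d r → ℕ
rank {r = r} M =
  max 0 (List.map ∣_∣ (filter (linearlyIndependent? (columns M)) (vectorsOver (outside ∷ inside ∷ []) r)))

[1⋯_] : ℕ → List ℕ
[1⋯ n ] = List.map suc (upTo n)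

matrices : ∀ n d r → List (Matrix d r)
matrices n d r = vectorsOver (vectorsOver [1⋯ n ] d) r

L : (n d k r : ℕ) → ℕ
L n d k r = length (filter (λ M → rank M ℕ.≤? k) (matrices n d r))

-- For n ≥ 2 the integer ⌊log₂ n⌋ is within constant factors of log n, so it may
-- stand for log n in a growth rate that only matters up to Θ.
l : (d k r n : ℕ) → ℕ
l d k r n = if does (r ℕ.≟ d)
  then n ^ (k ℕ.* d) ℕ.* ⌊log₂ n ⌋
  else n ^ (k ℕ.* (r ⊔ d))

infix 4 _=Θ_

_=Θ_ : (f g : ℕ → ℕ) → Set
f =Θ g = ∃[ c ] ∃[ C ] ∃[ N ] 0ℚ < c × 0ℚ < C ×
  (∀ n → N ℕ.≤ n → c * fromℕ (g n) ≤ fromℕ (f n) × fromℕ (f n) ≤ C * fromℕ (g n))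

{-# OPTIONS --safe #-}

-- Upper bound: let M have p ≤ q rows and columns (after transposing) and rank k. Elimination with
-- pivoting writes M = X M₀, where M₀ consists of k independent rows of M and the rational matrix X
-- has bounded entries. The columns of M₀ lie in the lattice Λ of all v with X v integral. If Λ has
-- index D, the box [n]ᵏ contains O(nᵏ/D) points of Λ, because Λ contains k independent vectors of
-- the box, and O(D^(p-k)) matrices X belong to Λ. Summing D^(p-k) (nᵏ/D)^q over the Hermite forms
-- of all lattices, one diagonal entry at a time, gives n^(kq), times log n if p = q.
--
-- Lower bound: for r ≠ d repeat rows or columns. For r = d use the X whose rows are congruent
-- modulo 1 to (tᵢ/q) (1, c) for reduced fractions t₀/q: here Λ has index q, and every range of
-- denominators Q < q ≤ 8 Q contributes n^(kd) matrices, up to a constant, as long as Q = O(n).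
module Submission where

open import Defs
open import Data.Nat.Base using (ℕ; _<_; _⊓_)

-- The denominators of X are unbounded, so X and M₀ cannot be counted separately. Sorting by Λ
-- balances them: a large index D admits more X but fewer columns. The bound O(nᵏ/D) does not hold
-- for every lattice: the pairs with a ≡ b modulo L, L > n, form a lattice of index L with n points
-- in [n]², however large L is. This is the obstacle that k independent columns remove. On average
-- there are roughly D^(k-1) lattices of index D, so index D contributes about n^(kq) D^(p-q-1) in
-- total, which is summable for p < q and harmonic for p = q. In terms of Hermite forms, the
-- diagonal entries carry the exponents k + x, ..., 1 + x with x = q - p, and only the last can
-- equal 1. In the square case a lower bound must therefore collect the same amount at every scale
-- of D. Lattices with cyclic quotient suffice for this, such as those given by the vector (1 , c).
-- What has to be secured is that no matrix arises twice: reduced fractions separate the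
-- denominators, and independent upper rows make X readable from the matrix.

module Sums where
  open import Algebra.Bundles using (CommutativeRing)
  open import Data.Fin.Base using (Fin; zero; suc)

  -- Finite sums in a commutative ring

  module FiniteSums {c ℓ} (R : CommutativeRing c ℓ) where
    open CommutativeRing R hiding (zero)
    open import Algebra.Properties.Semiring.Sum semiring public
      using (sum; sum-cong-≋; sum-cong-≗; sum-replicate-zero; *-distribˡ-sum; *-distribʳ-sum; ∑-distrib-+; ∑-comm)
    open import Relation.Binary.Reasoning.Setoid setoid

    δ : ∀ {n} → Fin n → Fin n → Carrier
    δ zero    zero    = 1#
    δ zero    (suc _) = 0#
    δ (suc _) zero    = 0#
    δ (suc i) (suc j) = δ i j

    sum-zero : ∀ {n} (f : Fin n → Carrier) → (∀ i → f i ≈ 0#) → sum f ≈ 0#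
    sum-zero {n} f f≈0 = trans (sum-cong-≋ f≈0) (sum-replicate-zero n)

    sum-linear : ∀ {n} a b (f g : Fin n → Carrier) → sum (λ i → a * f i + b * g i) ≈ a * sum f + b * sum g
    sum-linear a b f g = begin
      sum (λ i → a * f i + b * g i) ≈⟨ ∑-distrib-+ (λ i → a * f i) (λ i → b * g i) ⟩
      sum (λ i → a * f i) + sum (λ i → b * g i) ≈⟨ +-cong (*-distribˡ-sum a f) (*-distribˡ-sum b g) ⟨
      a * sum f + b * sum g ∎

    sum-δ : ∀ {n} (i : Fin n) f → sum (λ j → δ i j * f j) ≈ f i
    sum-δ zero    f = trans (+-cong (*-identityˡ (f zero)) (sum-zero _ (λ j → zeroˡ (f (suc j))))) (+-identityʳ (f zero))
    sum-δ (suc i) f = trans (+-cong (zeroˡ (f zero)) (sum-δ i (λ j → f (suc j)))) (+-identityˡ (f (suc i)))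

    sum-swap : ∀ {m n} (x : Fin m → Carrier) (y : Fin n → Carrier) (A : Fin m → Fin n → Carrier) →
      sum (λ i → x i * sum (λ j → y j * A i j)) ≈ sum (λ j → y j * sum (λ i → x i * A i j))
    sum-swap x y A = begin
      sum (λ i → x i * sum (λ j → y j * A i j)) ≈⟨ sum-cong-≋ (λ i → *-distribˡ-sum (x i) (λ j → y j * A i j)) ⟩
      sum (λ i → sum (λ j → x i * (y j * A i j))) ≈⟨ ∑-comm (λ i j → x i * (y j * A i j)) ⟩
      sum (λ j → sum (λ i → x i * (y j * A i j))) ≈⟨ sum-cong-≋ (λ j → sum-cong-≋ (λ i → x∙yz≈y∙xz (x i) (y j) (A i j))) ⟩
      sum (λ j → sum (λ i → y j * (x i * A i j))) ≈⟨ sum-cong-≋ (λ j → *-distribˡ-sum (y j) (λ i → x i * A i j)) ⟨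
      sum (λ j → y j * sum (λ i → x i * A i j)) ∎
      where open import Algebra.Properties.CommutativeSemigroup *-commutativeSemigroup using (x∙yz≈y∙xz)

  module RationalSums where
    open import Data.Rational.Properties using (+-*-commutativeRing)
    open FiniteSums +-*-commutativeRing public

  module IntegerSums where
    open import Data.Integer.Properties using (+-*-commutativeRing)
    open FiniteSums +-*-commutativeRing public

open Sums

open import Data.Product.Base using (_×_; _,_; proj₁; proj₂; Σ-syntax; ∃-syntax)
open import Relation.Binary.PropositionalEquality
  using (_≡_; refl; sym; trans; cong; cong₂; subst; module ≡-Reasoning; _≢_)
open import Relation.Nullary using (Dec; does; contradiction; yes; no; ¬?; ¬_)
open import Function.Base using (_∘_; case_of_; id)

-- Counting with duplicate-free lists

module Counting where
  open import Data.Bool.Base using (true; false)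
  open import Data.Fin.Base using (zero; suc)
  open import Data.List.Base using (List; []; _∷_; _++_; map; length; filter; upTo; concatMap; cartesianProductWith)
  open import Data.List.Membership.Propositional using (_∈_; lose)
  open import Data.List.Membership.Propositional.Properties
    using (∈-∃++; ∈-++⁺ˡ; ∈-++⁺ʳ; ∈-++⁻; ∈-map⁺; ∈-map⁻; ∈-cartesianProductWith⁺; ∈-cartesianProductWith⁻;
           ∈-concatMap⁺; ∈-upTo⁺; ∈-upTo⁻)
  open import Data.List.Properties using (length-++; length-map; length-upTo; applyUpTo-∷ʳ; map-++)
  open import Data.List.Relation.Binary.Subset.Propositional using (_⊆_)
  open import Data.List.Relation.Unary.All as All using (All; []; _∷_)
  import Data.List.Relation.Unary.All.Properties as All
  open import Data.List.Relation.Unary.AllPairs using ([]; _∷_)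
  open import Data.List.Relation.Unary.Any using (here; there)
  open import Data.List.Relation.Unary.Unique.Propositional using (Unique)
  import Data.List.Relation.Unary.Unique.Propositional.Properties as Unique
  open import Data.Nat.Base using (ℕ; zero; suc; _+_; _*_; _^_; _≤_; z≤n; s≤s)
  open import Data.Nat.ListAction using (sum)
  open import Data.Nat.ListAction.Properties using (sum-++)
  open import Data.Nat.Properties
    using (suc-injective; m≤n⇒m≤o+n; +-suc; +-identityʳ; +-mono-≤; *-distribˡ-+; *-zeroʳ; ≤-refl; ≤-trans;
           ≤-reflexive)
  open import Data.Sum.Base using (inj₁; inj₂)
  open import Data.Vec.Base using (Vec; []; _∷_; lookup)
  open import Data.Vec.Properties using (∷-injective)

  ∑ : ∀ {A : Set} → List A → (A → ℕ) → ℕ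
  ∑ xs f = sum (map f xs)

  -- Pigeonhole: deleting the head of `xs` from `ys` preserves the inclusion of the tail, in which
  -- the head does not recur.
  length-⊆ : ∀ {A : Set} {xs ys : List A} → Unique xs → xs ⊆ ys → length xs ≤ length ys
  length-⊆ {xs = []} [] _ = z≤n
  length-⊆ {xs = x ∷ xs} (x∉xs ∷ uniq) xs⊆ys with as , bs , refl ← ∈-∃++ (xs⊆ys (here refl)) =
    ≤-trans (s≤s (length-⊆ uniq xs⊆))
      (≤-reflexive (trans (cong suc (length-++ as)) (trans (sym (+-suc (length as) (length bs))) (sym (length-++ as)))))
    where
    xs⊆ : xs ⊆ as ++ bs
    xs⊆ y∈xs with ∈-++⁻ as (xs⊆ys (there y∈xs))
    ... | inj₁ y∈as         = ∈-++⁺ˡ y∈as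
    ... | inj₂ (here refl)  = contradiction refl (All.lookup x∉xs y∈xs)
    ... | inj₂ (there y∈bs) = ∈-++⁺ʳ as y∈bs

  map-unique : ∀ {A B : Set} (f : A → B) {xs} → (∀ {x y} → x ∈ xs → y ∈ xs → f x ≡ f y → x ≡ y) →
    Unique xs → Unique (map f xs)
  map-unique f inj []            = []
  map-unique f inj (x∉xs ∷ uniq) =
    All.map⁺ (All.tabulate λ y∈xs fx≡fy → All.lookup x∉xs y∈xs (inj (here refl) (there y∈xs) fx≡fy))
    ∷ map-unique f (λ x∈ y∈ → inj (there x∈) (there y∈)) uniq

  -- Injectivity is asked on members only, since the encodings used later are injective only on
  -- valid data.
  length-injection : ∀ {A B : Set} (f : A → B) {xs ys} → Unique xs →
    (∀ {x} → x ∈ xs → f x ∈ ys) → (∀ {x y} → x ∈ xs → y ∈ xs → f x ≡ f y → x ≡ y) →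
    length xs ≤ length ys
  length-injection f {xs} uniq f∈ys inj = ≤-trans (≤-reflexive (sym (length-map f xs)))
    (length-⊆ (map-unique f inj uniq) λ y∈ → let x , x∈xs , y≡fx = ∈-map⁻ f y∈ in subst (_∈ _) (sym y≡fx) (f∈ys x∈xs))

  length-concatMap : ∀ {A B : Set} (f : A → List B) xs → length (concatMap f xs) ≡ ∑ xs (length ∘ f)
  length-concatMap f []       = refl
  length-concatMap f (x ∷ xs) = trans (length-++ (f x)) (cong (length (f x) +_) (length-concatMap f xs))

  length-cartesianProductWith : ∀ {A B C : Set} (f : A → B → C) xs ys →
    length (cartesianProductWith f xs ys) ≡ length xs * length ys
  length-cartesianProductWith f []       ys = refl
  length-cartesianProductWith f (x ∷ xs) ys = trans (length-++ (map (f x) ys))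
    (cong₂ _+_ (length-map (f x) ys) (length-cartesianProductWith f xs ys))

  ∈-concatMap : ∀ {A B : Set} (f : A → List B) {xs x y} → x ∈ xs → y ∈ f x → y ∈ concatMap f xs
  ∈-concatMap f x∈xs y∈fx = ∈-concatMap⁺ f (lose x∈xs y∈fx)

  ∑-cong : ∀ {A : Set} xs {f g : A → ℕ} → (∀ x → f x ≡ g x) → ∑ xs f ≡ ∑ xs g
  ∑-cong []       f≡g = refl
  ∑-cong (x ∷ xs) f≡g = cong₂ _+_ (f≡g x) (∑-cong xs f≡g)

  ∑-mono-∈ : ∀ {A : Set} xs {f g : A → ℕ} → (∀ {x} → x ∈ xs → f x ≤ g x) → ∑ xs f ≤ ∑ xs g
  ∑-mono-∈ []       f≤g = z≤n
  ∑-mono-∈ (x ∷ xs) f≤g = +-mono-≤ (f≤g (here refl)) (∑-mono-∈ xs (f≤g ∘ there))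

  ∑-mono : ∀ {A : Set} xs {f g : A → ℕ} → (∀ x → f x ≤ g x) → ∑ xs f ≤ ∑ xs g
  ∑-mono xs f≤g = ∑-mono-∈ xs (λ {x} _ → f≤g x)

  *-distribˡ-∑ : ∀ {A : Set} c xs (f : A → ℕ) → c * ∑ xs f ≡ ∑ xs (λ x → c * f x)
  *-distribˡ-∑ c []       f = *-zeroʳ c
  *-distribˡ-∑ c (x ∷ xs) f = trans (*-distribˡ-+ c (f x) (∑ xs f)) (cong (c * f x +_) (*-distribˡ-∑ c xs f))

  ∑-const : ∀ {A : Set} (xs : List A) c → ∑ xs (λ _ → c) ≡ length xs * c
  ∑-const []       c = refl
  ∑-const (x ∷ xs) c = cong (c +_) (∑-const xs c)

  ∑-concatMap : ∀ {A B : Set} (f : A → List B) xs g → ∑ (concatMap f xs) g ≡ ∑ xs (λ x → ∑ (f x) g)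
  ∑-concatMap f []       g = refl
  ∑-concatMap f (x ∷ xs) g = trans (cong sum (map-++ g (f x) (concatMap f xs)))
    (trans (sum-++ (map g (f x)) (map g (concatMap f xs))) (cong (∑ (f x) g +_) (∑-concatMap f xs g)))

  ∑-map : ∀ {A B : Set} (f : A → B) xs g → ∑ (map f xs) g ≡ ∑ xs (g ∘ f)
  ∑-map f []       g = refl
  ∑-map f (x ∷ xs) g = cong (g (f x) +_) (∑-map f xs g)

  ∑-filter : ∀ {A : Set} {P : A → Set} (P? : ∀ x → Dec (P x)) xs (f : A → ℕ) →
    ∑ (filter P? xs) f ≤ ∑ xs f
  ∑-filter P? []       f = z≤n
  ∑-filter P? (x ∷ xs) f with does (P? x)
  ... | true  = +-mono-≤ (≤-refl {f x}) (∑-filter P? xs f)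
  ... | false = m≤n⇒m≤o+n (f x) (∑-filter P? xs f)

  ∑-upTo-suc : ∀ n (f : ℕ → ℕ) → ∑ (upTo (suc n)) f ≡ ∑ (upTo n) f + f n
  ∑-upTo-suc n f = begin
    sum (map f (upTo (suc n))) ≡⟨ cong (sum ∘ map f) (applyUpTo-∷ʳ (λ i → i) n) ⟨
    sum (map f (upTo n ++ n ∷ [])) ≡⟨ cong sum (map-++ f (upTo n) (n ∷ [])) ⟩
    sum (map f (upTo n) ++ f n ∷ []) ≡⟨ sum-++ (map f (upTo n)) (f n ∷ []) ⟩
    ∑ (upTo n) f + (f n + 0) ≡⟨ cong (∑ (upTo n) f +_) (+-identityʳ (f n)) ⟩
    ∑ (upTo n) f + f n ∎
    where open ≡-Reasoning

  vectorsOver-unique : ∀ {A : Set} {xs : List A} m → Unique xs → Unique (vectorsOver xs m)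
  vectorsOver-unique zero    uniq = [] ∷ []
  vectorsOver-unique (suc m) uniq =
    Unique.cartesianProductWith⁺ _∷_ ∷-injective uniq (vectorsOver-unique m uniq)

  ∈-vectorsOver⁺ : ∀ {A : Set} {xs : List A} {m} (v : Vec A m) → (∀ i → lookup v i ∈ xs) → v ∈ vectorsOver xs m
  ∈-vectorsOver⁺ []      v∈ = here refl
  ∈-vectorsOver⁺ (x ∷ v) v∈ = ∈-cartesianProductWith⁺ _∷_ (v∈ zero) (∈-vectorsOver⁺ v (v∈ ∘ suc))

  ∈-vectorsOver⁻ : ∀ {A : Set} (xs : List A) {m v} → v ∈ vectorsOver xs m → ∀ i → lookup v i ∈ xs
  ∈-vectorsOver⁻ xs {suc m} v∈ i with ∈-cartesianProductWith⁻ _∷_ xs (vectorsOver xs m) v∈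
  ∈-vectorsOver⁻ xs {suc m} v∈ zero    | _ , _ , x∈ , w∈ , refl = x∈
  ∈-vectorsOver⁻ xs {suc m} v∈ (suc i) | _ , _ , x∈ , w∈ , refl = ∈-vectorsOver⁻ xs w∈ i

  length-vectorsOver : ∀ {A : Set} (xs : List A) m → length (vectorsOver xs m) ≡ length xs ^ m
  length-vectorsOver xs zero    = refl
  length-vectorsOver xs (suc m) = trans (length-cartesianProductWith _∷_ xs (vectorsOver xs m))
    (cong (length xs *_) (length-vectorsOver xs m))

  [1⋯]-unique : ∀ n → Unique [1⋯ n ]
  [1⋯]-unique n = Unique.map⁺ suc-injective (Unique.upTo⁺ n)

  ∈-[1⋯]⁺ : ∀ {n m} → 1 ≤ m → m ≤ n → m ∈ [1⋯ n ]
  ∈-[1⋯]⁺ {m = suc m} _ m<n = ∈-map⁺ suc (∈-upTo⁺ m<n)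

  ∈-[1⋯]⁻ : ∀ {n m} → m ∈ [1⋯ n ] → 1 ≤ m × m ≤ n
  ∈-[1⋯]⁻ m∈ with ∈-map⁻ suc m∈
  ... | _ , i∈ , refl = s≤s z≤n , ∈-upTo⁻ i∈

  length-[1⋯] : ∀ n → length [1⋯ n ] ≡ n
  length-[1⋯] n = trans (length-map suc (upTo n)) (length-upTo n)

-- Sums of floors, binary logarithms and reduced fractions

module Arithmetic where
  open Counting
  open import Data.List.Base using (List; []; _∷_; map; length; filter; upTo; concatMap; cartesianProduct)
  open import Data.List.Membership.Propositional using (_∈_)
  open import Data.List.Membership.Propositional.Properties
    using (∈-map⁺; ∈-cartesianProduct⁺; ∈-cartesianProduct⁻; ∈-filter⁻; ∈-upTo⁺)
  open import Data.List.Properties using (length-map; length-upTo; map-upTo)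
  open import Data.List.Relation.Unary.Unique.Propositional using (Unique)
  import Data.List.Relation.Unary.Unique.Propositional.Properties as Unique
  open import Data.Nat.Base

  open import Data.Nat.Divisibility using (divides; ∣⇒≤)
  open import Data.Nat.DivMod using (m/n≤m; _/_; m/n*n≤m; m*n/n≡m; /-monoˡ-≤; /-monoʳ-≤)
  open import Data.Nat.GCD using (gcd; gcd[m,n]∣m; gcd[m,n]∣n)
  open import Data.Nat.Induction using (<-rec)
  open import Data.Nat.Logarithm using (⌊log₂_⌋; ⌊log₂⌋-mono-≤; ⌊log₂⌊n/2⌋⌋≡⌊log₂n⌋∸1; ⌊log₂[2^n]⌋≡n)
  open import Data.Nat.Properties
  open import Data.Nat.Tactic.RingSolver using (solve-∀)

  ∑-upTo-shift : ∀ n (f : ℕ → ℕ) → ∑ (upTo (suc n)) f ≡ f 0 + ∑ (upTo n) (f ∘ suc)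
  ∑-upTo-shift n f = cong (f 0 +_) (trans (cong (λ xs → ∑ xs f) (sym (map-upTo suc n))) (∑-map suc (upTo n) f))

  ∑-upTo-+ : ∀ m n (f : ℕ → ℕ) → ∑ (upTo (m + n)) f ≡ ∑ (upTo m) f + ∑ (upTo n) (λ i → f (m + i))
  ∑-upTo-+ zero    n f = refl
  ∑-upTo-+ (suc m) n f = begin-equality
    ∑ (upTo (suc m + n)) f ≡⟨ ∑-upTo-shift (m + n) f ⟩
    f 0 + ∑ (upTo (m + n)) (f ∘ suc) ≡⟨ cong (f 0 +_) (∑-upTo-+ m n (f ∘ suc)) ⟩
    f 0 + (∑ (upTo m) (f ∘ suc) + ∑ (upTo n) (λ i → f (suc m + i))) ≡⟨ +-assoc (f 0) _ _ ⟨
    f 0 + ∑ (upTo m) (f ∘ suc) + ∑ (upTo n) (λ i → f (suc m + i)) ≡⟨ cong (_+ ∑ (upTo n) (λ i → f (suc m + i))) (∑-upTo-shift m f) ⟨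
    ∑ (upTo (suc m)) f + ∑ (upTo n) (λ i → f (suc m + i)) ∎
    where open ≤-Reasoning

  -- The telescoping bound ∑ 1/g² ≤ ∑ 1/(g(g-1)) = 1/s - 1/(s+j) over s < g ≤ s+j, cleared of denominators.
  ∑-floor² : ∀ s j N .{{_ : NonZero s}} →
    s * (s + j) * ∑ (upTo j) (λ i → (N / suc (s + i)) * (N / suc (s + i))) ≤ j * (N * N)
  ∑-floor² s zero    N = ≤-reflexive (*-zeroʳ (s * (s + 0)))
  ∑-floor² s (suc j) N = *-cancelˡ-≤ (s + j) {{>-nonZero (≤-trans (>-nonZero⁻¹ s) (m≤m+n s j))}} (begin
    G * (s * (s + suc j) * ∑ (upTo (suc j)) f) ≡⟨ cong₂ (λ g x → G * (s * g * x)) (+-suc s j) (∑-upTo-suc j f) ⟩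
    G * (s * suc G * (A + q * q)) ≡⟨ lemma₁ G s A q ⟩
    suc G * (s * G * A) + G * (s * ((q * q) * suc G)) ≤⟨ +-mono-≤ (*-monoʳ-≤ (suc G) (∑-floor² s j N)) (*-monoˡ-≤ (s * ((q * q) * suc G)) (n≤1+n G)) ⟩
    suc G * (j * (N * N)) + suc G * (s * ((q * q) * suc G)) ≡⟨ cong (suc G * (j * (N * N)) +_) (lemma₂ (suc G) s q) ⟩
    suc G * (j * (N * N)) + s * ((q * suc G) * (q * suc G)) ≤⟨ +-monoʳ-≤ (suc G * (j * (N * N))) (*-monoʳ-≤ s (*-mono-≤ (m/n*n≤m N (suc G)) (m/n*n≤m N (suc G)))) ⟩
    suc G * (j * (N * N)) + s * (N * N) ≡⟨ lemma₃ s j (N * N) ⟩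
    G * (suc j * (N * N)) ∎)
    where
    open ≤-Reasoning
    G = s + j
    f = λ i → (N / suc (s + i)) * (N / suc (s + i))
    A = ∑ (upTo j) f
    q = N / suc G
    lemma₁ : ∀ g s a q → g * (s * suc g * (a + q * q)) ≡ suc g * (s * g * a) + g * (s * ((q * q) * suc g))
    lemma₁ = solve-∀
    lemma₂ : ∀ g s q → g * (s * ((q * q) * g)) ≡ s * ((q * g) * (q * g))
    lemma₂ = solve-∀
    lemma₃ : ∀ s j x → suc (s + j) * (j * x) + s * x ≡ (s + j) * (suc j * x)
    lemma₃ = solve-∀

  ∑-floor²≤2N² : ∀ E N → ∑ (upTo E) (λ i → (N / suc i) * (N / suc i)) ≤ 2 * (N * N)
  ∑-floor²≤2N² zero    N = z≤n
  ∑-floor²≤2N² (suc E) N = begin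
    ∑ (upTo (suc E)) f ≡⟨ ∑-upTo-shift E f ⟩
    (N / 1) * (N / 1) + ∑ (upTo E) (f ∘ suc)
                                         ≤⟨ +-mono-≤ (*-mono-≤ N/1≤N N/1≤N) (*-cancelˡ-≤ (suc E) (begin
        suc E * ∑ (upTo E) (f ∘ suc) ≡⟨ cong (_* ∑ (upTo E) (f ∘ suc)) (+-identityʳ (suc E)) ⟨
        1 * (1 + E) * ∑ (upTo E) (f ∘ suc) ≤⟨ ∑-floor² 1 E N ⟩
        E * (N * N) ≤⟨ *-monoˡ-≤ (N * N) (n≤1+n E) ⟩
        suc E * (N * N) ∎)) ⟩
    N * N + N * N ≡⟨ cong (N * N +_) (+-identityʳ (N * N)) ⟨
    2 * (N * N) ∎
    where
    open ≤-Reasoning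
    f = λ i → (N / suc i) * (N / suc i)
    N/1≤N : N / 1 ≤ N
    N/1≤N = m/n≤m N 1

  -- All but two of the factors `N / suc i` are estimated by `N`, which leaves the convergent sum of
  -- squares.
  ∑-floor^ : ∀ x E N → ∑ (upTo E) (λ i → (N / suc i) ^ (2 + x)) ≤ 2 * N ^ (2 + x)
  ∑-floor^ x E N = begin
    ∑ (upTo E) (λ i → (N / suc i) ^ (2 + x)) ≤⟨ ∑-mono (upTo E) (λ i → ≤-trans
                                                                      (≤-reflexive (lemma (N / suc i) ((N / suc i) ^ x)))
                                                                      (*-monoˡ-≤ (f i) (^-monoˡ-≤ x (m/n≤m N (suc i))))) ⟩
    ∑ (upTo E) (λ i → N ^ x * f i) ≡⟨ *-distribˡ-∑ (N ^ x) (upTo E) f ⟨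
    N ^ x * ∑ (upTo E) f ≤⟨ *-monoʳ-≤ (N ^ x) (∑-floor²≤2N² E N) ⟩
    N ^ x * (2 * (N * N)) ≡⟨ lemma′ (N ^ x) N ⟩
    2 * N ^ (2 + x) ∎
    where
    open ≤-Reasoning
    f = λ i → (N / suc i) * (N / suc i)
    lemma : ∀ a b → a * (a * b) ≡ b * (a * a)
    lemma = solve-∀
    lemma′ : ∀ b a → b * (2 * (a * a)) ≡ 2 * (a * (a * b))
    lemma′ = solve-∀

  -- The harmonic sum by doubling: each of the `2 ^ J` new terms is at most `N / 2 ^ J`, so doubling
  -- the range costs at most one more `N`.
  ∑-floor : ∀ J N → ∑ (upTo (2 ^ J)) (λ i → N / suc i) ≤ suc J * N
  ∑-floor zero    N = +-mono-≤ (m/n≤m N 1) z≤n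
  ∑-floor (suc J) N = begin
    ∑ (upTo (2 * 2 ^ J)) f ≡⟨ cong (λ e → ∑ (upTo (2 ^ J + e)) f) (+-identityʳ (2 ^ J)) ⟩
    ∑ (upTo (2 ^ J + 2 ^ J)) f ≡⟨ ∑-upTo-+ (2 ^ J) (2 ^ J) f ⟩
    ∑ (upTo (2 ^ J)) f + ∑ (upTo (2 ^ J)) (λ i → f (2 ^ J + i)) ≤⟨ +-mono-≤ (∑-floor J N) (∑-mono (upTo (2 ^ J)) (λ i → /-monoʳ-≤ N {{_}} {{m^n≢0 2 J}} (≤-trans (m≤m+n (2 ^ J) i) (n≤1+n _)))) ⟩
    suc J * N + ∑ (upTo (2 ^ J)) (λ _ → top) ≡⟨ cong (suc J * N +_) (trans (∑-const (upTo (2 ^ J)) top) (trans (cong (_* top) (length-upTo (2 ^ J))) (*-comm (2 ^ J) top))) ⟩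
    suc J * N + top * 2 ^ J ≤⟨ +-monoʳ-≤ (suc J * N) (m/n*n≤m N (2 ^ J) {{m^n≢0 2 J}}) ⟩
    suc J * N + N ≡⟨ +-comm (suc J * N) N ⟩
    suc (suc J) * N ∎
    where
    open ≤-Reasoning
    f = λ i → N / suc i
    top = (N / 2 ^ J) {{m^n≢0 2 J}}

  n<2^[1+log] : ∀ n → n < 2 ^ suc ⌊log₂ n ⌋
  n<2^[1+log] n with 2 ^ suc ⌊log₂ n ⌋ ≤? n
  ... | yes le = contradiction (≤-trans (≤-reflexive (sym (⌊log₂[2^n]⌋≡n (suc ⌊log₂ n ⌋)))) (⌊log₂⌋-mono-≤ le)) (<-irrefl refl)
  ... | no  gt = ≰⇒> gt

  2^log≤n : ∀ n .{{_ : NonZero n}} → 2 ^ ⌊log₂ n ⌋ ≤ n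
  2^log≤n = λ n → <-rec (λ n → .{{_ : NonZero n}} → 2 ^ ⌊log₂ n ⌋ ≤ n) step n
    where
    2⌊n/2⌋≤n : ∀ n → 2 * ⌊ n /2⌋ ≤ n
    2⌊n/2⌋≤n n = ≤-trans (+-monoʳ-≤ ⌊ n /2⌋ (≤-trans (≤-reflexive (+-identityʳ ⌊ n /2⌋)) (⌊n/2⌋≤⌈n/2⌉ n)))
      (≤-reflexive (⌊n/2⌋+⌈n/2⌉≡n n))
    step : ∀ n → (∀ {m} → m < n → .{{_ : NonZero m}} → 2 ^ ⌊log₂ m ⌋ ≤ m) → .{{_ : NonZero n}} → 2 ^ ⌊log₂ n ⌋ ≤ n
    step (suc zero)    rec = ≤-refl
    step n@(suc (suc m)) rec = ≤-trans (^-monoʳ-≤ 2 le)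
      (≤-trans (*-monoʳ-≤ 2 (rec {⌊ n /2⌋} (s≤s (s≤s (⌊n/2⌋≤n m))))) (2⌊n/2⌋≤n n))
      where
      le : ⌊log₂ n ⌋ ≤ suc ⌊log₂ ⌊ n /2⌋ ⌋
      le = ≤-trans (m≤n+m∸n ⌊log₂ n ⌋ 1) (≤-reflexive (cong suc (sym (⌊log₂⌊n/2⌋⌋≡⌊log₂n⌋∸1 n))))

  length-filter-split : ∀ {A : Set} {P : A → Set} (P? : ∀ x → Dec (P x)) xs →
    length (filter P? xs) + length (filter (λ x → ¬? (P? x)) xs) ≡ length xs
  length-filter-split P? []       = refl
  length-filter-split P? (x ∷ xs) with P? x
  ... | yes _ = cong suc (length-filter-split P? xs)
  ... | no  _ = trans (+-suc _ _) (cong suc (length-filter-split P? xs))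

  pairs : ℕ → List (ℕ × ℕ)
  pairs N = cartesianProduct [1⋯ N ] [1⋯ N ]

  pairs-unique : ∀ N → Unique (pairs N)
  pairs-unique N = Unique.cartesianProduct⁺ ([1⋯]-unique N) ([1⋯]-unique N)

  length-pairs : ∀ N → length (pairs N) ≡ N * N
  length-pairs N = trans (length-cartesianProductWith _,_ [1⋯ N ] [1⋯ N ])
    (cong₂ _*_ (length-[1⋯] N) (length-[1⋯] N))

  coprime? : ∀ ((t , q) : ℕ × ℕ) → Dec (gcd t q ≡ 1)
  coprime? (t , q) = gcd t q ≟ 1

  -- A common divisor `2 + i` makes the pair a multiple of a pair in the square of side
  -- `N / (2 + i)`. Divisor 2 costs a quarter of all pairs and the divisors from 3 on cost a half by
  -- telescoping, together three quarters.
  nonCoprime-count : ∀ N → 4 * length (filter (¬? ∘ coprime?) (pairs N)) ≤ 3 * (N * N)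
  nonCoprime-count N = ≤-trans (*-monoʳ-≤ 4 (≤-trans covered (≤-reflexive count))) (total N)
    where
    multiples : ℕ → List (ℕ × ℕ)
    multiples i = map (λ p → proj₁ p * (2 + i) , proj₂ p * (2 + i)) (pairs (N / (2 + i)))
    f : ℕ → ℕ
    f i = (N / (2 + i)) * (N / (2 + i))
    count : length (concatMap multiples (upTo N)) ≡ ∑ (upTo N) f
    count = trans (length-concatMap multiples (upTo N)) (∑-cong (upTo N) λ i →
      trans (length-map _ (pairs (N / (2 + i)))) (length-pairs (N / (2 + i))))
    quotient∈ : ∀ {m i} c → m ∈ [1⋯ N ] → m ≡ c * (2 + i) → c ∈ [1⋯ N / (2 + i) ]
    quotient∈ zero    m∈ refl with () ← proj₁ (∈-[1⋯]⁻ m∈)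
    quotient∈ {i = i} c@(suc _) m∈ refl = ∈-[1⋯]⁺ (s≤s z≤n)
      (≤-trans (≤-reflexive (sym (m*n/n≡m c (2 + i)))) (/-monoˡ-≤ (2 + i) (proj₂ (∈-[1⋯]⁻ m∈))))
    covers : ∀ {p} → p ∈ filter (¬? ∘ coprime?) (pairs N) → p ∈ concatMap multiples (upTo N)
    covers {t , q} p∈ with ∈-filter⁻ (¬? ∘ coprime?) {xs = pairs N} p∈
    ... | p∈pairs , gcd≢1 with ∈-cartesianProduct⁻ [1⋯ N ] [1⋯ N ] p∈pairs
    ... | t∈ , q∈ with gcd t q in eq | gcd[m,n]∣m t q | gcd[m,n]∣n t q
    ... | zero        | divides a refl | _ rewrite *-zeroʳ a with () ← proj₁ (∈-[1⋯]⁻ t∈)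
    ... | suc zero    | _ | _ = contradiction refl gcd≢1
    ... | suc (suc i) | divides a t≡ | divides b q≡ = ∈-concatMap multiples (∈-upTo⁺ i<N)
          (subst (_∈ multiples i) (sym (cong₂ _,_ t≡ q≡))
            (∈-map⁺ _ (∈-cartesianProduct⁺ (quotient∈ a t∈ t≡) (quotient∈ b q∈ q≡))))
      where
      i<N : i < N
      i<N = ≤-trans (n≤1+n (suc i)) (≤-trans (∣⇒≤ {{>-nonZero (proj₁ (∈-[1⋯]⁻ t∈))}} (divides a t≡)) (proj₂ (∈-[1⋯]⁻ t∈)))
    covered : length (filter (¬? ∘ coprime?) (pairs N)) ≤ length (concatMap multiples (upTo N))
    covered = length-⊆ (Unique.filter⁺ (¬? ∘ coprime?) (pairs-unique N)) covers
    total : ∀ j → 4 * ∑ (upTo j) f ≤ 3 * (N * N)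
    total zero    = z≤n
    total (suc j) = begin
      4 * ∑ (upTo (suc j)) f ≡⟨ cong (4 *_) (∑-upTo-shift j f) ⟩
      4 * ((N / 2) * (N / 2) + ∑ (upTo j) (f ∘ suc)) ≡⟨ lemma₁ (N / 2) (∑ (upTo j) (f ∘ suc)) ⟩
      (N / 2 * 2) * (N / 2 * 2) + 2 * (2 * ∑ (upTo j) (f ∘ suc))
        ≤⟨ +-mono-≤ (*-mono-≤ (m/n*n≤m N 2) (m/n*n≤m N 2)) (*-monoʳ-≤ 2 (*-cancelˡ-≤ {2 * ∑ (upTo j) (f ∘ suc)} {N * N} (2 + j) (begin
          (2 + j) * (2 * ∑ (upTo j) (f ∘ suc)) ≡⟨ lemma₂ (2 + j) (∑ (upTo j) (f ∘ suc)) ⟩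
          2 * (2 + j) * ∑ (upTo j) (f ∘ suc) ≤⟨ ∑-floor² 2 j N ⟩
          j * (N * N) ≤⟨ *-monoˡ-≤ (N * N) (≤-trans (n≤1+n j) (n≤1+n (suc j))) ⟩
          (2 + j) * (N * N) ∎))) ⟩
      N * N + 2 * (N * N) ∎
      where
      open ≤-Reasoning
      lemma₁ : ∀ a b → 4 * (a * a + b) ≡ (a * 2) * (a * 2) + 2 * (2 * b)
      lemma₁ = solve-∀
      lemma₂ : ∀ a b → a * (2 * b) ≡ 2 * a * b
      lemma₂ = solve-∀

  coprime-count : ∀ N → N * N ≤ 4 * length (filter coprime? (pairs N))
  coprime-count N = +-cancelʳ-≤ (3 * (N * N)) (N * N) _ (begin
    N * N + 3 * (N * N) ≡⟨⟩
    4 * (N * N) ≡⟨ cong (4 *_) (trans (length-filter-split coprime? (pairs N)) (length-pairs N)) ⟨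
    4 * (length good + length bad) ≡⟨ *-distribˡ-+ 4 (length good) (length bad) ⟩
    4 * length good + 4 * length bad ≤⟨ +-monoʳ-≤ (4 * length good) (nonCoprime-count N) ⟩
    4 * length good + 3 * (N * N) ∎)
    where
    open ≤-Reasoning
    good = filter coprime? (pairs N)
    bad = filter (¬? ∘ coprime?) (pairs N)

  largeDenominator? : ∀ Q (p : ℕ × ℕ) → Dec (Q < proj₂ p)
  largeDenominator? Q p = Q <? proj₂ p

  fractions : ℕ → List (ℕ × ℕ)
  fractions Q = filter (largeDenominator? Q) (filter coprime? (pairs (8 * Q)))

  fractions-unique : ∀ Q → Unique (fractions Q)
  fractions-unique Q = Unique.filter⁺ (largeDenominator? Q) (Unique.filter⁺ coprime? (pairs-unique (8 * Q)))

  ∈-fractions⁻ : ∀ Q {t q} → (t , q) ∈ fractions Q → 1 ≤ t × t ≤ 8 * Q × Q < q × q ≤ 8 * Q × gcd t q ≡ 1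
  ∈-fractions⁻ Q p∈ with ∈-filter⁻ (largeDenominator? Q) p∈
  ... | p∈′ , Q<q with ∈-filter⁻ coprime? {xs = pairs (8 * Q)} p∈′
  ... | p∈pairs , cop with ∈-cartesianProduct⁻ [1⋯ 8 * Q ] [1⋯ 8 * Q ] p∈pairs
  ... | t∈ , q∈ = proj₁ (∈-[1⋯]⁻ t∈) , proj₂ (∈-[1⋯]⁻ t∈) , Q<q , proj₂ (∈-[1⋯]⁻ q∈) , cop

  -- At least a quarter of the 64 Q² pairs are coprime, and at most 8 Q² pairs have a denominator up
  -- to `Q`. The ratio 8 is the first power of two beyond 4, where the difference would vanish.
  fractions-count : ∀ Q → 8 * (Q * Q) ≤ length (fractions Q)
  fractions-count Q = *-cancelˡ-≤ 4 (+-cancelʳ-≤ (4 * (8 * Q * Q)) (4 * (8 * (Q * Q))) _ (begin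
    4 * (8 * (Q * Q)) + 4 * (8 * Q * Q) ≡⟨ lemma Q ⟩
    8 * Q * (8 * Q) ≤⟨ coprime-count (8 * Q) ⟩
    4 * length cop ≡⟨ cong (4 *_) (length-filter-split (largeDenominator? Q) cop) ⟨
    4 * (length (fractions Q) + length small) ≤⟨ *-monoʳ-≤ 4 (+-monoʳ-≤ (length (fractions Q)) small≤) ⟩
    4 * (length (fractions Q) + 8 * Q * Q) ≡⟨ *-distribˡ-+ 4 (length (fractions Q)) (8 * Q * Q) ⟩
    4 * length (fractions Q) + 4 * (8 * Q * Q) ∎))
    where
    open ≤-Reasoning
    cop = filter coprime? (pairs (8 * Q))
    small = filter (¬? ∘ largeDenominator? Q) cop
    lemma : ∀ Q → 4 * (8 * (Q * Q)) + 4 * (8 * Q * Q) ≡ 8 * Q * (8 * Q)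
    lemma = solve-∀
    small⊆ : ∀ {p} → p ∈ small → p ∈ cartesianProduct [1⋯ 8 * Q ] [1⋯ Q ]
    small⊆ {t , q} p∈ with ∈-filter⁻ (¬? ∘ largeDenominator? Q) {xs = cop} p∈
    ... | p∈′ , Q≮q with ∈-cartesianProduct⁻ [1⋯ 8 * Q ] [1⋯ 8 * Q ] (proj₁ (∈-filter⁻ coprime? {xs = pairs (8 * Q)} p∈′))
    ... | t∈ , q∈ = ∈-cartesianProduct⁺ t∈ (∈-[1⋯]⁺ (proj₁ (∈-[1⋯]⁻ q∈)) (≮⇒≥ Q≮q))
    small≤ : length small ≤ 8 * Q * Q
    small≤ = ≤-trans (length-⊆ (Unique.filter⁺ (¬? ∘ largeDenominator? Q) (Unique.filter⁺ coprime? (pairs-unique (8 * Q)))) small⊆)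
      (≤-reflexive (trans (length-cartesianProductWith _,_ [1⋯ 8 * Q ] [1⋯ Q ])
        (cong₂ _*_ (length-[1⋯] (8 * Q)) (length-[1⋯] Q))))

-- Certificates for upper and lower bounds on the rank

module Rank where
  open Counting
  open import Data.Fin.Base using (Fin; zero; suc)
  open import Data.Fin.Properties using (any?)
  import Data.Fin.Properties as Fin
  open import Data.Fin.Subset using (Subset; inside; outside; _∈_; _∉_; ∣_∣; ⊥)
  open import Data.Fin.Subset.Properties using (_∈?_; ∣⊥∣≡0; ∉⊥)
  open import Data.Integer.Base as ℤ using (ℤ; 0ℤ)
  import Data.Integer.Properties as ℤ
  open import Data.List.Base using ([]; _∷_)
  open import Data.List.Extrema.Nat using (max≤v⁺; xs≤max)
  open import Data.List.Membership.Propositional using () renaming (_∈_ to _∈ˡ_)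
  open import Data.List.Membership.Propositional.Properties using (∈-map⁺; ∈-filter⁺; ∈-filter⁻)
  import Data.List.Relation.Unary.All as All
  import Data.List.Relation.Unary.All.Properties as All
  open import Data.List.Relation.Unary.Any using (here; there)
  open import Data.Nat.Base as ℕ using (ℕ; zero; suc; z≤n)
  import Data.Nat.Properties as ℕ
  open import Data.Rational.Base using (ℚ; 0ℚ; 1ℚ; _+_; _*_; -_; _/_; 1/_; ≢-nonZero; toℚᵘ)
  open import Data.Rational.Properties
    using (_≟_; 1≢0; +-identityʳ; *-assoc; *-comm; *-identityˡ; *-inverseˡ; *-zeroˡ; *-zeroʳ; toℚᵘ-injective;
           toℚᵘ-fromℚᵘ; toℚᵘ-homo-+; toℚᵘ-homo-*)
  open import Data.Rational.Solver using (module +-*-Solver)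
  open import Data.Rational.Unnormalised.Base as ℚᵘ using (mkℚᵘ; *≡*)
  import Data.Rational.Unnormalised.Properties as ℚᵘ
  open import Data.Sum.Base using (_⊎_; inj₁; inj₂)
  open import Data.Vec.Base using ([]; _∷_; lookup; _[_]≔_; here; there)
  open import Relation.Nullary.Decidable using (_×-dec_; decidable-stable)
  open RationalSums
  module Z = IntegerSums

  opaque
    fromℤ : ℤ → ℚ
    fromℤ i = i / 1

    -- In unnormalised rationals an integer keeps the denominator 1, so the laws below reduce to
    -- laws of integers.
    toℚᵘ-fromℤ : ∀ i → toℚᵘ (fromℤ i) ℚᵘ.≃ mkℚᵘ i 0
    toℚᵘ-fromℤ i = toℚᵘ-fromℚᵘ (mkℚᵘ i 0)

    fromℤ-+ : ∀ i j → fromℤ (i ℤ.+ j) ≡ fromℤ i + fromℤ j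
    fromℤ-+ i j = toℚᵘ-injective (begin
      toℚᵘ (fromℤ (i ℤ.+ j)) ≈⟨ toℚᵘ-fromℤ (i ℤ.+ j) ⟩
      mkℚᵘ (i ℤ.+ j) 0 ≈⟨ *≡* (cong (ℤ._* ℤ.+ 1) (sym (cong₂ ℤ._+_ (ℤ.*-identityʳ i) (ℤ.*-identityʳ j)))) ⟩
      mkℚᵘ i 0 ℚᵘ.+ mkℚᵘ j 0 ≈⟨ ℚᵘ.+-cong (toℚᵘ-fromℤ i) (toℚᵘ-fromℤ j) ⟨
      toℚᵘ (fromℤ i) ℚᵘ.+ toℚᵘ (fromℤ j) ≈⟨ toℚᵘ-homo-+ (fromℤ i) (fromℤ j) ⟨
      toℚᵘ (fromℤ i + fromℤ j) ∎)
      where open import Relation.Binary.Reasoning.Setoid ℚᵘ.≃-setoid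

    fromℤ-* : ∀ i j → fromℤ (i ℤ.* j) ≡ fromℤ i * fromℤ j
    fromℤ-* i j = toℚᵘ-injective (begin
      toℚᵘ (fromℤ (i ℤ.* j)) ≈⟨ toℚᵘ-fromℤ (i ℤ.* j) ⟩
      mkℚᵘ i 0 ℚᵘ.* mkℚᵘ j 0 ≈⟨ ℚᵘ.*-cong (toℚᵘ-fromℤ i) (toℚᵘ-fromℤ j) ⟨
      toℚᵘ (fromℤ i) ℚᵘ.* toℚᵘ (fromℤ j) ≈⟨ toℚᵘ-homo-* (fromℤ i) (fromℤ j) ⟨
      toℚᵘ (fromℤ i * fromℤ j) ∎)
      where open import Relation.Binary.Reasoning.Setoid ℚᵘ.≃-setoid

    fromℤ-injective : ∀ {i j} → fromℤ i ≡ fromℤ j → i ≡ j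
    fromℤ-injective {i} {j} eq
      with *≡* p ← ℚᵘ.≃-trans (ℚᵘ.≃-sym (toℚᵘ-fromℤ i)) (ℚᵘ.≃-trans (ℚᵘ.≃-reflexive (cong toℚᵘ eq)) (toℚᵘ-fromℤ j)) =
      trans (sym (ℤ.*-identityʳ i)) (trans p (ℤ.*-identityʳ j))

    fromℕ≡fromℤ : ∀ m → fromℕ m ≡ fromℤ (ℤ.+ m)
    fromℕ≡fromℤ m = refl

    fromℤ-0 : fromℤ 0ℤ ≡ 0ℚ
    fromℤ-0 = refl

    fromℤ-1 : fromℤ (ℤ.+ 1) ≡ 1ℚ
    fromℤ-1 = refl

  fromℤ-sum : ∀ {n} (f : Fin n → ℤ) → fromℤ (Z.sum f) ≡ sum (fromℤ ∘ f)
  fromℤ-sum {zero}  f = fromℤ-0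
  fromℤ-sum {suc n} f = trans (fromℤ-+ (f zero) (Z.sum (f ∘ suc))) (cong (fromℤ (f zero) +_) (fromℤ-sum (f ∘ suc)))

  fromℤ-δ : ∀ {n} (i j : Fin n) → fromℤ (Z.δ i j) ≡ δ i j
  fromℤ-δ zero    zero    = fromℤ-1
  fromℤ-δ zero    (suc j) = fromℤ-0
  fromℤ-δ (suc i) zero    = fromℤ-0
  fromℤ-δ (suc i) (suc j) = fromℤ-δ i j

  *-cancel-zero : ∀ {a} → a ≢ 0ℚ → ∀ x → a * x ≡ 0ℚ → x ≡ 0ℚ
  *-cancel-zero {a} a≢0 x ax≡0 = begin
    x ≡⟨ *-identityˡ x ⟨
    1ℚ * x ≡⟨ cong (_* x) (*-inverseˡ a) ⟨
    1/ a * a * x ≡⟨ *-assoc (1/ a) a x ⟩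
    1/ a * (a * x) ≡⟨ cong (1/ a *_) ax≡0 ⟩
    1/ a * 0ℚ ≡⟨ *-zeroʳ (1/ a) ⟩
    0ℚ ∎
    where
    open ≡-Reasoning
    instance a-nonZero = ≢-nonZero a≢0

  δ-refl : ∀ {n} (i : Fin n) → δ i i ≡ 1ℚ
  δ-refl zero    = refl
  δ-refl (suc i) = δ-refl i

  δ-≢ : ∀ {n} {i j : Fin n} → i ≢ j → δ i j ≡ 0ℚ
  δ-≢ {i = zero}  {zero}  i≢j = contradiction refl i≢j
  δ-≢ {i = zero}  {suc j} i≢j = refl
  δ-≢ {i = suc i} {zero}  i≢j = refl
  δ-≢ {i = suc i} {suc j} i≢j = δ-≢ (i≢j ∘ cong suc)

  ∣remove∣ : ∀ {r} (S : Subset r) p → p ∈ S → ∣ S ∣ ≡ suc ∣ S [ p ]≔ outside ∣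
  ∣remove∣ (inside ∷ S)  zero    here        = refl
  ∣remove∣ (inside ∷ S)  (suc p) (there p∈S) = cong suc (∣remove∣ S p p∈S)
  ∣remove∣ (outside ∷ S) (suc p) (there p∈S) = ∣remove∣ S p p∈S

  ∉-remove : ∀ {r} (S : Subset r) p → p ∉ S [ p ]≔ outside
  ∉-remove (_ ∷ S) (suc p) (there p∈) = ∉-remove S p p∈

  remove-⊆ : ∀ {r} (S : Subset r) p {j} → j ∈ S [ p ]≔ outside → j ∈ S
  remove-⊆ (_ ∷ S) zero    (there j∈) = there j∈
  remove-⊆ (_ ∷ S) (suc p) here       = here
  remove-⊆ (_ ∷ S) (suc p) (there j∈) = there (remove-⊆ S p j∈)

  ∣insert∣ : ∀ {r} (S : Subset r) p → p ∉ S → ∣ S [ p ]≔ inside ∣ ≡ suc ∣ S ∣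
  ∣insert∣ (inside ∷ S)  zero    p∉S = contradiction here p∉S
  ∣insert∣ (outside ∷ S) zero    p∉S = refl
  ∣insert∣ (inside ∷ S)  (suc p) p∉S = cong suc (∣insert∣ S p (p∉S ∘ there))
  ∣insert∣ (outside ∷ S) (suc p) p∉S = ∣insert∣ S p (p∉S ∘ there)

  ∈-insert⁻ : ∀ {r} (S : Subset r) p {j} → j ∈ S [ p ]≔ inside → j ≡ p ⊎ j ∈ S
  ∈-insert⁻ (_ ∷ S) zero    here       = inj₁ refl
  ∈-insert⁻ (_ ∷ S) zero    (there j∈) = inj₂ (there j∈)
  ∈-insert⁻ (_ ∷ S) (suc p) here       = inj₂ here
  ∈-insert⁻ (_ ∷ S) (suc p) (there j∈) with ∈-insert⁻ S p j∈
  ... | inj₁ j≡p = inj₁ (cong suc j≡p)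
  ... | inj₂ j∈S = inj₂ (there j∈S)

  nonempty : ∀ {r} (S : Subset r) → 0 ℕ.< ∣ S ∣ → ∃[ j ] j ∈ S
  nonempty (inside ∷ S)  _ = zero , here
  nonempty (outside ∷ S) 0<∣S∣ = let j , j∈S = nonempty S 0<∣S∣ in suc j , there j∈S

  -- Elimination on the equations: with a pivot `B zero p` in `S`, the other equations are freed of
  -- the unknown `p` and solved on `S` without `p`. If row zero vanishes on `S`, anything supported
  -- there satisfies it. Each step uses up one equation and at most one unknown.
  homogeneous-solution : ∀ {r} k (S : Subset r) (B : Fin k → Fin r → ℚ) → k ℕ.< ∣ S ∣ →
    Σ[ c ∈ (Fin r → ℚ) ] (∀ j → j ∉ S → c j ≡ 0ℚ) × (∀ l → sum (λ j → c j * B l j) ≡ 0ℚ) × ∃[ j ] c j ≢ 0ℚ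
  homogeneous-solution zero S B 0<∣S∣ = let j , j∈S = nonempty S 0<∣S∣ in
    δ j , (λ i i∉S → δ-≢ {i = j} {i} λ { refl → i∉S j∈S }) , (λ ()) , j , λ δ≡0 → 1≢0 (trans (sym (δ-refl j)) δ≡0)
  homogeneous-solution (suc k) S B k<∣S∣ with any? (λ j → (j ∈? S) ×-dec (¬? (B zero j ≟ 0ℚ)))
  ... | no ∄pivot =
    let c , c∉ , Bc≡0 , nontrivial = homogeneous-solution k S (B ∘ suc) (ℕ.<-trans (ℕ.n<1+n k) k<∣S∣)
        row₀ : ∀ j → c j * B zero j ≡ 0ℚ
        row₀ j = case j ∈? S of λ where
          (no j∉S)  → trans (cong (_* B zero j) (c∉ j j∉S)) (*-zeroˡ (B zero j))
          (yes j∈S) → trans (cong (c j *_) (decidable-stable (B zero j ≟ 0ℚ) λ b≢0 → ∄pivot (j , j∈S , b≢0))) (*-zeroʳ (c j))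
    in c , c∉ , (λ { zero → sum-zero _ row₀ ; (suc l) → Bc≡0 l }) , nontrivial
  ... | yes (p , p∈S , a≢0) = c , c∉ , Bc≡0 , j₀ , cj₀≢0
    where
    a = B zero p
    S′ = S [ p ]≔ outside
    B′ : Fin k → Fin _ → ℚ
    B′ l j = a * B (suc l) j + (- B (suc l) p) * B zero j
    IH = homogeneous-solution k S′ B′ (ℕ.≤-pred (subst (suc k ℕ.<_) (∣remove∣ S p p∈S) k<∣S∣))
    c′ = proj₁ IH
    c′∉ = proj₁ (proj₂ IH)
    B′c′≡0 = proj₁ (proj₂ (proj₂ IH))
    j₀ = proj₁ (proj₂ (proj₂ (proj₂ IH)))
    s : Fin (suc k) → ℚ
    s l = sum (λ j → c′ j * B l j)
    -- Scaling by the pivot avoids division. The entry at `p`, where `c′` is 0, is chosen to make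
    -- equation zero hold.
    c : Fin _ → ℚ
    c j = a * c′ j + (- s zero) * δ p j
    c∉ : ∀ j → j ∉ S → c j ≡ 0ℚ
    c∉ j j∉S = trans (cong₂ (λ x y → a * x + (- s zero) * y) (c′∉ j (j∉S ∘ remove-⊆ S p)) (δ-≢ {i = p} {j} λ { refl → j∉S p∈S }))
      (cong₂ _+_ (*-zeroʳ a) (*-zeroʳ (- s zero)))
    combine : ∀ l → sum (λ j → c j * B l j) ≡ a * s l + (- s zero) * B l p
    combine l = trans (sum-cong-≗ (λ j → lemma a (c′ j) (- s zero) (δ p j) (B l j)))
      (trans (sum-linear a (- s zero) (λ j → c′ j * B l j) (λ j → δ p j * B l j))
        (cong (λ x → a * s l + (- s zero) * x) (sum-δ p (B l))))
      where
      lemma : ∀ a x b y z → (a * x + b * y) * z ≡ a * (x * z) + b * (y * z)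
      lemma = solve 5 (λ a x b y z → (a :* x :+ b :* y) :* z := a :* (x :* z) :+ b :* (y :* z)) refl
        where open +-*-Solver
    Bc≡0 : ∀ l → sum (λ j → c j * B l j) ≡ 0ℚ
    Bc≡0 zero    = trans (combine zero) (lemma a (s zero))
      where
      lemma : ∀ a x → a * x + (- x) * a ≡ 0ℚ
      lemma = solve 2 (λ a x → a :* x :+ (:- x) :* a := con 0ℚ) refl
        where open +-*-Solver
    Bc≡0 (suc l) = trans (combine (suc l)) (trans (lemma₁ a (s (suc l)) (s zero) (B (suc l) p))
      (trans (sym (sum-linear a (- B (suc l) p) (λ j → c′ j * B (suc l) j) (λ j → c′ j * B zero j)))
        (trans (sum-cong-≗ (λ j → lemma₂ a (c′ j) (B (suc l) j) (B (suc l) p) (B zero j))) (B′c′≡0 l))))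
      where
      lemma₁ : ∀ a x y z → a * x + (- y) * z ≡ a * x + (- z) * y
      lemma₁ = solve 4 (λ a x y z → a :* x :+ (:- y) :* z := a :* x :+ (:- z) :* y) refl
        where open +-*-Solver
      lemma₂ : ∀ a c x b y → a * (c * x) + (- b) * (c * y) ≡ c * (a * x + (- b) * y)
      lemma₂ = solve 5 (λ a c x b y → a :* (c :* x) :+ (:- b) :* (c :* y) := c :* (a :* x :+ (:- b) :* y)) refl
        where open +-*-Solver
    c′j₀≢0 : c′ j₀ ≢ 0ℚ
    c′j₀≢0 = proj₂ (proj₂ (proj₂ (proj₂ IH)))
    -- `c′` vanishes at `p`, so `j₀` differs from `p` and the correction does not touch it.
    cj₀≢0 : c j₀ ≢ 0ℚ
    cj₀≢0 cj₀≡0 = c′j₀≢0 (*-cancel-zero a≢0 (c′ j₀) (trans (sym (trans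
      (cong (λ x → a * c′ j₀ + (- s zero) * x) (δ-≢ {i = p} {j₀} λ p≡j₀ → c′j₀≢0 (c′∉ j₀ (subst (_∉ S′) p≡j₀ (∉-remove S p)))))
      (trans (cong (a * c′ j₀ +_) (*-zeroʳ (- s zero))) (+-identityʳ (a * c′ j₀))))) cj₀≡0))

  image : ∀ {k r} (γ : Fin k → Fin r) → (∀ {s s′} → γ s ≡ γ s′ → s ≡ s′) →
    ∃[ S ] ∣ S ∣ ≡ k × (∀ {j} → j ∈ S → ∃[ s ] γ s ≡ j)
  image {zero}  {r} γ inj = ⊥ , ∣⊥∣≡0 r , λ j∈ → contradiction j∈ ∉⊥
  image {suc k} γ inj with image (γ ∘ suc) (Fin.suc-injective ∘ inj)
  ... | S , ∣S∣≡k , S⊆ = S [ γ zero ]≔ inside ,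
      trans (∣insert∣ S (γ zero) (λ γ₀∈S → let s , eq = S⊆ γ₀∈S in case inj eq of λ ())) (cong suc ∣S∣≡k) ,
      λ j∈ → case ∈-insert⁻ S (γ zero) j∈ of λ where
        (inj₁ j≡γ₀) → zero , sym j≡γ₀
        (inj₂ j∈S)  → let s , eq = S⊆ j∈S in suc s , eq

  -- The hypothesis expresses by annihilators that the rows of the matrix with columns `v` are
  -- spanned by the `k` rows of `B`. More than `k` columns support a nontrivial vector annihilated
  -- by `B`, hence a relation among them.
  independent≤ : ∀ {d r} (v : Fin r → Fin d → ℚ) k (B : Fin k → Fin r → ℚ) →
    (∀ c → (∀ l → sum (λ j → c j * B l j) ≡ 0ℚ) → ∀ i → combination v c i ≡ 0ℚ) →
    ∀ S → LinearlyIndependent v S → ∣ S ∣ ℕ.≤ k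
  independent≤ v k B B⇒v S ind with ∣ S ∣ ℕ.≤? k
  ... | yes ∣S∣≤k = ∣S∣≤k
  ... | no  ∣S∣≰k with homogeneous-solution k S B (ℕ.≰⇒> ∣S∣≰k)
  ... | c , c∉ , Bc≡0 , j , cj≢0 = contradiction (ind c c∉ (B⇒v c Bc≡0) j) cj≢0

  rank≤ : ∀ {d r} (M : Matrix d r) k (B : Fin k → Fin r → ℚ) →
    (∀ c → (∀ l → sum (λ j → c j * B l j) ≡ 0ℚ) → ∀ i → combination (columns M) c i ≡ 0ℚ) → rank M ℕ.≤ k
  rank≤ {r = r} M k B B⇒M = max≤v⁺ z≤n (All.map⁺ (All.tabulate λ {S} S∈ → independent≤ (columns M) k B B⇒M S
    (proj₂ (∈-filter⁻ (linearlyIndependent? (columns M)) {xs = vectorsOver (outside ∷ inside ∷ []) r} S∈))))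

  ∣independent∣≤rank : ∀ {d r} (M : Matrix d r) S → LinearlyIndependent (columns M) S → ∣ S ∣ ℕ.≤ rank M
  ∣independent∣≤rank M S ind =
    All.lookup (xs≤max 0 _) (∈-map⁺ ∣_∣ (∈-filter⁺ (linearlyIndependent? (columns M)) (∈-vectorsOver⁺ S bits) ind))
    where
    bits : ∀ i → lookup S i ∈ˡ (outside ∷ inside ∷ [])
    bits i with lookup S i
    ... | outside = here refl
    ... | inside  = there (here refl)

  -- `z` is a left inverse, up to the factors `N s`, of the submatrix with rows `ρ` and columns `γ`.
  -- Applied to a relation it isolates the coefficient at `γ s`. It also forces `γ` to be injective,
  -- as equal columns would give `N s` = 0.
  independent-image : ∀ {d r} (v : Fin r → Fin d → ℚ) {k} (ρ : Fin k → Fin d) (γ : Fin k → Fin r)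
    (N : Fin k → ℚ) (z : Fin k → Fin k → ℚ) → (∀ s → N s ≢ 0ℚ) →
    (∀ s s′ → sum (λ l → z s l * v (γ s′) (ρ l)) ≡ N s * δ s s′) →
    ∃[ S ] ∣ S ∣ ≡ k × LinearlyIndependent v S
  independent-image v {k} ρ γ N z N≢0 zv≡Nδ = S , ∣S∣≡k , ind
    where
    injective : ∀ {s s′} → γ s ≡ γ s′ → s ≡ s′
    injective {s} {s′} γs≡γs′ with s Fin.≟ s′
    ... | yes s≡s′ = s≡s′
    ... | no  s≢s′ = contradiction (*-cancel-zero (N≢0 s) 1ℚ (begin
      N s * 1ℚ ≡⟨ cong (N s *_) (δ-refl s) ⟨
      N s * δ s s ≡⟨ zv≡Nδ s s ⟨
      sum (λ l → z s l * v (γ s) (ρ l)) ≡⟨ cong (λ j → sum (λ l → z s l * v j (ρ l))) γs≡γs′ ⟩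
      sum (λ l → z s l * v (γ s′) (ρ l)) ≡⟨ zv≡Nδ s s′ ⟩
      N s * δ s s′ ≡⟨ cong (N s *_) (δ-≢ s≢s′) ⟩
      N s * 0ℚ ≡⟨ *-zeroʳ (N s) ⟩
      0ℚ ∎)) 1≢0
      where open ≡-Reasoning
    S = proj₁ (image γ injective)
    ∣S∣≡k = proj₁ (proj₂ (image γ injective))
    S⊆ : ∀ {j} → j ∈ S → ∃[ s ] γ s ≡ j
    S⊆ = proj₂ (proj₂ (image γ injective))
    δ-γ : ∀ s s′ → δ s s′ ≡ δ (γ s) (γ s′)
    δ-γ s s′ with s Fin.≟ s′
    ... | yes refl = trans (δ-refl s) (sym (δ-refl (γ s)))
    ... | no  s≢s′ = trans (δ-≢ s≢s′) (sym (δ-≢ (s≢s′ ∘ injective)))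
    ind : LinearlyIndependent (v) S
    ind c c∉ vc≡0 j with j ∈? S
    ... | no  j∉S = c∉ j j∉S
    ... | yes j∈S with s , refl ← S⊆ j∈S = *-cancel-zero (N≢0 s) (c (γ s)) (begin
      N s * c (γ s) ≡⟨ cong (N s *_) (sum-δ (γ s) c) ⟨
      N s * sum (λ j → δ (γ s) j * c j) ≡⟨ *-distribˡ-sum (N s) (λ j → δ (γ s) j * c j) ⟩
      sum (λ j → N s * (δ (γ s) j * c j)) ≡⟨ sum-cong-≗ term ⟩
      sum (λ j → c j * sum (λ l → z s l * v j (ρ l))) ≡⟨ sum-swap c (z s) (λ j l → v j (ρ l)) ⟩
      sum (λ l → z s l * sum (λ j → c j * v j (ρ l))) ≡⟨ sum-zero _ (λ l → trans (cong (z s l *_) (vc≡0 (ρ l))) (*-zeroʳ (z s l))) ⟩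
      0ℚ ∎)
      where
      open ≡-Reasoning
      term : ∀ j → N s * (δ (γ s) j * c j) ≡ c j * sum (λ l → z s l * v j (ρ l))
      term j with j ∈? S
      ... | no  j∉S = trans (cong (λ x → N s * (δ (γ s) j * x)) (c∉ j j∉S))
                        (trans (trans (cong (N s *_) (*-zeroʳ (δ (γ s) j))) (*-zeroʳ (N s)))
                          (sym (trans (cong (_* sum (λ l → z s l * v j (ρ l))) (c∉ j j∉S))
                            (*-zeroˡ (sum (λ l → z s l * v j (ρ l)))))))
      ... | yes j∈S with s′ , refl ← S⊆ j∈S = begin
        N s * (δ (γ s) (γ s′) * c (γ s′)) ≡⟨ cong (λ x → N s * (x * c (γ s′))) (δ-γ s s′) ⟨
        N s * (δ s s′ * c (γ s′)) ≡⟨ *-assoc (N s) (δ s s′) (c (γ s′)) ⟨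
        N s * δ s s′ * c (γ s′) ≡⟨ *-comm (N s * δ s s′) (c (γ s′)) ⟩
        c (γ s′) * (N s * δ s s′) ≡⟨ cong (c (γ s′) *_) (zv≡Nδ s s′) ⟨
        c (γ s′) * sum (λ l → z s l * v (γ s′) (ρ l)) ∎

  -- The certificate is integral because elimination supplies it in this form, by solving for the
  -- unit vectors.
  rank≥ : ∀ {d r} (M : Matrix d r) {k} (ρ : Fin k → Fin d) (γ : Fin k → Fin r)
    (N : Fin k → ℤ) (z : Fin k → Fin k → ℤ) → (∀ s → N s ≢ 0ℤ) →
    (∀ s s′ → Z.sum (λ l → z s l ℤ.* ℤ.+ lookup (lookup M (γ s′)) (ρ l)) ≡ N s ℤ.* Z.δ s s′) →
    k ℕ.≤ rank M
  rank≥ M {k} ρ γ N z N≢0 zM≡Nδ =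
    let S , ∣S∣≡k , ind = independent-image (columns M) ρ γ (fromℤ ∘ N) (λ s → fromℤ ∘ z s)
          (λ s eq → N≢0 s (fromℤ-injective (trans eq (sym fromℤ-0)))) rational
    in subst (ℕ._≤ rank M) ∣S∣≡k (∣independent∣≤rank M S ind)
    where
    rational : ∀ s s′ → sum (λ l → fromℤ (z s l) * columns M (γ s′) (ρ l)) ≡ fromℤ (N s) * δ s s′
    rational s s′ = begin
      sum (λ l → fromℤ (z s l) * fromℕ (m l)) ≡⟨ sum-cong-≗ {k} (λ l → trans (cong (fromℤ (z s l) *_) (fromℕ≡fromℤ (m l))) (sym (fromℤ-* (z s l) (ℤ.+ m l)))) ⟩
      sum (λ l → fromℤ (z s l ℤ.* ℤ.+ m l)) ≡⟨ fromℤ-sum (λ l → z s l ℤ.* ℤ.+ m l) ⟨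
      fromℤ (Z.sum (λ l → z s l ℤ.* ℤ.+ m l)) ≡⟨ cong fromℤ (zM≡Nδ s s′) ⟩
      fromℤ (N s ℤ.* Z.δ s s′) ≡⟨ fromℤ-* (N s) (Z.δ s s′) ⟩
      fromℤ (N s) * fromℤ (Z.δ s s′) ≡⟨ cong (fromℤ (N s) *_) (fromℤ-δ s s′) ⟩
      fromℤ (N s) * δ s s′ ∎
      where
      open ≡-Reasoning
      m : Fin k → ℕ
      m l = lookup (lookup M (γ s′)) (ρ l)

-- Fraction-free elimination with bounded coefficients

module GaussianElimination where
  open import Data.Fin.Base using (Fin; zero; suc; punchIn; punchOut)
  open import Data.Fin.Properties using (any?; punchIn-punchOut)
  import Data.Fin.Properties as Fin
  open import Data.Integer.Base using (ℤ; 0ℤ; 1ℤ; _+_; _*_; -_; ∣_∣)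
  open import Data.Integer.Properties
  open import Data.Integer.Tactic.RingSolver using (solve-∀)
  open import Data.Nat.Base as ℕ using (ℕ; zero; suc; z≤n)
  import Data.Nat.Properties as ℕ
  import Data.Nat.Tactic.RingSolver as ℕSolver
  open import Data.Sum.Base using (_⊎_; inj₁; inj₂)
  open import Data.Vec.Functional using (_∷_)
  open import Relation.Nullary.Decidable using (decidable-stable)
  open IntegerSums

  sum-combineˡ : ∀ {n} (x f g : Fin n → ℤ) a b →
    sum (λ i → x i * (a * f i + b * g i)) ≡ a * sum (λ i → x i * f i) + b * sum (λ i → x i * g i)
  sum-combineˡ {n} x f g a b = trans (sum-cong-≗ {n} (λ i → lemma (x i) a (f i) b (g i)))
    (sum-linear a b (λ i → x i * f i) (λ i → x i * g i))
    where
    lemma : ∀ x a f b g → x * (a * f + b * g) ≡ a * (x * f) + b * (x * g)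
    lemma = solve-∀

  sum-combineʳ : ∀ {n} (x f g : Fin n → ℤ) a b →
    sum (λ i → x i * (a * f i + (- g i) * b)) ≡ a * sum (λ i → x i * f i) + (- b) * sum (λ i → x i * g i)
  sum-combineʳ {n} x f g a b = trans (sum-cong-≗ {n} (λ i → cong (λ y → x i * (a * f i + y)) (lemma (g i) b)))
    (sum-combineˡ x f g a (- b))
    where
    lemma : ∀ g b → (- g) * b ≡ (- b) * g
    lemma = solve-∀

  sum-scale : ∀ {n} a (x f : Fin n → ℤ) → sum (λ i → (a * x i) * f i) ≡ a * sum (λ i → x i * f i)
  sum-scale {n} a x f = trans (sum-cong-≗ {n} (λ i → *-assoc a (x i) (f i))) (sym (*-distribˡ-sum a (λ i → x i * f i)))

  ∣sum∣≤ : ∀ {n} (f : Fin n → ℤ) {B} → (∀ i → ∣ f i ∣ ℕ.≤ B) → ∣ sum f ∣ ℕ.≤ n ℕ.* B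
  ∣sum∣≤ {zero}  f f≤B = z≤n
  ∣sum∣≤ {suc n} f f≤B = ℕ.≤-trans (∣i+j∣≤∣i∣+∣j∣ (f zero) (sum (f ∘ suc)))
    (ℕ.+-mono-≤ (f≤B zero) (∣sum∣≤ (f ∘ suc) (f≤B ∘ suc)))

  argmax : ∀ {p} (f : Fin (suc p) → ℕ) → ∃[ i ] (∀ j → f j ℕ.≤ f i)
  argmax {zero}  f = zero , λ { zero → ℕ.≤-refl }
  argmax {suc p} f with argmax (f ∘ suc)
  ... | i , max with f zero ℕ.≤? f (suc i)
  ... | yes f₀≤ = suc i , λ { zero → f₀≤ ; (suc j) → max j }
  ... | no  f₀≰ = zero , λ { zero → ℕ.≤-refl ; (suc j) → ℕ.≤-trans (max j) (ℕ.<⇒≤ (ℕ.≰⇒> f₀≰)) }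

  -- Bounds `X / N`. The new pivot row enters with coefficient (r - ∑ ξₗ rₗ) / a, where pivoting
  -- makes r / a and all rₗ / a at most 1 in absolute value, and the `k` old coefficients ξₗ are at
  -- most `growth k`.
  growth : ℕ → ℕ
  growth zero    = 0
  growth (suc k) = 1 ℕ.+ k ℕ.* growth k

  growth-≤ : ∀ k → growth k ℕ.≤ growth (suc k)
  growth-≤ zero    = z≤n
  growth-≤ (suc k) = ℕ.≤-trans (ℕ.m≤m+n (growth (suc k)) (k ℕ.* growth (suc k))) (ℕ.n≤1+n _)

  -- `N` is a common denominator for the rows `τ` as combinations of the rows `ρ`. `solveʳ` and
  -- `solveˡ` say that the square submatrix at `ρ` and `γ` is invertible over the rationals: the
  -- packing bound needs its columns to span, and the rank bounds need an inverse for the matrix or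
  -- for its transpose.
  record Elimination {p q} (M : Fin p → Fin q → ℤ) : Set where
    field
      {k m} : ℕ
      k+m≡p : k ℕ.+ m ≡ p
      ρ     : Fin k → Fin p
      τ     : Fin m → Fin p
      γ     : Fin k → Fin q
      cover : ∀ i → (∃[ l ] ρ l ≡ i) ⊎ (∃[ t ] τ t ≡ i)
      N     : ℤ
      N≢0   : N ≢ 0ℤ
      X     : Fin m → Fin k → ℤ
      comb  : ∀ t j → N * M (τ t) j ≡ sum (λ l → X t l * M (ρ l) j)
      bound : ∀ t l → ∣ X t l ∣ ℕ.≤ growth k ℕ.* ∣ N ∣
      solveʳ : ∀ (t : Fin k → ℤ) → Σ[ e ∈ ℤ ] Σ[ c ∈ (Fin k → ℤ) ] e ≢ 0ℤ ×
        (∀ l → sum (λ s → c s * M (ρ l) (γ s)) ≡ e * t l)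
      solveˡ : ∀ (t : Fin k → ℤ) → Σ[ e ∈ ℤ ] Σ[ c ∈ (Fin k → ℤ) ] e ≢ 0ℤ ×
        (∀ s → sum (λ l → c l * M (ρ l) (γ s)) ≡ e * t s)

  *-≢0 : ∀ {i j} → i ≢ 0ℤ → j ≢ 0ℤ → i * j ≢ 0ℤ
  *-≢0 {i} {j} i≢0 j≢0 ij≡0 with i*j≡0⇒i≡0∨j≡0 i {j} ij≡0
  ... | inj₁ i≡0 = i≢0 i≡0
  ... | inj₂ j≡0 = j≢0 j≡0

  -- Fraction-free Gaussian elimination with partial pivoting: the pivot has maximal
  -- absolute value in its column, which keeps the coefficients X / N bounded.
  eliminate : ∀ q {p} (M : Fin p → Fin q → ℤ) → Elimination M
  eliminate zero {p} M = record
    { k+m≡p = refl ; ρ = λ () ; τ = id ; γ = λ () ; cover = λ i → inj₂ (i , refl)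
    ; N = 1ℤ ; N≢0 = λ () ; X = λ _ () ; comb = λ _ () ; bound = λ _ ()
    ; solveʳ = λ _ → 1ℤ , (λ ()) , (λ ()) , λ ()
    ; solveˡ = λ _ → 1ℤ , (λ ()) , (λ ()) , λ () }
  eliminate (suc q) {p} M with any? (λ i → ¬? (M i zero ≟ 0ℤ))
  eliminate (suc q) {p} M | no ∄pivot = record
    { k+m≡p = E.k+m≡p ; ρ = E.ρ ; τ = E.τ ; γ = suc ∘ E.γ ; cover = E.cover
    ; N = E.N ; N≢0 = E.N≢0 ; X = E.X ; comb = comb ; bound = E.bound
    ; solveʳ = E.solveʳ ; solveˡ = E.solveˡ }
    where
    module E = Elimination (eliminate q (λ i → M i ∘ suc))
    M₀≡0 : ∀ i → M i zero ≡ 0ℤ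
    M₀≡0 i = decidable-stable (M i zero ≟ 0ℤ) (λ ≢0 → ∄pivot (i , ≢0))
    comb : ∀ t j → E.N * M (E.τ t) j ≡ sum (λ l → E.X t l * M (E.ρ l) j)
    comb t zero    = trans (trans (cong (E.N *_) (M₀≡0 (E.τ t))) (*-zeroʳ E.N))
      (sym (sum-zero _ (λ l → trans (cong (E.X t l *_) (M₀≡0 (E.ρ l))) (*-zeroʳ (E.X t l)))))
    comb t (suc j) = E.comb t j
  eliminate (suc q) {suc p} M | yes (i₁ , M₁≢0) = record
    { k+m≡p = cong suc E.k+m≡p
    ; ρ = i₀ ∷ (punchIn i₀ ∘ E.ρ) ; τ = punchIn i₀ ∘ E.τ ; γ = zero ∷ (suc ∘ E.γ)
    ; cover = cover
    ; N = E.N * a ; N≢0 = *-≢0 E.N≢0 a≢0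
    ; X = X ; comb = comb ; bound = bound
    ; solveʳ = solveʳ ; solveˡ = solveˡ }
    where
    i₀ = proj₁ (argmax (λ i → ∣ M i zero ∣))
    maximal : ∀ i → ∣ M i zero ∣ ℕ.≤ ∣ M i₀ zero ∣
    maximal = proj₂ (argmax (λ i → ∣ M i zero ∣))
    a = M i₀ zero
    a≢0 : a ≢ 0ℤ
    a≢0 a≡0 = M₁≢0 (∣i∣≡0⇒i≡0 (ℕ.n≤0⇒n≡0 (ℕ.≤-trans (maximal i₁) (ℕ.≤-reflexive (cong ∣_∣ a≡0)))))
    R : Fin p → Fin (suc q) → ℤ
    R i = M (punchIn i₀ i)
    -- Clears the pivot column. The recursion sees the other columns only, and `comb′` extends its
    -- relations to column zero, where both sides vanish.
    M′ : Fin p → Fin (suc q) → ℤ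
    M′ i j = a * R i j + (- R i zero) * M i₀ j
    module E = Elimination (eliminate q (λ i → M′ i ∘ suc))

    cover : ∀ i → (∃[ l ] (i₀ ∷ (punchIn i₀ ∘ E.ρ)) l ≡ i) ⊎ (∃[ t ] punchIn i₀ (E.τ t) ≡ i)
    cover i with i₀ Fin.≟ i
    ... | yes i₀≡i = inj₁ (zero , i₀≡i)
    ... | no  i₀≢i with E.cover (punchOut i₀≢i)
    ... | inj₁ (l , ρl≡) = inj₁ (suc l , trans (cong (punchIn i₀) ρl≡) (punchIn-punchOut i₀≢i))
    ... | inj₂ (t , τt≡) = inj₂ (t , trans (cong (punchIn i₀) τt≡) (punchIn-punchOut i₀≢i))

    T : (Fin E.k → ℤ) → ℤ
    T x = sum (λ l → x l * R (E.ρ l) zero)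

    -- Unfolding `M′` in the recursive relation leaves multiples of the pivot row on both sides;
    -- their difference is its coefficient.
    X : Fin E.m → Fin (suc E.k) → ℤ
    X t = (E.N * R (E.τ t) zero + - T (E.X t)) ∷ (λ l → a * E.X t l)

    comb′ : ∀ t j → E.N * M′ (E.τ t) j ≡ sum (λ l → E.X t l * M′ (E.ρ l) j)
    comb′ t (suc j) = E.comb t j
    comb′ t zero    = trans (trans (cong (E.N *_) (lemma a (R (E.τ t) zero))) (*-zeroʳ E.N))
      (sym (sum-zero _ (λ l → trans (cong (E.X t l *_) (lemma a (R (E.ρ l) zero))) (*-zeroʳ (E.X t l)))))
      where
      lemma : ∀ a x → a * x + (- x) * a ≡ 0ℤ
      lemma = solve-∀

    comb : ∀ t j → E.N * a * R (E.τ t) j ≡ sum (λ l → X t l * M ((i₀ ∷ (punchIn i₀ ∘ E.ρ)) l) j)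
    comb t j = begin
      E.N * a * r ≡⟨ lemma₁ E.N a r r₀ u ⟩
      E.N * M′ (E.τ t) j + E.N * r₀ * u ≡⟨ cong (_+ E.N * r₀ * u) (comb′ t j) ⟩
      sum (λ l → x l * M′ (E.ρ l) j) + E.N * r₀ * u ≡⟨ cong (_+ E.N * r₀ * u) (sum-combineʳ x (λ l → R (E.ρ l) j) (λ l → R (E.ρ l) zero) a u) ⟩
      a * S + (- u) * T x + E.N * r₀ * u ≡⟨ lemma₂ (a * S) u (T x) (E.N * r₀) ⟩
      (E.N * r₀ + - T x) * u + a * S ≡⟨ cong ((E.N * r₀ + - T x) * u +_) (sum-scale a x (λ l → R (E.ρ l) j)) ⟨
      (E.N * r₀ + - T x) * u + sum (λ l → (a * x l) * R (E.ρ l) j) ∎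
      where
      open ≡-Reasoning
      r = R (E.τ t) j
      r₀ = R (E.τ t) zero
      u = M i₀ j
      x = E.X t
      S = sum (λ l → x l * R (E.ρ l) j)
      lemma₁ : ∀ n a r r₀ u → n * a * r ≡ n * (a * r + (- r₀) * u) + n * r₀ * u
      lemma₁ = solve-∀
      lemma₂ : ∀ s u t n → s + (- u) * t + n * u ≡ (n + - t) * u + s
      lemma₂ = solve-∀

    bound : ∀ t l → ∣ X t l ∣ ℕ.≤ growth (suc E.k) ℕ.* ∣ E.N * a ∣
    bound t zero = begin
      ∣ E.N * r₀ + - T x ∣ ≤⟨ ∣i+j∣≤∣i∣+∣j∣ (E.N * r₀) (- T x) ⟩
      ∣ E.N * r₀ ∣ ℕ.+ ∣ - T x ∣ ≡⟨ cong₂ ℕ._+_ (abs-* E.N r₀) (∣-i∣≡∣i∣ (T x)) ⟩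
      ∣ E.N ∣ ℕ.* ∣ r₀ ∣ ℕ.+ ∣ T x ∣ ≤⟨ ℕ.+-mono-≤ (ℕ.*-monoʳ-≤ ∣ E.N ∣ (maximal (punchIn i₀ (E.τ t)))) (∣sum∣≤ (λ l → x l * R (E.ρ l) zero) term) ⟩
      ∣ E.N ∣ ℕ.* ∣ a ∣ ℕ.+ E.k ℕ.* (growth E.k ℕ.* ∣ E.N ∣ ℕ.* ∣ a ∣)
                                              ≡⟨ lemma ∣ E.N ∣ ∣ a ∣ E.k (growth E.k) ⟩
      growth (suc E.k) ℕ.* (∣ E.N ∣ ℕ.* ∣ a ∣) ≡⟨ cong (growth (suc E.k) ℕ.*_) (abs-* E.N a) ⟨
      growth (suc E.k) ℕ.* ∣ E.N * a ∣ ∎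
      where
      open ℕ.≤-Reasoning
      x = E.X t
      r₀ = R (E.τ t) zero
      term : ∀ l → ∣ x l * R (E.ρ l) zero ∣ ℕ.≤ growth E.k ℕ.* ∣ E.N ∣ ℕ.* ∣ a ∣
      term l = ℕ.≤-trans (ℕ.≤-reflexive (abs-* (x l) (R (E.ρ l) zero)))
        (ℕ.*-mono-≤ (E.bound t l) (maximal (punchIn i₀ (E.ρ l))))
      lemma : ∀ n a k g → n ℕ.* a ℕ.+ k ℕ.* (g ℕ.* n ℕ.* a) ≡ (1 ℕ.+ k ℕ.* g) ℕ.* (n ℕ.* a)
      lemma = ℕSolver.solve-∀
    bound t (suc l) = begin
      ∣ a * E.X t l ∣ ≡⟨ trans (abs-* a (E.X t l)) (ℕ.*-comm ∣ a ∣ ∣ E.X t l ∣) ⟩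
      ∣ E.X t l ∣ ℕ.* ∣ a ∣ ≤⟨ ℕ.*-monoˡ-≤ ∣ a ∣ (E.bound t l) ⟩
      growth E.k ℕ.* ∣ E.N ∣ ℕ.* ∣ a ∣ ≡⟨ ℕ.*-assoc (growth E.k) ∣ E.N ∣ ∣ a ∣ ⟩
      growth E.k ℕ.* (∣ E.N ∣ ℕ.* ∣ a ∣) ≤⟨ ℕ.*-monoˡ-≤ (∣ E.N ∣ ℕ.* ∣ a ∣) (growth-≤ E.k) ⟩
      growth (suc E.k) ℕ.* (∣ E.N ∣ ℕ.* ∣ a ∣) ≡⟨ cong (growth (suc E.k) ℕ.*_) (abs-* E.N a) ⟨
      growth (suc E.k) ℕ.* ∣ E.N * a ∣ ∎
      where open ℕ.≤-Reasoning

    W : Fin (suc E.k) → Fin (suc E.k) → ℤ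
    W l s = M ((i₀ ∷ (punchIn i₀ ∘ E.ρ)) l) ((zero ∷ (suc ∘ E.γ)) s)

    lemma₀ : ∀ e t u a → (e * t + - u) * a + a * u ≡ a * e * t
    lemma₀ = solve-∀

    -- Serves `solveʳ` and `solveˡ` alike: the right-hand side is reduced in the same way as the
    -- matrix, and `e * t₀ + - u` is the coefficient of the pivot that its own equation forces.
    solve-step : ∀ e t₀ u m a v t → a * v + (- m) * u ≡ e * (a * t + (- m) * t₀) →
      (e * t₀ + - u) * m + a * v ≡ a * e * t
    solve-step e t₀ u m a v t eq = trans (lemma₁ e t₀ u m (a * v)) (trans (cong (_+ e * t₀ * m) eq) (lemma₂ e t₀ m a t))
      where
      lemma₁ : ∀ e t u m w → (e * t + - u) * m + w ≡ w + (- m) * u + e * t * m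
      lemma₁ = solve-∀
      lemma₂ : ∀ e t₀ m a t → e * (a * t + (- m) * t₀) + e * t₀ * m ≡ a * e * t
      lemma₂ = solve-∀

    solveʳ : ∀ (t : Fin (suc E.k) → ℤ) → Σ[ e ∈ ℤ ] Σ[ c ∈ (Fin (suc E.k) → ℤ) ] e ≢ 0ℤ ×
      (∀ l → sum (λ s → c s * W l s) ≡ e * t l)
    solveʳ t with E.solveʳ (λ l → a * t (suc l) + (- R (E.ρ l) zero) * t zero)
    ... | e , c , e≢0 , eq = a * e , ((e * t zero + - U) ∷ λ s → a * c s) , *-≢0 a≢0 e≢0 , λ where
        zero    → trans (cong ((e * t zero + - U) * a +_) (sum-scale a c (λ s → M i₀ (suc (E.γ s)))))
                    (lemma₀ e (t zero) U a)
        (suc l) → trans (cong ((e * t zero + - U) * R (E.ρ l) zero +_) (sum-scale a c (λ s → R (E.ρ l) (suc (E.γ s)))))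
                    (solve-step e (t zero) U (R (E.ρ l) zero) a (sum (λ s → c s * R (E.ρ l) (suc (E.γ s)))) (t (suc l))
                      (trans (sym (sum-combineˡ c (λ s → R (E.ρ l) (suc (E.γ s))) (λ s → M i₀ (suc (E.γ s))) a (- R (E.ρ l) zero))) (eq l)))
      where
      U = sum (λ s → c s * M i₀ (suc (E.γ s)))

    solveˡ : ∀ (t : Fin (suc E.k) → ℤ) → Σ[ e ∈ ℤ ] Σ[ c ∈ (Fin (suc E.k) → ℤ) ] e ≢ 0ℤ ×
      (∀ s → sum (λ l → c l * W l s) ≡ e * t s)
    solveˡ t with E.solveˡ (λ s → a * t (suc s) + (- M i₀ (suc (E.γ s))) * t zero)
    ... | e , c , e≢0 , eq = a * e , ((e * t zero + - T c) ∷ λ l → a * c l) , *-≢0 a≢0 e≢0 , λ where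
        zero    → trans (cong ((e * t zero + - T c) * a +_) (sum-scale a c (λ l → R (E.ρ l) zero)))
                    (lemma₀ e (t zero) (T c) a)
        (suc s) → let j = suc (E.γ s) in
                  trans (cong ((e * t zero + - T c) * M i₀ j +_) (sum-scale a c (λ l → R (E.ρ l) j)))
                    (solve-step e (t zero) (T c) (M i₀ j) a (sum (λ l → c l * R (E.ρ l) j)) (t (suc s))
                      (trans (sym (sum-combineʳ c (λ l → R (E.ρ l) j) (λ l → R (E.ρ l) zero) a (M i₀ j))) (eq s)))

-- Hermite forms of lattices, and bounded row vectors in their coordinates

module HermiteForms where
  open Counting
  open GaussianElimination using (sum-combineˡ; sum-scale; ∣sum∣≤)
  open import Data.Fin.Base using (Fin; zero; suc)
  open import Data.Integer.Base using (ℤ; +_; -[1+_]; 0ℤ; 1ℤ; _+_; _*_; -_; ∣_∣)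
  open import Data.Integer.DivMod using (_/ℕ_; _%ℕ_; n%ℕd<d; a≡a%ℕn+[a/ℕn]*n)
  open import Data.Integer.Properties
  open import Data.Integer.Tactic.RingSolver using (solve-∀)
  open import Data.List.Base using (List; []; _∷_; _++_; map; length; upTo; concatMap; cartesianProductWith)
  open import Data.List.Membership.Propositional using (_∈_; find; lose)
  open import Data.List.Membership.Propositional.Properties
    using (∈-map⁺; ∈-++⁺ˡ; ∈-++⁺ʳ; ∈-upTo⁺; ∈-upTo⁻; ∈-cartesianProductWith⁺; ∈-cartesianProductWith⁻)
  open import Data.List.Properties using (length-map; length-++; length-upTo)
  open import Data.List.Relation.Unary.Any as Any using (here)
  open import Data.List.Relation.Unary.Unique.Propositional using (Unique; []; _∷_)
  open import Data.List.Relation.Unary.All using ([])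
  import Data.List.Relation.Unary.Unique.Propositional.Properties as Unique
  open import Data.Nat.Base as ℕ using (ℕ; zero; suc; z≤n; s≤s)
  import Data.Nat.Properties as ℕ
  import Data.Nat.Tactic.RingSolver as ℕSolver
  open import Data.Unit.Base using (⊤; tt)
  open import Data.Vec.Base using (Vec; []; _∷_; lookup; tabulate; replicate)
  open import Data.Vec.Functional as Vector using (Vector)
  open import Data.Vec.Properties using (lookup∘tabulate; lookup-replicate; ∷-injective)
  open IntegerSums

  -- A lower triangular matrix with positive diagonal: cons δ h H has the first
  -- column (suc δ , h) and the lower right block H.
  data Triangular : ℕ → Set where
    []   : Triangular 0
    cons : ∀ {k} (δ : ℕ) (h : Vec ℕ k) (H : Triangular k) → Triangular (suc k)

  det : ∀ {k} → Triangular k → ℕ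
  det []           = 1
  det (cons δ h H) = suc δ ℕ.* det H

  det-nonZero : ∀ {k} (H : Triangular k) → ℕ.NonZero (det H)
  det-nonZero []           = _
  det-nonZero (cons δ h H) = ℕ.m*n≢0 (suc δ) (det H) {{_}} {{det-nonZero H}}

  entries : ∀ {k} → Vec ℕ k → Fin k → ℤ
  entries v l = + lookup v l

  apply : ∀ {k} → Triangular k → (Fin k → ℤ) → Fin k → ℤ
  apply (cons δ h H) b zero    = + suc δ * b zero
  apply (cons δ h H) b (suc l) = entries h l * b zero + apply H (b ∘ suc) l

  applyˡ : ∀ {k} → Triangular k → (Fin k → ℤ) → Fin k → ℤ
  applyˡ (cons δ h H) x zero    = x zero * + suc δ + sum (λ l → x (suc l) * entries h l)
  applyˡ (cons δ h H) x (suc l) = applyˡ H (x ∘ suc) l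

  apply-adjoint : ∀ {k} (H : Triangular k) x b →
    sum (λ l → applyˡ H x l * b l) ≡ sum (λ l → x l * apply H b l)
  apply-adjoint []           x b = refl
  apply-adjoint {suc k} (cons δ h H) x b = begin
    (x₀ * + suc δ + s) * b₀ + sum (λ l → applyˡ H x′ l * b′ l) ≡⟨ cong (λ ζ → (x₀ * + suc δ + s) * b₀ + ζ) (apply-adjoint H x′ b′) ⟩
    (x₀ * + suc δ + s) * b₀ + S ≡⟨ lemma x₀ (+ suc δ) s b₀ S ⟩
    x₀ * (+ suc δ * b₀) + (b₀ * s + 1ℤ * S) ≡⟨ cong (λ ζ → x₀ * (+ suc δ * b₀) + ζ) (sum-combineˡ x′ (entries h) (apply H b′) b₀ 1ℤ) ⟨
    x₀ * (+ suc δ * b₀) + sum (λ l → x′ l * (b₀ * entries h l + 1ℤ * apply H b′ l))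
      ≡⟨ cong (λ ζ → x₀ * (+ suc δ * b₀) + ζ) (sum-cong-≗ {k} (λ l → cong (x′ l *_) (cong₂ _+_ (*-comm b₀ (entries h l)) (*-identityˡ (apply H b′ l))))) ⟩
    x₀ * (+ suc δ * b₀) + sum (λ l → x′ l * (entries h l * b₀ + apply H b′ l)) ∎
    where
    open ≡-Reasoning
    x₀ = x zero
    b₀ = b zero
    x′ = x ∘ suc
    b′ = b ∘ suc
    s = sum (λ l → x′ l * entries h l)
    S = sum (λ l → x′ l * apply H b′ l)
    lemma : ∀ x d s b t → (x * d + s) * b + t ≡ x * (d * b) + (b * s + 1ℤ * t)
    lemma = solve-∀

  -- Inverts apply H on the lattice spanned by the columns of H; off this lattice the divisions truncate.
  substitute : ∀ {k} → Triangular k → (Fin k → ℤ) → Fin k → ℤ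
  substitute []           v = λ ()
  substitute (cons δ h H) v = (v zero /ℕ suc δ) Vector.∷
    substitute H (λ l → v (suc l) + - (v zero /ℕ suc δ) * entries h l)

  -- Representatives of ℤᵏ modulo the columns of `H`: each coordinate runs below its diagonal entry.
  residues : ∀ {k} → Triangular k → List (Vec ℕ k)
  residues []           = [] ∷ []
  residues (cons δ h H) = cartesianProductWith _∷_ (upTo (suc δ)) (residues H)

  length-residues : ∀ {k} (H : Triangular k) → length (residues H) ≡ det H
  length-residues []           = refl
  length-residues (cons δ h H) = trans (length-cartesianProductWith _∷_ (upTo (suc δ)) (residues H))
    (cong₂ ℕ._*_ (length-upTo (suc δ)) (length-residues H))

  residues-unique : ∀ {k} (H : Triangular k) → Unique (residues H)
  residues-unique []           = [] ∷ []
  residues-unique (cons δ h H) =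
    Unique.cartesianProductWith⁺ _∷_ ∷-injective (Unique.upTo⁺ (suc δ)) (residues-unique H)

  -- Division with remainder from the top coordinate down, as a column of `H` affects only its own
  -- and later coordinates.
  reduce : ∀ {k} (H : Triangular k) (w : Fin k → ℤ) →
    Σ[ t ∈ Vec ℕ k ] Σ[ b ∈ (Fin k → ℤ) ] t ∈ residues H × (∀ l → w l ≡ entries t l + apply H b l)
  reduce []           w = [] , (λ ()) , here refl , λ ()
  reduce (cons δ h H) w with reduce H (λ l → w (suc l) + - (w zero /ℕ suc δ) * entries h l)
  ... | t , b , t∈ , eq = (w zero %ℕ suc δ ∷ t) , ((w zero /ℕ suc δ) Vector.∷ b) ,
      ∈-cartesianProductWith⁺ _∷_ (∈-upTo⁺ (n%ℕd<d (w zero) (suc δ))) t∈ , λ where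
        zero    → trans (a≡a%ℕn+[a/ℕn]*n (w zero) (suc δ)) (cong (λ z → + (w zero %ℕ suc δ) + z) (*-comm (w zero /ℕ suc δ) (+ suc δ)))
        (suc l) → trans (lemma₁ (w (suc l)) (w zero /ℕ suc δ) (entries h l))
                    (trans (cong (_+ entries h l * (w zero /ℕ suc δ)) (eq l))
                      (lemma₂ (entries t l) (apply H b l) (entries h l * (w zero /ℕ suc δ))))
    where
    lemma₁ : ∀ w q h → w ≡ (w + (- q) * h) + h * q
    lemma₁ = solve-∀
    lemma₂ : ∀ t a b → (t + a) + b ≡ t + (b + a)
    lemma₂ = solve-∀

  small-multiple : ∀ d .{{_ : ℕ.NonZero d}} {m n b} → m ℕ.< d → n ℕ.< d → + m ≡ + n + + d * b → b ≡ 0ℤ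
  small-multiple d {m} {n} {+ zero} m<d n<d eq = refl
  small-multiple d {m} {n} {+ suc b} m<d n<d eq = contradiction (ℕ.≤-trans m<d (begin
    d ≤⟨ ℕ.m≤m*n d (suc b) ⟩
    d ℕ.* suc b ≤⟨ ℕ.m≤n+m (d ℕ.* suc b) n ⟩
    n ℕ.+ d ℕ.* suc b ≡⟨ +-injective (trans (cong (λ ζ → + n + ζ) (pos-* d (suc b))) (sym eq)) ⟩
    m ∎)) (ℕ.<-irrefl refl)
    where open ℕ.≤-Reasoning
  small-multiple d {m} {n} { -[1+ b ]} m<d n<d eq = contradiction (ℕ.≤-trans n<d (begin
    d ≤⟨ ℕ.m≤m*n d (suc b) ⟩
    d ℕ.* suc b ≤⟨ ℕ.m≤n+m (d ℕ.* suc b) m ⟩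
    m ℕ.+ d ℕ.* suc b ≡⟨ +-injective (trans (cong (λ ζ → + m + ζ) (pos-* d (suc b))) (trans (cong (_+ + d * + suc b) eq) (lemma (+ n) (+ d) (+ suc b)))) ⟩
    n ∎)) (ℕ.<-irrefl refl)
    where
    open ℕ.≤-Reasoning
    lemma : ∀ n d b → (n + d * (- b)) + d * b ≡ n
    lemma = solve-∀

  residues-distinct : ∀ {k} (H : Triangular k) {t t′} b → t ∈ residues H → t′ ∈ residues H →
    (∀ l → entries t l ≡ entries t′ l + apply H b l) → t ≡ t′
  residues-distinct [] {[]} {[]} b t∈ t′∈ eq = refl
  residues-distinct (cons δ h H) b t∈ t′∈ eq
    with ∈-cartesianProductWith⁻ _∷_ (upTo (suc δ)) (residues H) t∈ | ∈-cartesianProductWith⁻ _∷_ (upTo (suc δ)) (residues H) t′∈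
  ... | m , t , m∈ , t∈₁ , refl | n , t′ , n∈ , t′∈₁ , refl =
    cong₂ _∷_ (+-injective (trans (eq zero) (trans (cong (λ z → + n + + suc δ * z) b₀≡0) (trans (cong (λ z → + n + z) (*-zeroʳ (+ suc δ))) (+-identityʳ (+ n))))))
      (residues-distinct H (b ∘ suc) t∈₁ t′∈₁ λ l → trans (eq (suc l))
        (cong (λ z → entries t′ l + z) (trans (cong (λ z → entries h l * z + apply H (b ∘ suc) l) b₀≡0)
          (trans (cong (_+ apply H (b ∘ suc) l) (*-zeroʳ (entries h l))) (+-identityˡ (apply H (b ∘ suc) l))))))
    where
    b₀≡0 : b zero ≡ 0ℤ
    b₀≡0 = small-multiple (suc δ) {m} {n} {b zero} (∈-upTo⁻ m∈) (∈-upTo⁻ n∈) (eq zero)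

  -- Reducing each column modulo the lattice of the later ones leaves only `det H` choices for `h`,
  -- a weight that the summation over forms can absorb.
  Reduced : ∀ {k} → Triangular k → Set
  Reduced []           = ⊤
  Reduced (cons δ h H) = h ∈ residues H × Reduced H

  -- `E` bounds each diagonal entry rather than the determinant. The surplus forms do no harm in an
  -- upper bound, and the sum can be taken one entry at a time.
  hermiteForms : ℕ → ∀ k → List (Triangular k)
  hermiteForms E zero    = [] ∷ []
  hermiteForms E (suc k) =
    concatMap (λ H → cartesianProductWith (λ h δ → cons δ h H) (residues H) (upTo E)) (hermiteForms E k)

  ∈-hermiteForms : ∀ E {k} (H : Triangular k) → Reduced H → det H ℕ.≤ E → H ∈ hermiteForms E k
  ∈-hermiteForms E []           red          det≤E = here refl
  ∈-hermiteForms E (cons δ h H) (h∈ , red) det≤E =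
    ∈-concatMap (λ H → cartesianProductWith (λ h δ → cons δ h H) (residues H) (upTo E))
      (∈-hermiteForms E H red (ℕ.≤-trans (ℕ.m≤n*m (det H) (suc δ)) det≤E))
      (∈-cartesianProductWith⁺ (λ h δ → cons δ h H) h∈
        (∈-upTo⁺ (ℕ.≤-trans (ℕ.m≤m*n (suc δ) (det H) {{det-nonZero H}}) det≤E)))

  -- `shift` is closure under u + z v up to pointwise equality, so it also transports membership.
  -- `full` makes the index finite: vectors may be reduced modulo `suc period`, which bounds every
  -- search in the lattice.
  record Lattice (k : ℕ) : Set₁ where
    field
      Λ      : (Fin k → ℤ) → Set
      Λ?     : ∀ v → Dec (Λ v)
      shift  : ∀ {u v w} z → (∀ l → w l ≡ u l + z * v l) → Λ u → Λ v → Λ w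
      period : ℕ
      full   : ∀ (w : Fin k → ℤ) → Λ (λ l → + suc period * w l)

    respects : ∀ {u w} → (∀ l → w l ≡ u l) → Λ u → Λ w
    respects {u} w≡u Λu = shift {u} {u} 0ℤ
      (λ l → trans (w≡u l) (sym (trans (cong (λ z → u l + z) (*-zeroˡ (u l))) (+-identityʳ (u l))))) Λu Λu

    zero∈Λ : Λ (λ _ → 0ℤ)
    zero∈Λ = respects (λ l → sym (*-zeroʳ (+ suc period))) (full (λ _ → 0ℤ))

    combination∈Λ : ∀ {n} (x : Fin n → ℤ) (v : Fin n → Fin k → ℤ) → (∀ i → Λ (v i)) → Λ (λ l → sum (λ i → x i * v i l))
    combination∈Λ {zero}  x v Λv = zero∈Λ
    combination∈Λ {suc n} x v Λv = shift (x zero) (λ l → +-comm (x zero * v zero l) (sum (λ i → x (suc i) * v (suc i) l)))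
      (combination∈Λ (x ∘ suc) (v ∘ suc) (Λv ∘ suc)) (Λv zero)

  least : (P : ℕ → Set) → (∀ s → Dec (P s)) → ∀ n → P n → ∃[ s ] P s × (∀ s′ → s′ ℕ.< s → ¬ P s′)
  least P P? n Pn with P? 0
  least P P? n       Pn | yes P0 = 0 , P0 , λ _ ()
  least P P? zero    Pn | no ¬P0 = contradiction Pn ¬P0
  least P P? (suc n) Pn | no ¬P0 with least (P ∘ suc) (P? ∘ suc) n Pn
  ... | s , Ps , min = suc s , Ps , λ { zero _ → ¬P0 ; (suc s′) (s≤s s′<s) → min s′ s′<s }

  record HermiteForm {k} (𝓛 : Lattice k) : Set where
    open Lattice 𝓛
    field
      H       : Triangular k
      reduced : Reduced H
      apply∈Λ : ∀ b → Λ (apply H b)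
      spans   : ∀ v → Λ v → ∀ l → apply H (substitute H v) l ≡ v l

  -- The first column has the least positive first coordinate `D` in the lattice, and the block
  -- comes from the sublattice with first coordinate 0. Subtracting multiples of the first column
  -- brings the first coordinate of any member below `D`, hence to 0, and so the member into the
  -- sublattice.
  hermiteForm : ∀ {k} (𝓛 : Lattice k) → HermiteForm 𝓛
  hermiteForm {zero}  𝓛 = record
    { H = [] ; reduced = tt ; apply∈Λ = λ b → respects {λ _ → 0ℤ} (λ ()) zero∈Λ ; spans = λ _ _ () }
    where open Lattice 𝓛
  hermiteForm {suc k} 𝓛 = record
    { H = H ; reduced = t∈ , I.reduced ; apply∈Λ = apply∈Λ ; spans = spans }
    where
    open Lattice 𝓛
    𝓛′ : Lattice k
    𝓛′ = record
      { Λ = λ v → Λ (0ℤ Vector.∷ v)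
      ; Λ? = λ v → Λ? (0ℤ Vector.∷ v)
      ; shift = λ z eq → shift z λ { zero → sym (trans (+-identityˡ (z * 0ℤ)) (*-zeroʳ z)) ; (suc l) → eq l }
      ; period = period
      ; full = λ w → respects (λ { zero → sym (*-zeroʳ (+ suc period)) ; (suc l) → refl }) (full (0ℤ Vector.∷ w))
      }
    module I = HermiteForm (hermiteForm 𝓛′)
    -- Tails may be reduced modulo `suc period`, so a finite search decides whether `suc s` occurs
    -- as a first coordinate.
    candidates = vectorsOver (upTo (suc period)) k
    P : ℕ → Set
    P s = Any.Any (λ h → Λ (+ suc s Vector.∷ entries h)) candidates
    initial : P period
    initial = lose (∈-vectorsOver⁺ (replicate k 0) λ i → subst (_∈ upTo (suc period)) (sym (lookup-replicate i 0)) (∈-upTo⁺ (s≤s z≤n)))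
      (respects (λ { zero → sym (*-identityʳ (+ suc period))
                   ; (suc l) → trans (cong +_ (lookup-replicate l 0)) (sym (*-zeroʳ (+ suc period))) })
        (full (1ℤ Vector.∷ λ _ → 0ℤ)))
    minimum = least P (λ s → Any.any? (λ h → Λ? (+ suc s Vector.∷ entries h)) candidates) period initial
    δ₀ = proj₁ minimum
    D = suc δ₀
    h₀ = proj₁ (find (proj₁ (proj₂ minimum)))
    Λ[D,h₀] : Λ (+ D Vector.∷ entries h₀)
    Λ[D,h₀] = proj₂ (proj₂ (find (proj₁ (proj₂ minimum))))
    -- Subtracting columns of the block makes the tail reduced without leaving the lattice.
    reduction = reduce I.H (entries h₀)
    t = proj₁ reduction
    b₁ = proj₁ (proj₂ reduction)
    t∈ = proj₁ (proj₂ (proj₂ reduction))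
    Λ[D,t] : Λ (+ D Vector.∷ entries t)
    Λ[D,t] = shift (- 1ℤ)
      (λ { zero → lemma₀ (+ D)
         ; (suc l) → trans (lemma (entries t l) (apply I.H b₁ l)) (cong (_+ (- 1ℤ) * apply I.H b₁ l) (sym (proj₂ (proj₂ (proj₂ reduction)) l))) })
      Λ[D,h₀] (I.apply∈Λ b₁)
      where
      lemma₀ : ∀ d → d ≡ d + (- 1ℤ) * 0ℤ
      lemma₀ = solve-∀
      lemma : ∀ t a → t ≡ (t + a) + (- 1ℤ) * a
      lemma = solve-∀
    H = cons δ₀ t I.H
    apply∈Λ : ∀ b → Λ (apply H b)
    apply∈Λ b = shift (b zero)
      (λ { zero → trans (*-comm (+ D) (b zero)) (sym (+-identityˡ (b zero * + D)))
         ; (suc l) → trans (+-comm (entries t l * b zero) (apply I.H (b ∘ suc) l)) (cong (λ z → apply I.H (b ∘ suc) l + z) (*-comm (entries t l) (b zero))) })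
      (I.apply∈Λ (b ∘ suc)) Λ[D,t]
    module _ (v : Fin (suc k) → ℤ) (Λv : Λ v) where
      q = v zero /ℕ D
      r = v zero %ℕ D
      w : Fin k → ℤ
      w l = v (suc l) + - q * entries t l
      Λ[r,w] : Λ (+ r Vector.∷ w)
      Λ[r,w] = shift (- q)
        (λ { zero → trans (lemma (+ r) q (+ D)) (cong (_+ (- q) * + D) (sym (a≡a%ℕn+[a/ℕn]*n (v zero) D))) ; (suc l) → refl })
        Λv Λ[D,t]
        where
        lemma : ∀ r q d → r ≡ (r + q * d) + (- q) * d
        lemma = solve-∀
      r≡0 : r ≡ 0
      r≡0 with r in r≡
      ... | zero  = refl
      -- A nonzero remainder would be a smaller first coordinate, once the tail is brought among the
      -- candidates.
      ... | suc s = contradiction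
        (lose (∈-vectorsOver⁺ w₁ (λ i → subst (_∈ upTo (suc period)) (sym (lookup∘tabulate _ i)) (∈-upTo⁺ (n%ℕd<d (w i) (suc period)))))
          (shift (- 1ℤ)
            (λ { zero → trans (cong +_ (sym r≡)) (lemma₀ (+ r) (+ suc period))
               ; (suc l) → trans (cong +_ (lookup∘tabulate _ l)) (trans (lemma (+ (w l %ℕ suc period)) (w l /ℕ suc period) (+ suc period))
                             (cong (_+ (- 1ℤ) * (+ suc period * (w l /ℕ suc period))) (sym (a≡a%ℕn+[a/ℕn]*n (w l) (suc period))))) })
            Λ[r,w] (full (0ℤ Vector.∷ λ l → w l /ℕ suc period))))
        (proj₂ (proj₂ minimum) s (ℕ.≤-pred (subst (ℕ._< D) r≡ (n%ℕd<d (v zero) D))))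
        where
        w₁ : Vec ℕ k
        w₁ = tabulate (λ l → w l %ℕ suc period)
        lemma₀ : ∀ r n → r ≡ r + (- 1ℤ) * (n * 0ℤ)
        lemma₀ = solve-∀
        lemma : ∀ m q n → m ≡ (m + q * n) + (- 1ℤ) * (n * q)
        lemma = solve-∀
      Λ[0,w] : Λ (0ℤ Vector.∷ w)
      Λ[0,w] = subst (λ x → Λ (+ x Vector.∷ w)) r≡0 Λ[r,w]
      spans : ∀ l → apply H (substitute H v) l ≡ v l
      spans zero    = sym (trans (a≡a%ℕn+[a/ℕn]*n (v zero) D) (trans (cong (λ x → + x + q * + D) r≡0)
                        (trans (+-identityˡ (q * + D)) (*-comm q (+ D)))))
      spans (suc l) = trans (cong (λ z → entries t l * q + z) (I.spans w Λ[0,w] l)) (lemma (entries t l) q (v (suc l)))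
        where
        lemma : ∀ t q v → t * q + (v + (- q) * t) ≡ v
        lemma = solve-∀

  -- numerators H y is the vector x with x H = det H · y.
  numerators : ∀ {k} → Triangular k → (Fin k → ℤ) → Fin k → ℤ
  numerators []           y = λ ()
  numerators (cons δ h H) y =
    (+ det H * y zero + - sum (λ l → numerators H (y ∘ suc) l * entries h l)) Vector.∷
    (λ l → + suc δ * numerators H (y ∘ suc) l)

  -- Back substitution in x H = N y: the later entries are known by induction and determine the
  -- first one. Multiplying by `det H` keeps everything integral.
  numerators-unique : ∀ {k} (H : Triangular k) N x y → (∀ l → N * y l ≡ applyˡ H x l) →
    ∀ l → N * numerators H y l ≡ + det H * x l
  numerators-unique {suc k} (cons δ h H) N x y Ny≡xH = λ where
      zero    → begin
        N * (+ det H * y zero + - s) ≡⟨ lemma₁ N (+ det H) (y zero) s ⟩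
        + det H * (N * y zero) + - (N * s) ≡⟨ cong₂ (λ u v → + det H * u + - v) (Ny≡xH zero) Ns≡ ⟩
        + det H * (x zero * + suc δ + σ) + - (+ det H * σ) ≡⟨ lemma₂ (+ det H) (x zero) (+ suc δ) σ ⟩
        + suc δ * + det H * x zero ≡⟨ cong (_* x zero) (pos-* (suc δ) (det H)) ⟨
        + det (cons δ h H) * x zero ∎
      (suc l) → begin
        N * (+ suc δ * numerators H (y ∘ suc) l) ≡⟨ lemma₃ N (+ suc δ) (numerators H (y ∘ suc) l) ⟩
        + suc δ * (N * numerators H (y ∘ suc) l) ≡⟨ cong (+ suc δ *_) (IH l) ⟩
        + suc δ * (+ det H * x (suc l)) ≡⟨ *-assoc (+ suc δ) (+ det H) (x (suc l)) ⟨
        + suc δ * + det H * x (suc l) ≡⟨ cong (_* x (suc l)) (pos-* (suc δ) (det H)) ⟨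
        + det (cons δ h H) * x (suc l) ∎
    where
    open ≡-Reasoning
    IH = numerators-unique H N (x ∘ suc) (y ∘ suc) (Ny≡xH ∘ suc)
    s = sum (λ l → numerators H (y ∘ suc) l * entries h l)
    σ = sum (λ l → x (suc l) * entries h l)
    Ns≡ : N * s ≡ + det H * σ
    Ns≡ = trans (sym (sum-scale N (numerators H (y ∘ suc)) (entries h)))
      (trans (sum-cong-≗ {k} (λ l → cong (_* entries h l) (IH l))) (sum-scale (+ det H) (x ∘ suc) (entries h)))
    lemma₁ : ∀ n d y s → n * (d * y + - s) ≡ d * (n * y) + - (n * s)
    lemma₁ = solve-∀
    lemma₂ : ∀ d x e s → d * (x * e + s) + - (d * s) ≡ e * d * x
    lemma₂ = solve-∀
    lemma₃ : ∀ n d x → n * (d * x) ≡ d * (n * x)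
    lemma₃ = solve-∀

  interval : ℕ → List ℤ
  interval B = map +_ (upTo (suc B)) ++ map -[1+_] (upTo B)

  ∈-interval : ∀ {B} z → ∣ z ∣ ℕ.≤ B → z ∈ interval B
  ∈-interval {B} (+ n)    n≤B = ∈-++⁺ˡ (∈-map⁺ +_ (∈-upTo⁺ (s≤s n≤B)))
  ∈-interval {B} -[1+ n ] n<B = ∈-++⁺ʳ (map +_ (upTo (suc B))) (∈-map⁺ -[1+_] (∈-upTo⁺ n<B))

  length-interval : ∀ B → length (interval B) ≡ suc B ℕ.+ B
  length-interval B = trans (length-++ (map +_ (upTo (suc B))))
    (cong₂ ℕ._+_ (trans (length-map +_ (upTo (suc B))) (length-upTo (suc B))) (trans (length-map -[1+_] (upTo B)) (length-upTo B)))

  -- Contains every integral y = ξ H for a rational vector ξ with entries in [-C , C].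
  boundedRows : ℕ → ∀ {k} → Triangular k → List (Vec ℤ k)
  boundedRows C []           = [] ∷ []
  boundedRows C (cons δ h H) = concatMap
    (λ y → map (λ z → ((sum (λ l → numerators H (lookup y) l * entries h l) /ℕ det H) {{det-nonZero H}} + z) ∷ y)
               (interval (C ℕ.* suc δ)))
    (boundedRows C H)

  -- Each new coordinate has 2 C (1 + δ) + 1 values, at most (2 C + 1)(1 + δ), and the diagonal
  -- entries multiply to `det H`.
  length-boundedRows : ∀ C {k} (H : Triangular k) → length (boundedRows C H) ℕ.≤ suc (C ℕ.+ C) ℕ.^ k ℕ.* det H
  length-boundedRows C []           = ℕ.≤-refl
  length-boundedRows C {suc k} (cons δ h H) = begin
    length (boundedRows C (cons δ h H)) ≡⟨ length-concatMap _ (boundedRows C H) ⟩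
    ∑ (boundedRows C H) (λ y → length (map (λ z → (c y + z) ∷ y) (interval (C ℕ.* suc δ))))
      ≡⟨ ∑-cong (boundedRows C H) (λ y → trans (length-map (λ z → (c y + z) ∷ y) (interval (C ℕ.* suc δ))) (length-interval (C ℕ.* suc δ))) ⟩
    ∑ (boundedRows C H) (λ _ → suc (C ℕ.* suc δ) ℕ.+ C ℕ.* suc δ) ≡⟨ ∑-const (boundedRows C H) _ ⟩
    length (boundedRows C H) ℕ.* (suc (C ℕ.* suc δ) ℕ.+ C ℕ.* suc δ)
      ≤⟨ ℕ.*-mono-≤ (length-boundedRows C H) (ℕ.≤-trans (ℕ.m≤m+n (suc (C ℕ.* suc δ) ℕ.+ C ℕ.* suc δ) δ) (ℕ.≤-reflexive (lemma₁ C δ))) ⟩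
    suc (C ℕ.+ C) ℕ.^ k ℕ.* det H ℕ.* (suc (C ℕ.+ C) ℕ.* suc δ) ≡⟨ lemma₂ (suc (C ℕ.+ C) ℕ.^ k) (det H) (suc (C ℕ.+ C)) (suc δ) ⟩
    suc (C ℕ.+ C) ℕ.* suc (C ℕ.+ C) ℕ.^ k ℕ.* (suc δ ℕ.* det H) ∎
    where
    open ℕ.≤-Reasoning
    c : Vec ℤ k → ℤ
    c y = (sum (λ l → numerators H (lookup y) l * entries h l) /ℕ det H) {{det-nonZero H}}
    lemma₁ : ∀ C δ → suc (C ℕ.* suc δ) ℕ.+ C ℕ.* suc δ ℕ.+ δ ≡ suc (C ℕ.+ C) ℕ.* suc δ
    lemma₁ = ℕSolver.solve-∀
    lemma₂ : ∀ a b c d → a ℕ.* b ℕ.* (c ℕ.* d) ≡ c ℕ.* a ℕ.* (d ℕ.* b)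
    lemma₂ = ℕSolver.solve-∀

  -- `z` is an integer, so a remainder smaller than `d` cannot push it past `B`.
  quotient-bound : ∀ d .{{_ : ℕ.NonZero d}} {r B} z → r ℕ.< d → ∣ + d * z + - + r ∣ ℕ.≤ B ℕ.* d → ∣ z ∣ ℕ.≤ B
  quotient-bound d {r} {B} z r<d bound = ℕ.≤-pred (ℕ.*-cancelˡ-< d ∣ z ∣ (suc B) (begin-strict
    d ℕ.* ∣ z ∣ ≡⟨ abs-* (+ d) z ⟨
    ∣ + d * z ∣ ≡⟨ cong ∣_∣ (lemma (+ d * z) (+ r)) ⟩
    ∣ (+ d * z + - + r) + + r ∣ ≤⟨ ∣i+j∣≤∣i∣+∣j∣ (+ d * z + - + r) (+ r) ⟩
    ∣ + d * z + - + r ∣ ℕ.+ r <⟨ ℕ.+-mono-≤-< bound r<d ⟩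
    B ℕ.* d ℕ.+ d ≡⟨ trans (ℕ.+-comm (B ℕ.* d) d) (ℕ.*-comm (suc B) d) ⟩
    d ℕ.* suc B ∎))
    where
    open ℕ.≤-Reasoning
    lemma : ∀ x r → x ≡ (x + - r) + r
    lemma = solve-∀

  -- With ξ = x / N, the first entry of ξ H is ξ₀ (1 + δ) plus a value that the later entries of `y`
  -- determine through `numerators`. Flooring this value moves the centre by less than 1, which
  -- `quotient-bound` absorbs.
  ∈-boundedRows : ∀ C {k} (H : Triangular k) N .{{_ : ℕ.NonZero N}} (x : Fin k → ℤ) (y : Vec ℤ k) →
    (∀ l → + N * lookup y l ≡ applyˡ H x l) → (∀ l → ∣ x l ∣ ℕ.≤ C ℕ.* N) → y ∈ boundedRows C H
  ∈-boundedRows C []           N x []       Ny≡xH x≤CN = here refl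
  ∈-boundedRows C {suc k} (cons δ h H) N x (y₀ ∷ y) Ny≡xH x≤CN =
    ∈-concatMap _ (∈-boundedRows C H N (x ∘ suc) y (Ny≡xH ∘ suc) (x≤CN ∘ suc))
      (subst (_∈ map (λ z → (q + z) ∷ y) (interval (C ℕ.* suc δ))) (cong (_∷ y) (lemma₀ q y₀))
        (∈-map⁺ (λ z → (q + z) ∷ y) (∈-interval {C ℕ.* suc δ} (y₀ + - q) (quotient-bound d {r} {C ℕ.* suc δ} (y₀ + - q) (n%ℕd<d s d)
          (ℕ.*-cancelˡ-≤ N bound)))))
    where
    d = det H
    instance
      d-nonZero : ℕ.NonZero d
      d-nonZero = det-nonZero H
    s = sum (λ l → numerators H (lookup y) l * entries h l)
    q = s /ℕ d
    r = s %ℕ d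
    σ = sum (λ l → x (suc l) * entries h l)
    lemma₀ : ∀ q y → q + (y + - q) ≡ y
    lemma₀ = solve-∀
    Ns≡ : + N * s ≡ + d * σ
    Ns≡ = trans (sym (sum-scale (+ N) (numerators H (lookup y)) (entries h)))
      (trans (sum-cong-≗ {k} (λ l → cong (_* entries h l) (numerators-unique H (+ N) (x ∘ suc) (lookup y) (Ny≡xH ∘ suc) l)))
        (sum-scale (+ d) (x ∘ suc) (entries h)))
    identity : + N * (+ d * (y₀ + - q) + - + r) ≡ + d * (x zero * + suc δ)
    identity = begin
      + N * (+ d * (y₀ + - q) + - + r) ≡⟨ lemma₁ (+ N) (+ d) y₀ q (+ r) ⟩
      + d * (+ N * y₀) + - (+ N * (+ r + q * + d)) ≡⟨ cong (λ z → + d * (+ N * y₀) + - (+ N * z)) (a≡a%ℕn+[a/ℕn]*n s d) ⟨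
      + d * (+ N * y₀) + - (+ N * s) ≡⟨ cong₂ (λ u v → + d * u + - v) (Ny≡xH zero) Ns≡ ⟩
      + d * (x zero * + suc δ + σ) + - (+ d * σ) ≡⟨ lemma₂ (+ d) (x zero * + suc δ) σ ⟩
      + d * (x zero * + suc δ) ∎
      where
      open ≡-Reasoning
      lemma₁ : ∀ n d y q r → n * (d * (y + - q) + - r) ≡ d * (n * y) + - (n * (r + q * d))
      lemma₁ = solve-∀
      lemma₂ : ∀ d u s → d * (u + s) + - (d * s) ≡ d * u
      lemma₂ = solve-∀
    bound : N ℕ.* ∣ + d * (y₀ + - q) + - + r ∣ ℕ.≤ N ℕ.* (C ℕ.* suc δ ℕ.* d)
    bound = begin
      N ℕ.* ∣ + d * (y₀ + - q) + - + r ∣ ≡⟨ abs-* (+ N) (+ d * (y₀ + - q) + - + r) ⟨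
      ∣ + N * (+ d * (y₀ + - q) + - + r) ∣ ≡⟨ cong ∣_∣ identity ⟩
      ∣ + d * (x zero * + suc δ) ∣ ≡⟨ trans (abs-* (+ d) (x zero * + suc δ)) (cong (d ℕ.*_) (abs-* (x zero) (+ suc δ))) ⟩
      d ℕ.* (∣ x zero ∣ ℕ.* suc δ) ≤⟨ ℕ.*-monoʳ-≤ d (ℕ.*-monoˡ-≤ (suc δ) (x≤CN zero)) ⟩
      d ℕ.* (C ℕ.* N ℕ.* suc δ) ≡⟨ lemma d C N (suc δ) ⟩
      N ℕ.* (C ℕ.* suc δ ℕ.* d) ∎
      where
      open ℕ.≤-Reasoning
      lemma : ∀ d c n e → d ℕ.* (c ℕ.* n ℕ.* e) ≡ n ℕ.* (c ℕ.* e ℕ.* d)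
      lemma = ℕSolver.solve-∀

-- The packing bound, and the encoding of matrices by lattices

module LatticeCodes where
  open Counting
  open GaussianElimination
  open HermiteForms
  open import Data.Fin.Base using (Fin; zero; suc)
  open import Data.Fin.Properties using (all?; any?)
  import Data.Fin.Properties as Fin
  open import Data.Integer.Base using (ℤ; +_; -[1+_]; 0ℤ; 1ℤ; _+_; _*_; -_; ∣_∣)
  open import Data.Integer.Divisibility.Signed using (_∣?_; divides; ∣m∣n⇒∣m+n; ∣n⇒∣m*n) renaming (_∣_ to _∣ℤ_)
  open import Data.Integer.DivMod using (_/ℕ_; _%ℕ_; n%ℕd<d; a≡a%ℕn+[a/ℕn]*n)
  open import Data.Integer.Properties
  open import Data.Integer.Tactic.RingSolver using (solve-∀)
  open import Data.List.Base using (List; length; filter; concatMap; allFin; cartesianProduct; cartesianProductWith)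
  open import Data.List.Membership.Propositional using (_∈_)
  open import Data.List.Membership.Propositional.Properties
    using (∈-filter⁺; ∈-filter⁻; ∈-cartesianProduct⁺; ∈-cartesianProduct⁻; ∈-cartesianProductWith⁺; ∈-allFin;
           ∈-length)
  open import Data.List.Relation.Unary.Unique.Propositional using (Unique)
  import Data.List.Relation.Unary.Unique.Propositional.Properties as Unique
  open import Data.Nat.Base as ℕ using (ℕ; zero; suc; z≤n)
  import Data.Nat.Properties as ℕ
  import Data.Nat.Tactic.RingSolver as ℕSolver
  open import Data.Sum.Base using (inj₁; inj₂)
  open import Data.Vec.Base using (Vec; lookup; tabulate)
  open import Data.Vec.Properties using (lookup∘tabulate; tabulate∘lookup; tabulate-cong)
  open IntegerSums

  lookup-ext : ∀ {A : Set} {n} {v w : Vec A n} → (∀ i → lookup v i ≡ lookup w i) → v ≡ w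
  lookup-ext {v = v} {w} eq = trans (sym (tabulate∘lookup v)) (trans (tabulate-cong eq) (tabulate∘lookup w))

  inLattice? : ∀ {k} (H : Triangular k) (v : Vec ℕ k) → Dec (∀ l → apply H (substitute H (entries v)) l ≡ entries v l)
  inLattice? H v = all? (λ l → apply H (substitute H (entries v)) l ≟ entries v l)

  points : ∀ n {k} → Triangular k → List (Vec ℕ k)
  points n {k} H = filter (inLattice? H) (vectorsOver [1⋯ n ] k)

  points-unique : ∀ n {k} (H : Triangular k) → Unique (points n H)
  points-unique n {k} H = Unique.filter⁺ (inLattice? H)
    (vectorsOver-unique k ([1⋯]-unique n))

  ∈-points⁻ : ∀ {n k} (H : Triangular k) {v} → v ∈ points n H →
    (∀ l → lookup v l ∈ [1⋯ n ]) × (∀ l → apply H (substitute H (entries v)) l ≡ entries v l)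
  ∈-points⁻ {n} {k} H {v} v∈
    with ∈-filter⁻ (inLattice? H) {xs = vectorsOver [1⋯ n ] k} v∈
  ... | v∈box , eq = ∈-vectorsOver⁻ [1⋯ n ] v∈box , eq

  sum-nonNegative : ∀ {k} (f : Fin k → ℤ) B → (∀ s → ∃[ m ] f s ≡ + m × m ℕ.≤ B) →
    ∃[ m ] sum f ≡ + m × m ℕ.≤ k ℕ.* B
  sum-nonNegative {zero}  f B bounds = 0 , refl , z≤n
  sum-nonNegative {suc k} f B bounds with bounds zero | sum-nonNegative (f ∘ suc) B (bounds ∘ suc)
  ... | m , f₀≡m , m≤B | n , sum≡n , n≤kB = m ℕ.+ n , cong₂ _+_ f₀≡m sum≡n , ℕ.+-mono-≤ m≤B n≤kB

  nonNegative : ∀ ν z {m} → + suc ν * z ≡ + m → z ≡ + ∣ z ∣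
  nonNegative ν (+ n)    eq = refl
  nonNegative ν -[1+ n ] ()

  normalise-sign : ∀ e → e ≢ 0ℤ → Σ[ ε ∈ ℤ ] ∃[ ν ] ε * e ≡ + suc ν × suc ν ≡ ∣ e ∣ × ∣ ε ∣ ≡ 1
  normalise-sign (+ zero)  e≢0 = contradiction refl e≢0
  normalise-sign (+ suc ν) e≢0 = 1ℤ , ν , *-identityˡ (+ suc ν) , refl , refl
  normalise-sign -[1+ ν ]  e≢0 = - 1ℤ , ν , -1*i≡-i -[1+ ν ] , refl , refl

  -- The lattice contains k independent vectors w s of the box, so ℤᵏ/Λ has representatives in their
  -- parallelepiped; translating the points of the box by these representatives is injective.
  module Packing {k} (𝓛 : Lattice k) (F : HermiteForm 𝓛) (n : ℕ) (w : Fin k → Fin k → ℕ)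
    (w≤n : ∀ s l → w s l ℕ.≤ n) (w∈Λ : ∀ s → Lattice.Λ 𝓛 (λ l → + w s l))
    (solve : ∀ (t : Fin k → ℤ) → Σ[ e ∈ ℤ ] Σ[ c ∈ (Fin k → ℤ) ] e ≢ 0ℤ × (∀ l → sum (λ s → c s * + w s l) ≡ e * t l))
    where
    open Lattice 𝓛
    open HermiteForm F

    -- In rational coordinates with respect to the `w s`, subtracting integer parts leaves
    -- coefficients in [0, 1). The rest lies in the parallelepiped, so its entries are between 0 and
    -- `k * n`.
    representative : (t : Fin k → ℤ) →
      Σ[ u ∈ Vec ℕ k ] (∀ l → lookup u l ℕ.≤ k ℕ.* n) × Λ (λ l → t l + - entries u l)
    representative t with solve t
    ... | e , c , e≢0 , cw≡et with normalise-sign e e≢0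
    ... | ε , ν , εe≡ , _ , _ = u , u≤ , respects t-u (combination∈Λ q (λ s l → + w s l) w∈Λ)
      where
      N = suc ν
      r : Fin k → ℕ
      r s = (ε * c s) %ℕ N
      q : Fin k → ℤ
      q s = (ε * c s) /ℕ N
      z : Fin k → ℤ
      z l = t l + - sum (λ s → q s * + w s l)
      Nz≡ : ∀ l → + N * z l ≡ sum (λ s → + r s * + w s l)
      Nz≡ l = begin
        + N * (t l + - Q) ≡⟨ lemma₁ (+ N) (t l) Q ⟩
        + N * t l + - (+ N) * Q ≡⟨ cong (λ x → x * t l + - (+ N) * Q) εe≡ ⟨
        ε * e * t l + - (+ N) * Q ≡⟨ cong (_+ - (+ N) * Q) (trans (*-assoc ε e (t l)) (cong (ε *_) (sym (cw≡et l)))) ⟩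
        ε * sum (λ s → c s * + w s l) + - (+ N) * Q ≡⟨ sum-linear ε (- (+ N)) (λ s → c s * + w s l) (λ s → q s * + w s l) ⟨
        sum (λ s → ε * (c s * + w s l) + - (+ N) * (q s * + w s l))
          ≡⟨ sum-cong-≗ {k} (λ s → trans (lemma₂ ε (c s) (+ w s l) (+ N) (q s))
               (cong (_* + w s l) (trans (cong (_+ - (q s * + N)) (a≡a%ℕn+[a/ℕn]*n (ε * c s) N)) (lemma₃ (+ r s) (q s * + N))))) ⟩
        sum (λ s → + r s * + w s l) ∎
        where
        open ≡-Reasoning
        Q = sum (λ s → q s * + w s l)
        lemma₁ : ∀ n t q → n * (t + - q) ≡ n * t + - n * q
        lemma₁ = solve-∀
        lemma₂ : ∀ ε c w n q → ε * (c * w) + - n * (q * w) ≡ (ε * c + - (q * n)) * w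
        lemma₂ = solve-∀
        lemma₃ : ∀ r x → (r + x) + - x ≡ r
        lemma₃ = solve-∀
      bounds : ∀ l → ∃[ m ] sum (λ s → + r s * + w s l) ≡ + m × m ℕ.≤ k ℕ.* (N ℕ.* n)
      bounds l = sum-nonNegative (λ s → + r s * + w s l) (N ℕ.* n) λ s → r s ℕ.* w s l , sym (pos-* (r s) (w s l)) ,
        ℕ.*-mono-≤ (ℕ.<⇒≤ (n%ℕd<d (ε * c s) N)) (w≤n s l)
      z≡ : ∀ l → z l ≡ + ∣ z l ∣
      z≡ l = nonNegative ν (z l) (trans (Nz≡ l) (proj₁ (proj₂ (bounds l))))
      u = tabulate (λ l → ∣ z l ∣)
      u≤ : ∀ l → lookup u l ℕ.≤ k ℕ.* n
      u≤ l = ℕ.≤-trans (ℕ.≤-reflexive (lookup∘tabulate _ l)) (ℕ.*-cancelˡ-≤ N (begin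
        N ℕ.* ∣ z l ∣ ≡⟨ abs-* (+ N) (z l) ⟨
        ∣ + N * z l ∣ ≡⟨ cong ∣_∣ (trans (Nz≡ l) (proj₁ (proj₂ (bounds l)))) ⟩
        proj₁ (bounds l) ≤⟨ proj₂ (proj₂ (bounds l)) ⟩
        k ℕ.* (N ℕ.* n) ≡⟨ lemma k N n ⟩
        N ℕ.* (k ℕ.* n) ∎))
        where
        open ℕ.≤-Reasoning
        lemma : ∀ k m n → k ℕ.* (m ℕ.* n) ≡ m ℕ.* (k ℕ.* n)
        lemma = ℕSolver.solve-∀
      t-u : ∀ l → t l + - entries u l ≡ sum (λ s → q s * + w s l)
      t-u l = trans (cong (λ x → t l + - x) (trans (cong +_ (lookup∘tabulate _ l)) (sym (z≡ l)))) (lemma (t l) (sum (λ s → q s * + w s l)))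
        where
        lemma : ∀ t q → t + - (t + - q) ≡ q
        lemma = solve-∀

    translate : Vec ℕ k × Vec ℕ k → Vec ℕ k
    translate (v , t) = tabulate (λ l → lookup v l ℕ.+ lookup (proj₁ (representative (entries t))) l)

    -- From v + u = v′ + u′ it follows that t - t′ is the sum of the lattice vectors t - u, u′ - t′
    -- and v′ - v, and distinct residues are incongruent. Thus t = t′, so u = u′ and v = v′.
    translate-injective : ∀ {x y} → x ∈ cartesianProduct (points n H) (residues H) →
      y ∈ cartesianProduct (points n H) (residues H) → translate x ≡ translate y → x ≡ y
    translate-injective {v , t} {v′ , t′} x∈ y∈ eq
      with ∈-cartesianProduct⁻ (points n H) (residues H) x∈ | ∈-cartesianProduct⁻ (points n H) (residues H) y∈
    ... | v∈ , t∈ | v′∈ , t′∈ = cong₂ _,_ v≡v′ t≡t′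
      where
      u = proj₁ (representative (entries t))
      u′ = proj₁ (representative (entries t′))
      v+u≡ : ∀ l → lookup v l ℕ.+ lookup u l ≡ lookup v′ l ℕ.+ lookup u′ l
      v+u≡ l = trans (sym (lookup∘tabulate _ l)) (trans (cong (λ x → lookup x l) eq) (lookup∘tabulate _ l))
      point∈Λ : ∀ {v} → v ∈ points n H → Λ (entries v)
      point∈Λ {v} v∈ = respects (λ l → sym (proj₂ (∈-points⁻ H v∈) l)) (apply∈Λ (substitute H (entries v)))
      t-t′ : Fin k → ℤ
      t-t′ l = entries t l + - entries t′ l
      t-t′∈Λ : Λ t-t′
      t-t′∈Λ = shift 1ℤ
        (λ l → trans (lemma₁ (entries t l) (entries t′ l) (entries u l) (entries u′ l) (entries v l) (entries v′ l))
          (trans (cong (λ x → S l + 1ℤ * (entries v′ l + - 1ℤ * entries v l) + (x + - (entries v′ l + entries u′ l))) (cong +_ (v+u≡ l)))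
            (lemma₂ (S l + 1ℤ * (entries v′ l + - 1ℤ * entries v l)) (+ (lookup v′ l ℕ.+ lookup u′ l)))))
        (shift (- 1ℤ) (λ l → refl) (proj₂ (proj₂ (representative (entries t)))) (proj₂ (proj₂ (representative (entries t′)))))
        (shift (- 1ℤ) (λ l → refl) (point∈Λ v′∈) (point∈Λ v∈))
        where
        S : Fin k → ℤ
        S l = (entries t l + - entries u l) + - 1ℤ * (entries t′ l + - entries u′ l)
        lemma₁ : ∀ t t′ u u′ v v′ → t + - t′ ≡
          (((t + - u) + - 1ℤ * (t′ + - u′)) + 1ℤ * (v′ + - 1ℤ * v)) + ((v + u) + - (v′ + u′))
        lemma₁ = solve-∀
        lemma₂ : ∀ s x → s + (x + - x) ≡ s
        lemma₂ = solve-∀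
      t≡t′ : t ≡ t′
      t≡t′ = residues-distinct H (substitute H t-t′) t∈ t′∈ λ l →
        trans (lemma (entries t l) (entries t′ l)) (cong (λ x → entries t′ l + x) (sym (spans t-t′ t-t′∈Λ l)))
        where
        lemma : ∀ t t′ → t ≡ t′ + (t + - t′)
        lemma = solve-∀
      v≡v′ : v ≡ v′
      v≡v′ = lookup-ext λ l → ℕ.+-cancelʳ-≡ (lookup u′ l) _ _
        (trans (cong (λ s → lookup v l ℕ.+ lookup (proj₁ (representative (entries s))) l) (sym t≡t′)) (v+u≡ l))

    -- The side `suc k * n` arises as `n` for the point plus `k * n` for the representative.
    packing : det H ℕ.* length (points n H) ℕ.≤ (suc k ℕ.* n) ℕ.^ k
    packing = begin
      det H ℕ.* length (points n H) ≡⟨ cong (ℕ._* length (points n H)) (length-residues H) ⟨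
      length (residues H) ℕ.* length (points n H) ≡⟨ ℕ.*-comm (length (residues H)) (length (points n H)) ⟩
      length (points n H) ℕ.* length (residues H) ≡⟨ length-cartesianProductWith _,_ (points n H) (residues H) ⟨
      length (cartesianProduct (points n H) (residues H)) ≤⟨ length-injection translate
                                                              (Unique.cartesianProduct⁺ (points-unique n H) (residues-unique H))
                                                              translate∈ translate-injective ⟩
      length (vectorsOver [1⋯ suc k ℕ.* n ] k) ≡⟨ length-vectorsOver [1⋯ suc k ℕ.* n ] k ⟩
      length [1⋯ suc k ℕ.* n ] ℕ.^ k ≡⟨ cong (ℕ._^ k) (length-[1⋯] (suc k ℕ.* n)) ⟩
      (suc k ℕ.* n) ℕ.^ k ∎
      where
      open ℕ.≤-Reasoning
      translate∈ : ∀ {x} → x ∈ cartesianProduct (points n H) (residues H) → translate x ∈ vectorsOver [1⋯ suc k ℕ.* n ] k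
      translate∈ {v , t} x∈ = ∈-vectorsOver⁺ (translate (v , t)) λ l → subst (_∈ [1⋯ suc k ℕ.* n ]) (sym (lookup∘tabulate _ l))
        (let v∈ = ∈-[1⋯]⁻ (proj₁ (∈-points⁻ H (proj₁ (∈-cartesianProduct⁻ (points n H) (residues H) x∈))) l)
         in ∈-[1⋯]⁺ (ℕ.≤-trans (proj₁ v∈) (ℕ.m≤m+n _ _)) (ℕ.+-mono-≤ (proj₂ v∈) (proj₁ (proj₂ (representative (entries t))) l)))

  -- A p × q matrix of rank k is encoded by k independent rows ρ, the remaining rows τ, the Hermite
  -- form H of a lattice containing the columns of the rows ρ, these columns, and the remaining rows
  -- in coordinates with respect to H.
  Code : (p q k m : ℕ) → Set
  Code p q k m = (Vec (Fin p) k × Vec (Fin p) m) × Triangular k × Vec (Vec ℤ k) m × Vec (Vec ℕ k) q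

  -- The absolute value and the final 0 only make the map total: for the code of an actual matrix
  -- the sum is a positive entry, and every row index occurs in `ρ` or `τ`.
  decode : ∀ {p q k m} → Code p q k m → Fin p → Fin q → ℕ
  decode ((ρ , τ) , H , Y , V) i j with any? (λ l → lookup ρ l Fin.≟ i) | any? (λ t → lookup τ t Fin.≟ i)
  ... | yes (l , _) | _           = lookup (lookup V j) l
  ... | no _        | yes (t , _) = ∣ sum (λ l → lookup (lookup Y t) l * substitute H (entries (lookup V j)) l) ∣
  ... | no _        | no _        = 0

  -- Stands in for the k independent box vectors: a decidable consequence of their existence,
  -- through which the number of points of `H` is controlled.
  dense? : ∀ P n {k} (H : Triangular k) → Dec (det H ℕ.* length (points n H) ℕ.≤ P)
  dense? P n H = det H ℕ.* length (points n H) ℕ.≤? P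

  codesOver : ∀ C n p q k m → Triangular k → List (Code p q k m)
  codesOver C n p q k m H = cartesianProductWith (λ rows YV → rows , H , YV)
    (cartesianProduct (vectorsOver (allFin p) k) (vectorsOver (allFin p) m))
    (cartesianProduct (vectorsOver (boundedRows C H) m) (vectorsOver (points n H) q))

  codes : ∀ C E P n p q k m → List (Code p q k m)
  codes C E P n p q k m = concatMap (codesOver C n p q k m) (filter (dense? P n) (hermiteForms E k))

  module Encoding {p q} (M : Fin p → Fin (suc q) → ℕ) {n} (M∈ : ∀ i j → M i j ∈ [1⋯ n ])
    (𝓔 : Elimination (λ i j → + M i j)) where
    open Elimination 𝓔

    -- The sign of `N` is moved into `X`, so that the common denominator becomes the natural number
    -- `suc ν`.
    ε = proj₁ (normalise-sign N N≢0)
    ν = proj₁ (proj₂ (normalise-sign N N≢0))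
    εN≡ : ε * N ≡ + suc ν
    εN≡ = proj₁ (proj₂ (proj₂ (normalise-sign N N≢0)))
    ν≡ : suc ν ≡ ∣ N ∣
    ν≡ = proj₁ (proj₂ (proj₂ (proj₂ (normalise-sign N N≢0))))
    ∣ε∣≡1 : ∣ ε ∣ ≡ 1
    ∣ε∣≡1 = proj₂ (proj₂ (proj₂ (proj₂ (normalise-sign N N≢0))))

    X⁺ : Fin m → Fin k → ℤ
    X⁺ t l = ε * X t l

    X⁺-bound : ∀ t l → ∣ X⁺ t l ∣ ℕ.≤ growth k ℕ.* suc ν
    X⁺-bound t l = begin
      ∣ ε * X t l ∣ ≡⟨ abs-* ε (X t l) ⟩
      ∣ ε ∣ ℕ.* ∣ X t l ∣ ≡⟨ cong (ℕ._* ∣ X t l ∣) ∣ε∣≡1 ⟩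
      1 ℕ.* ∣ X t l ∣ ≡⟨ ℕ.*-identityˡ ∣ X t l ∣ ⟩
      ∣ X t l ∣ ≤⟨ bound t l ⟩
      growth k ℕ.* ∣ N ∣ ≡⟨ cong (growth k ℕ.*_) ν≡ ⟨
      growth k ℕ.* suc ν ∎
      where open ℕ.≤-Reasoning

    comb⁺ : ∀ t j → + suc ν * + M (τ t) j ≡ sum (λ l → X⁺ t l * + M (ρ l) j)
    comb⁺ t j = begin
      + suc ν * + M (τ t) j ≡⟨ cong (_* + M (τ t) j) εN≡ ⟨
      ε * N * + M (τ t) j ≡⟨ *-assoc ε N (+ M (τ t) j) ⟩
      ε * (N * + M (τ t) j) ≡⟨ cong (ε *_) (comb t j) ⟩
      ε * sum (λ l → X t l * + M (ρ l) j) ≡⟨ sum-scale ε (X t) (λ l → + M (ρ l) j) ⟨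
      sum (λ l → X⁺ t l * + M (ρ l) j) ∎
      where open ≡-Reasoning

    -- Integrality of X v is expressed as divisibility by `suc ν`, which is also a period of the
    -- lattice.
    𝓛 : Lattice k
    𝓛 = record
      { Λ = λ v → ∀ t → + suc ν ∣ℤ sum (λ l → X⁺ t l * v l)
      ; Λ? = λ v → all? (λ t → + suc ν ∣? sum (λ l → X⁺ t l * v l))
      ; shift = λ {u} {v} {w} z eq Λu Λv t → subst (+ suc ν ∣ℤ_) (sym (linear u v w z eq t)) (∣m∣n⇒∣m+n (Λu t) (∣n⇒∣m*n z (Λv t)))
      ; period = ν
      ; full = λ w t → divides (sum (λ l → X⁺ t l * w l)) (scale w t)
      }
      where
      linear : ∀ u v w z → (∀ l → w l ≡ u l + z * v l) → ∀ t →
        sum (λ l → X⁺ t l * w l) ≡ sum (λ l → X⁺ t l * u l) + z * sum (λ l → X⁺ t l * v l)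
      linear u v w z eq t = begin
        sum (λ l → X⁺ t l * w l) ≡⟨ sum-cong-≗ {k} (λ l → cong (X⁺ t l *_) (trans (eq l) (cong (_+ z * v l) (sym (*-identityˡ (u l)))))) ⟩
        sum (λ l → X⁺ t l * (1ℤ * u l + z * v l)) ≡⟨ sum-combineˡ (X⁺ t) u v 1ℤ z ⟩
        1ℤ * sum (λ l → X⁺ t l * u l) + z * sum (λ l → X⁺ t l * v l) ≡⟨ cong (_+ z * sum (λ l → X⁺ t l * v l)) (*-identityˡ (sum (λ l → X⁺ t l * u l))) ⟩
        sum (λ l → X⁺ t l * u l) + z * sum (λ l → X⁺ t l * v l) ∎
        where open ≡-Reasoning
      scale : ∀ w t → sum (λ l → X⁺ t l * (+ suc ν * w l)) ≡ sum (λ l → X⁺ t l * w l) * + suc ν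
      scale w t = trans (sum-cong-≗ {k} (λ l → lemma (X⁺ t l) (+ suc ν) (w l))) (sym (*-distribʳ-sum (+ suc ν) (λ l → X⁺ t l * w l)))
        where
        lemma : ∀ x n w → x * (n * w) ≡ x * w * n
        lemma = solve-∀
    open Lattice 𝓛
    open HermiteForm (hermiteForm 𝓛)

    column : Fin (suc q) → Vec ℕ k
    column j = tabulate (λ l → M (ρ l) j)

    column∈Λ : ∀ j → Λ (λ l → + M (ρ l) j)
    column∈Λ j t = divides (+ M (τ t) j) (trans (sym (comb⁺ t j)) (*-comm (+ suc ν) (+ M (τ t) j)))

    column-spans : ∀ j l → apply H (substitute H (entries (column j))) l ≡ entries (column j) l
    column-spans j = spans (entries (column j)) (respects (λ l → cong +_ (lookup∘tabulate _ l)) (column∈Λ j))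

    column∈points : ∀ j → column j ∈ points n H
    column∈points j = ∈-filter⁺ (inLattice? H)
      (∈-vectorsOver⁺ (column j) (λ l → subst (_∈ [1⋯ n ]) (sym (lookup∘tabulate _ l)) (M∈ (ρ l) j))) (column-spans j)

    dense : det H ℕ.* length (points n H) ℕ.≤ (suc k ℕ.* n) ℕ.^ k
    dense = Packing.packing 𝓛 (hermiteForm 𝓛) n (λ s l → M (ρ l) (γ s)) (λ s l → proj₂ (∈-[1⋯]⁻ (M∈ (ρ l) (γ s))))
      (λ s → column∈Λ (γ s)) solveʳ

    -- The lattice has a point in the box, namely a column of the matrix; this is why the number of
    -- columns is a successor.
    det≤ : det H ℕ.≤ (suc k ℕ.* n) ℕ.^ k
    det≤ = ℕ.≤-trans (ℕ.m≤m*n (det H) (length (points n H)) {{ℕ.>-nonZero (∈-length (column∈points zero))}}) dense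

    -- The rows of X H, integral because the columns `apply H (δ l)` of `H` lie in `Λ`.
    y : Fin m → Vec ℤ k
    y t = tabulate (λ l → _∣ℤ_.quotient (apply∈Λ (δ l) t))

    νy≡X⁺H : ∀ t l → + suc ν * lookup (y t) l ≡ applyˡ H (X⁺ t) l
    νy≡X⁺H t l = begin
      + suc ν * lookup (y t) l ≡⟨ cong (+ suc ν *_) (lookup∘tabulate _ l) ⟩
      + suc ν * _∣ℤ_.quotient (apply∈Λ (δ l) t) ≡⟨ trans (*-comm (+ suc ν) _) (sym (_∣ℤ_.equality (apply∈Λ (δ l) t))) ⟩
      sum (λ i → X⁺ t i * apply H (δ l) i) ≡⟨ apply-adjoint H (X⁺ t) (δ l) ⟨
      sum (λ i → applyˡ H (X⁺ t) i * δ l i) ≡⟨ sum-cong-≗ {k} (λ i → *-comm (applyˡ H (X⁺ t) i) (δ l i)) ⟩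
      sum (λ i → δ l i * applyˡ H (X⁺ t) i) ≡⟨ sum-δ l (applyˡ H (X⁺ t)) ⟩
      applyˡ H (X⁺ t) l ∎
      where open ≡-Reasoning

    code : Code p (suc q) k m
    code = (tabulate ρ , tabulate τ) , H , tabulate y , tabulate column

    code∈codes : ∀ E → (suc k ℕ.* n) ℕ.^ k ℕ.≤ E → code ∈ codes (growth k) E ((suc k ℕ.* n) ℕ.^ k) n p (suc q) k m
    code∈codes E P≤E = ∈-concatMap (codesOver (growth k) n p (suc q) k m)
      (∈-filter⁺ (dense? ((suc k ℕ.* n) ℕ.^ k) n) (∈-hermiteForms E H reduced (ℕ.≤-trans det≤ P≤E)) dense)
      (∈-cartesianProductWith⁺ (λ rows YV → rows , H , YV)
        (∈-cartesianProduct⁺ (∈-vectorsOver⁺ (tabulate ρ) (λ l → ∈-allFin (lookup (tabulate ρ) l)))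
                             (∈-vectorsOver⁺ (tabulate τ) (λ t → ∈-allFin (lookup (tabulate τ) t))))
        (∈-cartesianProduct⁺
          (∈-vectorsOver⁺ (tabulate y) (λ t → subst (_∈ boundedRows (growth k) H) (sym (lookup∘tabulate y t))
            (∈-boundedRows (growth k) H (suc ν) (X⁺ t) (y t) (νy≡X⁺H t) (X⁺-bound t))))
          (∈-vectorsOver⁺ (tabulate column) (λ j → subst (_∈ points n H) (sym (lookup∘tabulate column j)) (column∈points j)))))

    -- X M₀ = (X H)(H⁻¹ M₀), where `apply-adjoint` moves `H` from one factor to the other.
    decode-row : ∀ t j → sum (λ l → lookup (y t) l * substitute H (entries (column j)) l) ≡ + M (τ t) j
    decode-row t j = *-cancelˡ-≡ (+ suc ν) _ _ (begin
      + suc ν * sum (λ l → lookup (y t) l * b l) ≡⟨ sum-scale (+ suc ν) (lookup (y t)) b ⟨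
      sum (λ l → + suc ν * lookup (y t) l * b l) ≡⟨ sum-cong-≗ {k} (λ l → cong (_* b l) (νy≡X⁺H t l)) ⟩
      sum (λ l → applyˡ H (X⁺ t) l * b l) ≡⟨ apply-adjoint H (X⁺ t) b ⟩
      sum (λ l → X⁺ t l * apply H b l) ≡⟨ sum-cong-≗ {k} (λ l → cong (X⁺ t l *_) (trans (column-spans j l) (cong +_ (lookup∘tabulate _ l)))) ⟩
      sum (λ l → X⁺ t l * + M (ρ l) j) ≡⟨ comb⁺ t j ⟨
      + suc ν * + M (τ t) j ∎)
      where
      open ≡-Reasoning
      b = substitute H (entries (column j))

    decode-code : ∀ i j → decode code i j ≡ M i j
    decode-code i j with any? (λ l → lookup (tabulate ρ) l Fin.≟ i) | any? (λ t → lookup (tabulate τ) t Fin.≟ i)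
    ... | yes (l , ρl≡i) | _ = trans (cong (λ v → lookup v l) (lookup∘tabulate column j))
          (trans (lookup∘tabulate _ l) (cong (λ i → M i j) (trans (sym (lookup∘tabulate ρ l)) ρl≡i)))
    ... | no _ | yes (t , τt≡i) = trans
          (cong₂ (λ y v → ∣ sum (λ l → lookup y l * substitute H (entries v) l) ∣) (lookup∘tabulate y t) (lookup∘tabulate column j))
          (trans (cong ∣_∣ (decode-row t j)) (cong (λ i → M i j) (trans (sym (lookup∘tabulate τ t)) τt≡i)))
    ... | no i∉ρ | no i∉τ with cover i
    ... | inj₁ (l , ρl≡i) = contradiction (l , trans (lookup∘tabulate ρ l) ρl≡i) i∉ρ
    ... | inj₂ (t , τt≡i) = contradiction (t , trans (lookup∘tabulate τ t) τt≡i) i∉τ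

-- Counting codes by summation over Hermite forms

module CodeCount where
  open Counting
  open Arithmetic
  open GaussianElimination using (growth)
  open HermiteForms
  open LatticeCodes using (Code; points; codes; codesOver; dense?)
  open import Data.List.Base
    using (List; []; _∷_; map; length; filter; upTo; allFin; cartesianProduct; cartesianProductWith; _++_)
  open import Data.List.Membership.Propositional.Properties using (∈-filter⁻; ∈-upTo⁻)
  open import Data.List.Properties using (length-tabulate; map-++)
  open import Data.Nat.Base
  open import Data.Nat.DivMod using (_/_; m/n*n≤m; m*n/n≡m; /-monoˡ-≤; m/n/o≡m/[n*o]; /-congʳ; n/1≡n)
  open import Data.Nat.ListAction using (sum)
  open import Data.Nat.ListAction.Properties using (sum-++)
  open import Data.Nat.Logarithm using (⌊log₂_⌋)
  open import Data.Nat.Properties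
  open import Data.Nat.Tactic.RingSolver using (solve-∀)
  open ≤-Reasoning

  ^-distribˡ-* : ∀ m n k → (m * n) ^ k ≡ m ^ k * n ^ k
  ^-distribˡ-* m n zero    = refl
  ^-distribˡ-* m n (suc k) = trans (cong (m * n *_) (^-distribˡ-* m n k)) (lemma m n (m ^ k) (n ^ k))
    where
    lemma : ∀ a b c d → a * b * (c * d) ≡ a * c * (b * d)
    lemma = solve-∀

  ∑-cartesianProductWith : ∀ {A B C : Set} (f : A → B → C) xs ys g →
    ∑ (cartesianProductWith f xs ys) g ≡ ∑ xs (λ x → ∑ ys (λ y → g (f x y)))
  ∑-cartesianProductWith f []       ys g = refl
  ∑-cartesianProductWith f (x ∷ xs) ys g = begin-equality
    sum (map g (map (f x) ys ++ cartesianProductWith f xs ys)) ≡⟨ cong sum (map-++ g (map (f x) ys) _) ⟩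
    sum (map g (map (f x) ys) ++ map g (cartesianProductWith f xs ys)) ≡⟨ sum-++ (map g (map (f x) ys)) _ ⟩
    ∑ (map (f x) ys) g + ∑ (cartesianProductWith f xs ys) g ≡⟨ cong₂ _+_ (∑-map (f x) ys g) (∑-cartesianProductWith f xs ys g) ⟩
    ∑ ys (g ∘ f x) + ∑ xs (λ x → ∑ ys (λ y → g (f x y))) ∎

  -- Covers two regimes: for `s` at least 2 a constant `Z` works for all `E`, for `s` = 1 it is
  -- logarithmic in `E`.
  PowerSumBound : ℕ → ℕ → ℕ → Set
  PowerSumBound E s Z = ∀ Q → ∑ (upTo E) (λ i → (Q / suc i) ^ s) ≤ Z * Q ^ s

  module HermiteSum (E P : ℕ) where

    quotient : ∀ {k} → Triangular k → ℕ
    quotient H = (P / det H) {{det-nonZero H}}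

    G : ℕ → ℕ → ℕ
    G k s = ∑ (hermiteForms E k) (λ H → quotient H ^ s)

    -- Nested floors give P / ((1 + δ) det H) = R / (1 + δ) with R = P / det H, so the sum over δ is
    -- a power sum at `R`. The `det H` choices of `h` absorb one factor of `R`, since det H · R ≤ P,
    -- and the exponent drops by one.
    G-suc : ∀ k s {Z} → PowerSumBound E (suc s) Z → G (suc k) (suc s) ≤ Z * P * G k s
    G-suc k s {Z} bound = begin
      G (suc k) (suc s)
        ≡⟨ ∑-concatMap (λ H → cartesianProductWith (λ h δ → cons δ h H) (residues H) (upTo E)) (hermiteForms E k) (λ H → quotient H ^ suc s) ⟩
      ∑ (hermiteForms E k) (λ H → ∑ (cartesianProductWith (λ h δ → cons δ h H) (residues H) (upTo E)) (λ H → quotient H ^ suc s))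
        ≤⟨ ∑-mono (hermiteForms E k) block ⟩
      ∑ (hermiteForms E k) (λ H → Z * P * quotient H ^ s)
        ≡⟨ *-distribˡ-∑ (Z * P) (hermiteForms E k) (λ H → quotient H ^ s) ⟨
      Z * P * G k s ∎
      where
      block : ∀ H → ∑ (cartesianProductWith (λ h δ → cons δ h H) (residues H) (upTo E)) (λ H → quotient H ^ suc s) ≤ Z * P * quotient H ^ s
      block H = begin
        ∑ (cartesianProductWith (λ h δ → cons δ h H) (residues H) (upTo E)) (λ H → quotient H ^ suc s)
          ≡⟨ ∑-cartesianProductWith (λ h δ → cons δ h H) (residues H) (upTo E) (λ H → quotient H ^ suc s) ⟩
        ∑ (residues H) (λ h → ∑ (upTo E) (λ δ → quotient (cons δ h H) ^ suc s))
          ≡⟨ ∑-cong (residues H) (λ h → ∑-cong (upTo E) (λ δ → cong (_^ suc s) (divide δ))) ⟩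
        ∑ (residues H) (λ _ → ∑ (upTo E) (λ δ → (R / suc δ) ^ suc s))
          ≡⟨ ∑-const (residues H) (∑ (upTo E) (λ δ → (R / suc δ) ^ suc s)) ⟩
        length (residues H) * ∑ (upTo E) (λ δ → (R / suc δ) ^ suc s)
          ≤⟨ *-mono-≤ (≤-reflexive (length-residues H)) (bound R) ⟩
        det H * (Z * (R * R ^ s))
          ≡⟨ lemma (det H) Z R (R ^ s) ⟩
        Z * (R * det H) * R ^ s
          ≤⟨ *-monoˡ-≤ (R ^ s) (*-monoʳ-≤ Z (m/n*n≤m P (det H) {{det-nonZero H}})) ⟩
        Z * P * R ^ s ∎
        where
        R = quotient H
        lemma : ∀ d z r t → d * (z * (r * t)) ≡ z * (r * d) * t
        lemma = solve-∀
        divide : ∀ δ → (P / (suc δ * det H)) {{m*n≢0 (suc δ) (det H) {{_}} {{det-nonZero H}}}} ≡ R / suc δ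
        divide δ = trans (/-congʳ {{m*n≢0 (suc δ) (det H) {{_}} {{det-nonZero H}}}} {{m*n≢0 (det H) (suc δ) {{det-nonZero H}}}} (*-comm (suc δ) (det H)))
          (sym (m/n/o≡m/[n*o] P (det H) (suc δ) {{det-nonZero H}} {{_}} {{m*n≢0 (det H) (suc δ) {{det-nonZero H}}}}))

    -- The exponent descends from `k + x` to `1 + x`. All steps but the last have exponent at least
    -- 2 and cost a factor 2; the last one costs `Z`.
    G-bound : ∀ k x {Z} → 1 ≤ Z → PowerSumBound E (1 + x) Z → G k (k + x) ≤ 2 ^ k * (Z * P ^ (k + x))
    G-bound zero x {Z} 1≤Z bound = begin
      (P / 1) ^ x + 0 ≡⟨ trans (+-identityʳ _) (cong (_^ x) (n/1≡n P)) ⟩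
      P ^ x ≤⟨ m≤n*m (P ^ x) Z {{>-nonZero 1≤Z}} ⟩
      Z * P ^ x ≡⟨ +-identityʳ (Z * P ^ x) ⟨
      1 * (Z * P ^ x) ∎
    G-bound (suc zero) x {Z} 1≤Z bound = begin
      G 1 (suc x) ≤⟨ G-suc 0 x {Z} bound ⟩
      Z * P * ((P / 1) ^ x + 0) ≡⟨ cong (Z * P *_) (trans (+-identityʳ _) (cong (_^ x) (n/1≡n P))) ⟩
      Z * P * P ^ x ≡⟨ *-assoc Z P (P ^ x) ⟩
      Z * (P * P ^ x) ≤⟨ m≤n*m (Z * (P * P ^ x)) 2 ⟩
      2 * (Z * (P * P ^ x)) ∎
    G-bound (suc (suc k)) x {Z} 1≤Z bound = begin
      G (suc (suc k)) (suc (suc (k + x))) ≤⟨ G-suc (suc k) (suc (k + x)) {2} (∑-floor^ (k + x) E) ⟩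
      2 * P * G (suc k) (suc (k + x)) ≤⟨ *-monoʳ-≤ (2 * P) (G-bound (suc k) x 1≤Z bound) ⟩
      2 * P * (2 ^ suc k * (Z * P ^ (suc k + x))) ≡⟨ lemma P (2 ^ suc k) Z (P ^ (suc k + x)) ⟩
      2 * 2 ^ suc k * (Z * (P * P ^ (suc k + x))) ∎
      where
      lemma : ∀ p a z b → 2 * p * (a * (z * b)) ≡ 2 * a * (z * (p * b))
      lemma = solve-∀

  codeFactor : ℕ → ℕ → ℕ → ℕ → ℕ
  codeFactor C p k m = p ^ k * p ^ m * (suc (C + C) ^ k) ^ m

  -- With D = det H there are O(D^m) choices for the remaining rows and pts^q for the columns. As q
  -- = m + (k + x), density bounds (D · pts)^m by P^m, which leaves pts^(k + x) to be summed over
  -- the forms.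
  length-codes : ∀ C E P n p k m x {Z} → 1 ≤ Z → PowerSumBound E (1 + x) Z →
    length (codes C E P n p (m + (k + x)) k m) ≤ codeFactor C p k m * (2 ^ k * (Z * P ^ (m + (k + x))))
  length-codes C E P n p k m x {Z} 1≤Z bound = begin
    length (codes C E P n p q k m)
      ≡⟨ length-concatMap (codesOver C n p q k m) (filter (dense? P n) (hermiteForms E k)) ⟩
    ∑ (filter (dense? P n) (hermiteForms E k)) (length ∘ codesOver C n p q k m)
      ≤⟨ ∑-mono-∈ (filter (dense? P n) (hermiteForms E k)) (λ {H} H∈ → block H (proj₂ (∈-filter⁻ (dense? P n) {xs = hermiteForms E k} H∈))) ⟩
    ∑ (filter (dense? P n) (hermiteForms E k)) (λ H → K * P ^ m * quotient H ^ (k + x))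
      ≤⟨ ∑-filter (dense? P n) (hermiteForms E k) (λ H → K * P ^ m * quotient H ^ (k + x)) ⟩
    ∑ (hermiteForms E k) (λ H → K * P ^ m * quotient H ^ (k + x))
      ≡⟨ *-distribˡ-∑ (K * P ^ m) (hermiteForms E k) (λ H → quotient H ^ (k + x)) ⟨
    K * P ^ m * G k (k + x)
      ≤⟨ *-monoʳ-≤ (K * P ^ m) (G-bound k x 1≤Z bound) ⟩
    K * P ^ m * (2 ^ k * (Z * P ^ (k + x)))
      ≡⟨ lemma K (P ^ m) (2 ^ k) Z (P ^ (k + x)) ⟩
    K * (2 ^ k * (Z * (P ^ m * P ^ (k + x))))
      ≡⟨ cong (λ y → K * (2 ^ k * (Z * y))) (^-distribˡ-+-* P m (k + x)) ⟨
    K * (2 ^ k * (Z * P ^ q)) ∎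
    where
    q = m + (k + x)
    K = codeFactor C p k m
    open HermiteSum E P
    lemma : ∀ k a b z c → k * a * (b * (z * c)) ≡ k * (b * (z * (a * c)))
    lemma = solve-∀
    length-allFin^ : ∀ j → length (vectorsOver (allFin p) j) ≡ p ^ j
    length-allFin^ j = trans (length-vectorsOver (allFin p) j) (cong (_^ j) (length-tabulate {n = p} id))
    block : ∀ H → det H * length (points n H) ≤ P → length (codesOver C n p q k m H) ≤ K * P ^ m * quotient H ^ (k + x)
    block H dense = begin
      length (codesOver C n p q k m H)
        ≡⟨ trans (length-cartesianProductWith _ (cartesianProduct (vectorsOver (allFin p) k) (vectorsOver (allFin p) m)) (cartesianProduct (vectorsOver (boundedRows C H) m) (vectorsOver (points n H) q)))
             (cong₂ _*_ (trans (length-cartesianProductWith _,_ (vectorsOver (allFin p) k) (vectorsOver (allFin p) m)) (cong₂ _*_ (length-allFin^ k) (length-allFin^ m)))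
               (trans (length-cartesianProductWith _,_ (vectorsOver (boundedRows C H) m) (vectorsOver (points n H) q)) (cong₂ _*_ (length-vectorsOver (boundedRows C H) m) (length-vectorsOver (points n H) q)))) ⟩
      p ^ k * p ^ m * (length (boundedRows C H) ^ m * pts ^ q)
        ≤⟨ *-monoʳ-≤ (p ^ k * p ^ m) (*-monoˡ-≤ (pts ^ q) (^-monoˡ-≤ m (length-boundedRows C H))) ⟩
      p ^ k * p ^ m * ((suc (C + C) ^ k * det H) ^ m * pts ^ q)
        ≡⟨ cong₂ (λ a b → p ^ k * p ^ m * (a * b)) (^-distribˡ-* (suc (C + C) ^ k) (det H) m) (^-distribˡ-+-* pts m (k + x)) ⟩
      p ^ k * p ^ m * ((suc (C + C) ^ k) ^ m * det H ^ m * (pts ^ m * pts ^ (k + x)))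
        ≡⟨ lemma₁ (p ^ k * p ^ m) ((suc (C + C) ^ k) ^ m) (det H ^ m) (pts ^ m) (pts ^ (k + x)) ⟩
      K * (det H ^ m * pts ^ m) * pts ^ (k + x)
        ≡⟨ cong (λ a → K * a * pts ^ (k + x)) (^-distribˡ-* (det H) pts m) ⟨
      K * (det H * pts) ^ m * pts ^ (k + x)
        ≤⟨ *-mono-≤ (*-monoʳ-≤ K (^-monoˡ-≤ m dense)) (^-monoˡ-≤ (k + x) pts≤) ⟩
      K * P ^ m * quotient H ^ (k + x) ∎
      where
      pts = length (points n H)
      lemma₁ : ∀ a b c d e → a * (b * c * (d * e)) ≡ a * b * (c * d) * e
      lemma₁ = solve-∀
      pts≤ : pts ≤ quotient H
      pts≤ = ≤-trans (≤-reflexive (sym (m*n/n≡m pts (det H) {{det-nonZero H}})))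
        (/-monoˡ-≤ (det H) {{det-nonZero H}} (≤-trans (≤-reflexive (*-comm pts (det H))) dense))

  n≤2^n : ∀ n → n ≤ 2 ^ n
  n≤2^n zero    = z≤n
  n≤2^n (suc n) = begin
    suc n ≡⟨ +-comm 1 n ⟩
    n + 1 ≤⟨ +-mono-≤ (n≤2^n n) (m^n>0 2 n) ⟩
    2 ^ n + 2 ^ n ≡⟨ cong (2 ^ n +_) (+-identityʳ (2 ^ n)) ⟨
    2 ^ suc n ∎

  -- A power of two above the volume, as the doubling argument for the harmonic sum requires; its
  -- exponent stays linear in the logarithm of `n`.
  powerBound : ℕ → ℕ → ℕ
  powerBound n k = 2 ^ (k * (suc k + suc ⌊log₂ n ⌋))

  volume≤powerBound : ∀ n k → (suc k * n) ^ k ≤ powerBound n k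
  volume≤powerBound n k = begin
    (suc k * n) ^ k ≤⟨ ^-monoˡ-≤ k (*-mono-≤ (n≤2^n (suc k)) (<⇒≤ (n<2^[1+log] n))) ⟩
    (2 ^ suc k * 2 ^ suc ⌊log₂ n ⌋) ^ k ≡⟨ cong (_^ k) (^-distribˡ-+-* 2 (suc k) (suc ⌊log₂ n ⌋)) ⟨
    (2 ^ (suc k + suc ⌊log₂ n ⌋)) ^ k ≡⟨ ^-*-assoc 2 (suc k + suc ⌊log₂ n ⌋) k ⟩
    2 ^ ((suc k + suc ⌊log₂ n ⌋) * k) ≡⟨ cong (2 ^_) (*-comm (suc k + suc ⌊log₂ n ⌋) k) ⟩
    powerBound n k ∎

  codesOfRank : ∀ n p q k → List (Code p q k (p ∸ k))
  codesOfRank n p q k = codes (growth k) (powerBound n k) ((suc k * n) ^ k) n p q k (p ∸ k)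

  codesUpToRank : (n p q κ : ℕ) → ℕ
  codesUpToRank n p q κ = ∑ (upTo (suc κ)) (λ k → length (codesOfRank n p q k))

  -- Lower ranks cost no more than rank `κ` up to a constant, because n^(kq) increases with `k`.
  codesUpToRank-bound : ∀ p x κ → κ ≤ p → ∃[ K ] (∀ n Z → 1 ≤ n → 1 ≤ Z →
    (∀ k → k ≤ κ → PowerSumBound (powerBound n k) (1 + x) Z) →
    codesUpToRank n p (p + x) κ ≤ K * (n ^ (κ * (p + x)) * Z))
  codesUpToRank-bound p x κ κ≤p = ∑ (upTo (suc κ)) K , λ n Z 1≤n 1≤Z bound → begin
    ∑ (upTo (suc κ)) (λ k → length (codesOfRank n p (p + x) k))
      ≤⟨ ∑-mono-∈ (upTo (suc κ)) (λ {k} k∈ → single n Z k 1≤n 1≤Z (≤-pred (∈-upTo⁻ k∈)) bound) ⟩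
    ∑ (upTo (suc κ)) (λ k → K k * (n ^ (κ * (p + x)) * Z))
      ≡⟨ ∑-cong (upTo (suc κ)) (λ k → *-comm (K k) (n ^ (κ * (p + x)) * Z)) ⟩
    ∑ (upTo (suc κ)) (λ k → n ^ (κ * (p + x)) * Z * K k)
      ≡⟨ *-distribˡ-∑ (n ^ (κ * (p + x)) * Z) (upTo (suc κ)) K ⟨
    n ^ (κ * (p + x)) * Z * ∑ (upTo (suc κ)) K
      ≡⟨ *-comm (n ^ (κ * (p + x)) * Z) (∑ (upTo (suc κ)) K) ⟩
    ∑ (upTo (suc κ)) K * (n ^ (κ * (p + x)) * Z) ∎
    where
    K : ℕ → ℕ
    K k = codeFactor (growth k) p k (p ∸ k) * (2 ^ k * (suc k ^ (k * (p + x))))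
    single : ∀ n Z k → 1 ≤ n → 1 ≤ Z → k ≤ κ → (∀ k → k ≤ κ → PowerSumBound (powerBound n k) (1 + x) Z) →
      length (codesOfRank n p (p + x) k) ≤ K k * (n ^ (κ * (p + x)) * Z)
    single n Z k 1≤n 1≤Z k≤κ bound = begin
      length (codesOfRank n p (p + x) k)
        ≡⟨ cong (λ q → length (codesOfRank n p q k)) q≡ ⟩
      length (codesOfRank n p (p ∸ k + (k + x)) k)
        ≤⟨ length-codes (growth k) (powerBound n k) ((suc k * n) ^ k) n p k (p ∸ k) x 1≤Z (bound k k≤κ) ⟩
      F * (2 ^ k * (Z * ((suc k * n) ^ k) ^ (p ∸ k + (k + x))))
        ≡⟨ cong (λ q → F * (2 ^ k * (Z * ((suc k * n) ^ k) ^ q))) q≡ ⟨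
      F * (2 ^ k * (Z * ((suc k * n) ^ k) ^ (p + x)))
        ≡⟨ cong (λ y → F * (2 ^ k * (Z * y))) (trans (^-*-assoc (suc k * n) k (p + x)) (^-distribˡ-* (suc k) n (k * (p + x)))) ⟩
      F * (2 ^ k * (Z * (suc k ^ (k * (p + x)) * n ^ (k * (p + x)))))
        ≤⟨ *-monoʳ-≤ F (*-monoʳ-≤ (2 ^ k) (*-monoʳ-≤ Z (*-monoʳ-≤ (suc k ^ (k * (p + x))) (^-monoʳ-≤ n {{>-nonZero 1≤n}} (*-monoˡ-≤ (p + x) k≤κ))))) ⟩
      F * (2 ^ k * (Z * (suc k ^ (k * (p + x)) * n ^ (κ * (p + x)))))
        ≡⟨ lemma F (2 ^ k) Z (suc k ^ (k * (p + x))) (n ^ (κ * (p + x))) ⟩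
      K k * (n ^ (κ * (p + x)) * Z) ∎
      where
      F = codeFactor (growth k) p k (p ∸ k)
      q≡ : p + x ≡ p ∸ k + (k + x)
      q≡ = trans (cong (_+ x) (sym (m∸n+n≡m (≤-trans k≤κ κ≤p)))) (+-assoc (p ∸ k) k x)
      lemma : ∀ f a z b c → f * (a * (z * (b * c))) ≡ f * (a * b) * (c * z)
      lemma = solve-∀

-- Bounds on the number of matrices of low rank

module RankCount where
  open Counting
  open Rank using (rank≤; rank≥)
  open GaussianElimination
  open LatticeCodes using (Code; codes; decode; lookup-ext; module Encoding)
  open CodeCount using (codesOfRank; codesUpToRank; powerBound; volume≤powerBound)
  open import Data.Fin.Base using (Fin; zero; suc; toℕ; inject≤; fromℕ<)
  open import Data.Fin.Properties using (toℕ-inject≤; fromℕ<-toℕ; toℕ<n; fromℕ<-cong)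
  open import Data.Integer.Base using (+_)
  open import Data.List.Base using (List; map; length; filter; concatMap; upTo)
  open import Data.List.Membership.Propositional using (_∈_)
  open import Data.List.Membership.Propositional.Properties using (∈-filter⁺; ∈-filter⁻; ∈-map⁺; ∈-upTo⁺)
  open import Data.List.Properties using (length-map)
  open import Data.List.Relation.Unary.Unique.Propositional using (Unique)
  import Data.List.Relation.Unary.Unique.Propositional.Properties as Unique
  open import Data.Nat.Base
  open import Data.Nat.Properties
  open import Data.Rational.Base using (ℚ) renaming (_*_ to _*ℚ_)
  import Data.Rational.Properties as ℚ
  open import Data.Vec.Base using (lookup; tabulate)
  open import Data.Vec.Properties using (lookup∘tabulate; tabulate∘lookup; tabulate-cong)
  private module ℤΣ = IntegerSums
  open RationalSums using (sum; δ; sum-cong-≗; sum-swap; sum-δ; sum-zero)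

  matrices-unique : ∀ n d r → Unique (matrices n d r)
  matrices-unique n d r = vectorsOver-unique r (vectorsOver-unique d ([1⋯]-unique n))

  ∈-matrices⁺ : ∀ {n d r} (M : Matrix d r) → (∀ j i → lookup (lookup M j) i ∈ [1⋯ n ]) → M ∈ matrices n d r
  ∈-matrices⁺ M M∈ = ∈-vectorsOver⁺ M (λ j → ∈-vectorsOver⁺ (lookup M j) (M∈ j))

  ∈-matrices⁻ : ∀ {n d r} {M : Matrix d r} → M ∈ matrices n d r → ∀ j i → lookup (lookup M j) i ∈ [1⋯ n ]
  ∈-matrices⁻ {n} {d} M∈ j = ∈-vectorsOver⁻ [1⋯ n ] (∈-vectorsOver⁻ (vectorsOver [1⋯ n ] d) M∈ j)

  lowRank : (n d k r : ℕ) → List (Matrix d r)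
  lowRank n d k r = filter (λ M → rank M ≤? k) (matrices n d r)

  lowRank-unique : ∀ n d k r → Unique (lowRank n d k r)
  lowRank-unique n d k r = Unique.filter⁺ (λ M → rank M ≤? k) (matrices-unique n d r)

  ∈-lowRank⁻ : ∀ {n d k r} {M : Matrix d r} → M ∈ lowRank n d k r →
    (∀ j i → lookup (lookup M j) i ∈ [1⋯ n ]) × rank M ≤ k
  ∈-lowRank⁻ {n} {d} {k} {r} M∈ =
    let M∈′ , rank≤k = ∈-filter⁻ (λ M → rank M ≤? k) {xs = matrices n d r} M∈ in ∈-matrices⁻ M∈′ , rank≤k

  ∈-lowRank⁺ : ∀ {n d k r} {M : Matrix d r} → (∀ j i → lookup (lookup M j) i ∈ [1⋯ n ]) → rank M ≤ k →
    M ∈ lowRank n d k r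
  ∈-lowRank⁺ {k = k} {M = M} M∈ rank≤k = ∈-filter⁺ (λ M → rank M ≤? k) (∈-matrices⁺ M M∈) rank≤k

  -- Every matrix in `ms` is decoded from some code, so codes are at least as numerous. `build`
  -- reads the decoded array by rows or by columns, so that one count serves a matrix and its
  -- transpose.
  encoded-count : ∀ {A : Set} {p q} κ n (build : (Fin p → Fin (suc q) → ℕ) → A) (ms : List A) → Unique ms →
    (∀ {M} → M ∈ ms → Σ[ N ∈ (Fin p → Fin (suc q) → ℕ) ] (∀ i j → N i j ∈ [1⋯ n ]) ×
      (∀ f → (∀ i j → f i j ≡ N i j) → build f ≡ M) ×
      ((𝓔 : Elimination (λ i j → + N i j)) → Elimination.k 𝓔 ≤ κ)) →
    length ms ≤ codesUpToRank n p (suc q) κ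
  encoded-count {A} {p} {q} κ n build ms uniq encode = begin
    length ms ≤⟨ length-⊆ uniq ms⊆ ⟩
    length (concatMap built (upTo (suc κ))) ≡⟨ length-concatMap built (upTo (suc κ)) ⟩
    ∑ (upTo (suc κ)) (length ∘ built) ≡⟨ ∑-cong (upTo (suc κ)) (λ k → length-map (build ∘ decode) (codesOfRank n p (suc q) k)) ⟩
    ∑ (upTo (suc κ)) (λ k → length (codesOfRank n p (suc q) k)) ∎
    where
    open ≤-Reasoning
    built : ℕ → List A
    built k = map (build ∘ decode) (codesOfRank n p (suc q) k)
    ms⊆ : ∀ {M} → M ∈ ms → M ∈ concatMap built (upTo (suc κ))
    ms⊆ {M} M∈ with encode M∈
    ... | N , N∈ , build≡ , k≤κ = ∈-concatMap built (∈-upTo⁺ (s≤s (k≤κ 𝓔)))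
        (subst (_∈ built k) (build≡ (decode (proj₁ coded)) (proj₂ (proj₂ coded))) (∈-map⁺ (build ∘ decode) (proj₁ (proj₂ coded))))
      where
      𝓔 = eliminate (suc q) (λ i j → + N i j)
      open Elimination 𝓔 using (k; m; k+m≡p)
      open Encoding N N∈ 𝓔 using (code; code∈codes; decode-code)
      P = (suc k * n) ^ k
      coded : Σ[ c ∈ Code p (suc q) k (p ∸ k) ] c ∈ codesOfRank n p (suc q) k × (∀ i j → decode c i j ≡ N i j)
      coded = subst (λ m → Σ[ c ∈ Code p (suc q) k m ] c ∈ codes (growth k) (powerBound n k) P n p (suc q) k m × (∀ i j → decode c i j ≡ N i j))
        (trans (sym (m+n∸m≡n k m)) (cong (_∸ k) k+m≡p))
        (code , code∈codes (powerBound n k) (volume≤powerBound n k) , decode-code)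

  tabulate-lookup² : ∀ {d r} (M : Matrix d r) (f : Fin r → Fin d → ℕ) → (∀ j i → f j i ≡ lookup (lookup M j) i) → tabulate (λ j → tabulate (f j)) ≡ M
  tabulate-lookup² M f eq = trans (tabulate-cong (λ j → trans (tabulate-cong (eq j)) (tabulate∘lookup (lookup M j)))) (tabulate∘lookup M)

  -- Solving for the unit vectors from the left certifies that `M` has at least the rank that
  -- elimination finds.
  L-upper-rows : ∀ n d κ r .{{_ : NonZero r}} → L n d κ r ≤ codesUpToRank n d r κ
  L-upper-rows n d κ (suc r) = encoded-count κ n (λ f → tabulate (λ j → tabulate (λ i → f i j))) (lowRank n d κ (suc r))
    (lowRank-unique n d κ (suc r)) λ {M} M∈ →
      (λ i j → lookup (lookup M j) i) , (λ i j → proj₁ (∈-lowRank⁻ {n} {d} {κ} {suc r} M∈) j i) ,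
      (λ f eq → tabulate-lookup² M (λ j i → f i j) (λ j i → eq i j)) ,
      λ 𝓔 → let open Elimination 𝓔 in ≤-trans
        (rank≥ M ρ γ (λ s → proj₁ (solveˡ (ℤΣ.δ s))) (λ s → proj₁ (proj₂ (solveˡ (ℤΣ.δ s))))
          (λ s → proj₁ (proj₂ (proj₂ (solveˡ (ℤΣ.δ s))))) (λ s → proj₂ (proj₂ (proj₂ (solveˡ (ℤΣ.δ s))))))
        (proj₂ (∈-lowRank⁻ {n} {d} {κ} {suc r} M∈))

  -- Transposition exchanges `ρ` and `γ`, so here the certificate comes from `solveʳ`.
  L-upper-columns : ∀ n d κ r .{{_ : NonZero d}} → L n d κ r ≤ codesUpToRank n r d κ
  L-upper-columns n (suc d) κ r = encoded-count κ n (λ f → tabulate (λ j → tabulate (f j))) (lowRank n (suc d) κ r)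
    (lowRank-unique n (suc d) κ r) λ {M} M∈ →
      (λ j i → lookup (lookup M j) i) , proj₁ (∈-lowRank⁻ {n} {suc d} {κ} {r} M∈) ,
      tabulate-lookup² M ,
      λ 𝓔 → let open Elimination 𝓔 in ≤-trans
        (rank≥ M γ ρ (λ s → proj₁ (solveʳ (ℤΣ.δ s))) (λ s → proj₁ (proj₂ (solveʳ (ℤΣ.δ s))))
          (λ s → proj₁ (proj₂ (proj₂ (solveʳ (ℤΣ.δ s))))) (λ s → proj₂ (proj₂ (proj₂ (solveʳ (ℤΣ.δ s))))))
        (proj₂ (∈-lowRank⁻ {n} {suc d} {κ} {r} M∈))

  -- A left inverse of the inclusion of the first `suc k` indices; at later indices it repeats the
  -- first row or column.
  retract : ∀ {d} k → Fin d → Fin (suc k)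
  retract k i with toℕ i <? suc k
  ... | yes i<k = fromℕ< i<k
  ... | no  _   = zero

  retract-inject : ∀ {d k} (k≤d : suc k ≤ d) (l : Fin (suc k)) → retract k (inject≤ l k≤d) ≡ l
  retract-inject {k = k} k≤d l with toℕ (inject≤ l k≤d) <? suc k
  ... | yes i<k = trans (fromℕ<-cong _ _ (toℕ-inject≤ l k≤d) i<k (toℕ<n l)) (fromℕ<-toℕ l (toℕ<n l))
  ... | no  i≮k = contradiction (subst (_< suc k) (sym (toℕ-inject≤ l k≤d)) (toℕ<n l)) i≮k

  L-lower-rows : ∀ n d k r → suc k ≤ d → n ^ (suc k * r) ≤ L n d (suc k) r
  L-lower-rows n d k r k≤d = begin
    n ^ (suc k * r) ≡⟨ ^-*-assoc n (suc k) r ⟨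
    (n ^ suc k) ^ r ≡⟨ cong (λ m → (m ^ suc k) ^ r) (length-[1⋯] n) ⟨
    (length [1⋯ n ] ^ suc k) ^ r ≡⟨ cong (_^ r) (length-vectorsOver [1⋯ n ] (suc k)) ⟨
    length (vectorsOver [1⋯ n ] (suc k)) ^ r ≡⟨ length-vectorsOver (vectorsOver [1⋯ n ] (suc k)) r ⟨
    length (matrices n (suc k) r) ≤⟨ length-injection extend (matrices-unique n (suc k) r) extend∈ (λ _ _ → extend-injective) ⟩
    L n d (suc k) r ∎
    where
    open ≤-Reasoning
    extend : Matrix (suc k) r → Matrix d r
    extend V = tabulate (λ j → tabulate (λ i → lookup (lookup V j) (retract k i)))
    lookup-extend : ∀ V j i → lookup (lookup (extend V) j) i ≡ lookup (lookup V j) (retract k i)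
    lookup-extend V j i = trans (cong (λ v → lookup v i) (lookup∘tabulate _ j)) (lookup∘tabulate _ i)
    extend-injective : ∀ {V V′} → extend V ≡ extend V′ → V ≡ V′
    extend-injective {V} {V′} eq = lookup-ext λ j → lookup-ext λ l →
      subst (λ l → lookup (lookup V j) l ≡ lookup (lookup V′ j) l) (retract-inject k≤d l)
        (trans (sym (lookup-extend V j (inject≤ l k≤d))) (trans (cong (λ M → lookup (lookup M j) (inject≤ l k≤d)) eq) (lookup-extend V′ j (inject≤ l k≤d))))
    extend∈ : ∀ {V} → V ∈ matrices n (suc k) r → extend V ∈ lowRank n d (suc k) r
    extend∈ {V} V∈ = ∈-lowRank⁺ {M = extend V} (λ j i → subst (_∈ [1⋯ n ]) (sym (lookup-extend V j i)) (∈-matrices⁻ V∈ j (retract k i)))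
      (rank≤ (extend V) (suc k) (λ l j → fromℕ (lookup (lookup V j) l)) λ c Bc≡0 i →
        trans (sum-cong-≗ {r} (λ j → cong (λ m → c j *ℚ fromℕ m) (lookup-extend V j i))) (Bc≡0 (retract k i)))

  L-lower-columns : ∀ n d k r → suc k ≤ r → n ^ (suc k * d) ≤ L n d (suc k) r
  L-lower-columns n d k r k≤r = begin
    n ^ (suc k * d) ≡⟨ cong (n ^_) (*-comm (suc k) d) ⟩
    n ^ (d * suc k) ≡⟨ ^-*-assoc n d (suc k) ⟨
    (n ^ d) ^ suc k ≡⟨ cong (λ m → (m ^ d) ^ suc k) (length-[1⋯] n) ⟨
    (length [1⋯ n ] ^ d) ^ suc k ≡⟨ cong (_^ suc k) (length-vectorsOver [1⋯ n ] d) ⟨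
    length (vectorsOver [1⋯ n ] d) ^ suc k ≡⟨ length-vectorsOver (vectorsOver [1⋯ n ] d) (suc k) ⟨
    length (matrices n d (suc k)) ≤⟨ length-injection extend (matrices-unique n d (suc k)) extend∈ (λ _ _ → extend-injective) ⟩
    L n d (suc k) r ∎
    where
    open ≤-Reasoning
    extend : Matrix d (suc k) → Matrix d r
    extend V = tabulate (λ j → lookup V (retract k j))
    extend-injective : ∀ {V V′} → extend V ≡ extend V′ → V ≡ V′
    extend-injective {V} {V′} eq = lookup-ext λ l →
      subst (λ l → lookup V l ≡ lookup V′ l) (retract-inject k≤r l)
        (trans (sym (lookup∘tabulate _ (inject≤ l k≤r))) (trans (cong (λ M → lookup M (inject≤ l k≤r)) eq) (lookup∘tabulate _ (inject≤ l k≤r))))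
    extend∈ : ∀ {V} → V ∈ matrices n d (suc k) → extend V ∈ lowRank n d (suc k) r
    extend∈ {V} V∈ = ∈-lowRank⁺ {M = extend V}
      (λ j i → subst (λ v → lookup v i ∈ [1⋯ n ]) (sym (lookup∘tabulate _ j)) (∈-matrices⁻ V∈ (retract k j) i))
      -- The extension factors as `V` times the selection matrix of `retract`, whose `suc k` rows
      -- bound the rank.
      (rank≤ (extend V) (suc k) (λ l j → δ (retract k j) l) λ c Bc≡0 i →
        trans (sum-cong-≗ {r} (λ j → cong (c j *ℚ_) (entry i j)))
          (trans (sum-swap c (λ l → fromℕ (lookup (lookup V l) i)) (λ j l → δ (retract k j) l))
            (sum-zero _ (λ l → trans (cong (fromℕ (lookup (lookup V l) i) *ℚ_) (Bc≡0 l)) (ℚ.*-zeroʳ (fromℕ (lookup (lookup V l) i)))))))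
      where
      entry : ∀ i j → columns (extend V) j i ≡ sum (λ l → fromℕ (lookup (lookup V l) i) *ℚ δ (retract k j) l)
      entry i j = trans (cong (λ v → fromℕ (lookup v i)) (lookup∘tabulate _ j))
        (sym (trans (sum-cong-≗ {suc k} (λ l → ℚ.*-comm (fromℕ (lookup (lookup V l) i)) (δ (retract k j) l)))
          (sum-δ (retract k j) (λ l → fromℕ (lookup (lookup V l) i)))))

-- Many singular square matrices from reduced fractions

module SingularFamily where
  open Counting
  open Arithmetic
  open Rank using (rank≤; fromℤ; fromℕ≡fromℤ; fromℤ-+; fromℤ-*; fromℤ-0; fromℤ-injective; *-cancel-zero)
  open GaussianElimination using (argmax; ∣sum∣≤)
  open LatticeCodes using (lookup-ext)
  open CodeCount using (^-distribˡ-*)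
  open RankCount using (lowRank; lowRank-unique; ∈-lowRank⁺; ∈-lowRank⁻)
  open import Algebra.Bundles using (CommutativeRing)
  import Algebra.Properties.Semiring.Sum as SemiringSum
  open import Data.Fin.Base using (Fin; zero; suc; toℕ; splitAt; _↑ˡ_; _↑ʳ_; punchIn)
  open import Data.Fin.Properties using (splitAt-↑ˡ; splitAt-↑ʳ; toℕ-↑ˡ; toℕ-injective; punchInᵢ≢i)
  open import Data.Integer.Base as ℤ using (ℤ; 0ℤ)
  import Data.Integer.Properties as ℤ
  import Data.Integer.Tactic.RingSolver as ℤSolver
  open import Data.List.Base using (List; []; _∷_; length; upTo; concatMap; cartesianProduct)
  open import Data.List.Membership.Propositional using (_∈_; find)
  open import Data.List.Membership.Propositional.Properties using (∈-cartesianProduct⁻; ∈-concatMap⁻; ∈-upTo⁻)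
  open import Data.List.Properties using (length-upTo)
  open import Data.List.Relation.Unary.All as All using ([]; _∷_)
  open import Data.List.Relation.Unary.AllPairs using ([]; _∷_)
  open import Data.List.Relation.Unary.Unique.Propositional using (Unique)
  import Data.List.Relation.Unary.Unique.Propositional.Properties as Unique
  open import Data.Nat.Base
  open import Data.Nat.Coprimality using (coprime-divisor; gcd≡1⇒coprime)
  import Data.Nat.Coprimality as Coprime
  open import Data.Nat.Divisibility
  open import Data.Nat.DivMod using (_/_; _%_; m%n<n; m≡m%n+[m/n]*n; m/n*n≤m; m/n*n≡m)
  import Data.Nat.DivMod as ℕ
  open import Data.Nat.GCD using (gcd)
  open import Data.Nat.Properties
  open import Data.Nat.Tactic.RingSolver using (solve-∀)
  open import Data.Rational.Base as ℚ using (ℚ; 0ℚ)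
  import Data.Rational.Properties as ℚ
  open import Data.Sum.Base using (inj₁; inj₂; [_,_]′)
  open import Data.Vec.Base using (Vec; lookup; tabulate)
  open import Data.Vec.Properties using (lookup∘tabulate)
  open import Relation.Binary.Definitions using (tri<; tri≈; tri>)
  private
    module ℕΣ = SemiringSum +-*-semiring
    module ℤΣ = IntegerSums
    module ℚΣ = RationalSums

  concatMap-unique : ∀ {A B : Set} (f : A → List B) {xs} → Unique xs → (∀ x → Unique (f x)) →
    (∀ {x y z} → z ∈ f x → z ∈ f y → x ≡ y) → Unique (concatMap f xs)
  concatMap-unique f []            f-unique f-disjoint = []
  concatMap-unique f (x∉xs ∷ uniq) f-unique f-disjoint = Unique.++⁺ (f-unique _)
    (concatMap-unique f uniq f-unique f-disjoint)
    λ (z∈fx , z∈rest) → let y , y∈xs , z∈fy = find (∈-concatMap⁻ f z∈rest)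
                        in All.lookup x∉xs y∈xs (f-disjoint z∈fx z∈fy)

  +sum : ∀ {n} (f : Fin n → ℕ) → ℤ.+ ℕΣ.sum f ≡ ℤΣ.sum (λ i → ℤ.+ f i)
  +sum {zero}  f = refl
  +sum {suc n} f = cong (λ z → ℤ.+ f zero ℤ.+ z) (+sum (f ∘ suc))

  fromℕ-* : ∀ a b → fromℕ (a * b) ≡ fromℕ a ℚ.* fromℕ b
  fromℕ-* a b = trans (fromℕ≡fromℤ (a * b)) (trans (cong fromℤ (ℤ.pos-* a b)) (trans (fromℤ-* (ℤ.+ a) (ℤ.+ b))
    (sym (cong₂ ℚ._*_ (fromℕ≡fromℤ a) (fromℕ≡fromℤ b)))))

  fromℕ-sum : ∀ {n} (f : Fin n → ℕ) → fromℕ (ℕΣ.sum f) ≡ ℚΣ.sum (λ i → fromℕ (f i))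
  fromℕ-sum {zero}  f = refl
  fromℕ-sum {suc n} f = trans (fromℕ≡fromℤ (f zero + ℕΣ.sum (f ∘ suc)))
    (trans (fromℤ-+ (ℤ.+ f zero) (ℤ.+ ℕΣ.sum (f ∘ suc)))
      (cong₂ ℚ._+_ (sym (fromℕ≡fromℤ (f zero))) (trans (sym (fromℕ≡fromℤ (ℕΣ.sum (f ∘ suc)))) (fromℕ-sum (f ∘ suc)))))

  fromℕ-≢0 : ∀ n .{{_ : NonZero n}} → fromℕ n ≢ 0ℚ
  fromℕ-≢0 (suc n) eq with () ← fromℤ-injective (trans (sym (fromℕ≡fromℤ (suc n))) (trans eq (sym fromℤ-0)))

  orthogonal-combination : ∀ {k d} (b : Fin d → ℚ) (a : Fin k → ℚ) (V : Fin d → Fin k → ℚ) (y : Fin d → ℚ) {q} → q ≢ 0ℚ →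
    (∀ j → q ℚ.* y j ≡ ℚΣ.sum (λ l → a l ℚ.* V j l)) → (∀ l → ℚΣ.sum (λ j → b j ℚ.* V j l) ≡ 0ℚ) →
    ℚΣ.sum (λ j → b j ℚ.* y j) ≡ 0ℚ
  orthogonal-combination {k} {d} b a V y {q} q≢0 qy≡aV bV≡0 = *-cancel-zero q≢0 (ℚΣ.sum (λ j → b j ℚ.* y j))
    (trans (ℚΣ.*-distribˡ-sum q (λ j → b j ℚ.* y j))
      (trans (ℚΣ.sum-cong-≗ {d} (λ j → trans (x∙yz≈y∙xz q (b j) (y j)) (cong (b j ℚ.*_) (qy≡aV j))))
        (trans (ℚΣ.sum-swap b a V)
          (ℚΣ.sum-zero _ (λ l → trans (cong (a l ℚ.*_) (bV≡0 l)) (ℚ.*-zeroʳ (a l)))))))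
    where open import Algebra.Properties.CommutativeSemigroup (CommutativeRing.*-commutativeSemigroup ℚ.+-*-commutativeRing) using (x∙yz≈y∙xz)

  sum-mono : ∀ {n} (f : Fin n → ℕ) B → (∀ i → f i ≤ B) → ℕΣ.sum f ≤ n * B
  sum-mono {zero}  f B f≤B = z≤n
  sum-mono {suc n} f B f≤B = +-mono-≤ (f≤B zero) (sum-mono (f ∘ suc) B (f≤B ∘ suc))

  -- In the equation whose index maximises the absolute value of `y`, the diagonal term outweighs
  -- all others together unless this maximum is 0.
  diagonallyDominant⇒injective : ∀ {κ} B (V : Fin (suc κ) → Fin (suc κ) → ℕ) →
    (∀ j l → j ≢ l → V j l ≤ B) → (∀ l → κ * B < V l l) →
    ∀ (y : Fin (suc κ) → ℤ) → (∀ j → ℤΣ.sum (λ l → y l ℤ.* ℤ.+ V j l) ≡ 0ℤ) → ∀ l → y l ≡ 0ℤ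
  diagonallyDominant⇒injective {κ} B V small large y yV≡0 l =
    ℤ.∣i∣≡0⇒i≡0 (n≤0⇒n≡0 (≤-trans (maximal l) (≤-reflexive Y≡0)))
    where
    i = proj₁ (argmax (λ l → ℤ.∣ y l ∣))
    maximal : ∀ l → ℤ.∣ y l ∣ ≤ ℤ.∣ y i ∣
    maximal = proj₂ (argmax (λ l → ℤ.∣ y l ∣))
    Y = ℤ.∣ y i ∣
    term : Fin (suc κ) → ℤ
    term l = y l ℤ.* ℤ.+ V i l
    rest = ℤΣ.sum (term ∘ punchIn i)
    open SemiringSum (CommutativeRing.semiring ℤ.+-*-commutativeRing) using (sum-remove)
    isolated : term i ≡ ℤ.- rest
    isolated = trans (lemma (term i) rest) (trans (cong (ℤ._+ ℤ.- rest) (trans (sym (sum-remove {i = i} term)) (yV≡0 i))) (ℤ.+-identityˡ (ℤ.- rest)))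
      where
      lemma : ∀ x r → x ≡ (x ℤ.+ r) ℤ.+ ℤ.- r
      lemma = ℤSolver.solve-∀
    bound : Y * V i i ≤ Y * (κ * B)
    bound = begin
      Y * V i i ≡⟨ ℤ.abs-* (y i) (ℤ.+ V i i) ⟨
      ℤ.∣ term i ∣ ≡⟨ trans (cong ℤ.∣_∣ isolated) (ℤ.∣-i∣≡∣i∣ rest) ⟩
      ℤ.∣ rest ∣ ≤⟨ ∣sum∣≤ (term ∘ punchIn i) (λ l → ≤-trans (≤-reflexive (ℤ.abs-* (y (punchIn i l)) (ℤ.+ V i (punchIn i l))))
                                   (*-mono-≤ (maximal (punchIn i l)) (small i (punchIn i l) (punchInᵢ≢i i l ∘ sym)))) ⟩
      κ * (Y * B) ≡⟨ lemma κ Y B ⟩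
      Y * (κ * B) ∎
      where
      open ≤-Reasoning
      lemma : ∀ k y b → k * (y * b) ≡ y * (k * b)
      lemma = solve-∀
    Y≡0 : Y ≡ 0
    Y≡0 with Y in eq
    ... | zero  = refl
    ... | suc Y′ = contradiction
      (*-cancelˡ-≤ (suc Y′) (subst (λ y → y * V i i ≤ y * (κ * B)) eq bound))
      (<⇒≱ (large i))

  %≡⇒∣ : ∀ q .{{_ : NonZero q}} a b → a % q ≡ b % q → q ∣ ∣ a - b ∣
  %≡⇒∣ q a b eq = divides ∣ a / q - b / q ∣ (begin-equality
    ∣ a - b ∣ ≡⟨ cong₂ ∣_-_∣ (m≡m%n+[m/n]*n a q) (m≡m%n+[m/n]*n b q) ⟩
    ∣ a % q + a / q * q - b % q + b / q * q ∣ ≡⟨ cong (λ r → ∣ a % q + a / q * q - r + b / q * q ∣) eq ⟨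
    ∣ a % q + a / q * q - a % q + b / q * q ∣ ≡⟨ ∣m+n-m+o∣≡∣n-o∣ (a % q) (a / q * q) (b / q * q) ⟩
    ∣ a / q * q - b / q * q ∣ ≡⟨ *-distribʳ-∣-∣ q (a / q) (b / q) ⟨
    ∣ a / q - b / q ∣ * q ∎)
    where open ≤-Reasoning

  -- The k = κ + 1 upper rows have their columns in the lattice v₀ + ∑ cₗ vₗ ≡ 0 (mod q) of index q.
  -- Row i of the coefficients num is congruent to num i 0 · (1 , c) modulo q, so the lower rows num / q · v
  -- are integral. The large diagonal of base makes the upper rows independent.
  module Family (κ e m : ℕ) where
    K = suc κ
    -- At least one lower row is present; it carries the reduced fraction t / q, from which `q` is
    -- recovered.
    d = K + suc e

    Column : Set
    Column = Vec ℕ κ × ℕ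

    Parameter : Set
    Parameter = (ℕ × ℕ) × Vec ℕ κ × Vec ℕ e × Vec Column d

    -- `K * m` exceeds `κ * m`, the most that the `κ` off-diagonal entries, each at most `m`, add up
    -- to.
    base : Fin d → Fin K → ℕ
    base j l with toℕ j ≟ toℕ l
    ... | yes _ = K * m
    ... | no  _ = 0

    base≤ : ∀ j l → base j l ≤ K * m
    base≤ j l with toℕ j ≟ toℕ l
    ... | yes _ = ≤-refl
    ... | no  _ = z≤n

    upperTail : Fin d → Vec ℕ κ → Fin κ → ℕ
    upperTail j off l = base j (suc l) + suc (lookup off l)

    partial : Vec ℕ κ → Fin d → Vec ℕ κ → ℕ
    partial c j off = suc (base j zero) + ℕΣ.sum (λ l → lookup c l * upperTail j off l)

    -- `pred q` is -1 modulo `q`, so this is the remainder of minus `partial`, which already counts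
    -- the successor added in `upper`. Writing `suc (pred q)` keeps the modulus nonzero for every
    -- `q`.
    residue : ℕ → Vec ℕ κ → Fin d → Vec ℕ κ → ℕ
    residue q c j off = (partial c j off * pred q) % suc (pred q)

    -- The later entries are free, they fix the first one modulo `q`, and `z` moves it by multiples
    -- of `q`: one vector in `q` survives, as it should for index `q`.
    upper : ℕ → Vec ℕ κ → Fin d → Column → Fin K → ℕ
    upper q c j (off , z) zero    = base j zero + suc (residue q c j off + suc (pred q) * z)
    upper q c j (off , z) (suc l) = upperTail j off l

    -- Taking remainders bounds the later coefficients by `q`, so that the lower rows stay of the
    -- order of `m`.
    num : Parameter → Fin (suc e) → Fin K → ℕ
    num ((t , q) , c , ts , cols) zero    zero    = t
    num ((t , q) , c , ts , cols) zero    (suc l) = (t * lookup c l) % suc (pred q)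
    num ((t , q) , c , ts , cols) (suc i) zero    = lookup ts i
    num ((t , q) , c , ts , cols) (suc i) (suc l) = (lookup ts i * lookup c l) % suc (pred q)

    top : Parameter → Fin d → Fin K → ℕ
    top ((t , q) , c , ts , cols) j = upper q c j (lookup cols j)

    numerator : Parameter → Fin (suc e) → Fin d → ℕ
    numerator x i j = ℕΣ.sum (λ l → num x i l * top x j l)

    denominator : Parameter → ℕ
    denominator ((t , q) , _) = suc (pred q)

    bottom : Parameter → Fin (suc e) → Fin d → ℕ
    bottom x@((t , q) , _) i j = numerator x i j / suc (pred q)

    entry : Parameter → Fin d → Fin d → ℕ
    entry x j i = [ top x j , (λ i → bottom x i j) ]′ (splitAt K i)

    matrix : Parameter → Matrix d d
    matrix x = tabulate (λ j → tabulate (entry x j))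

    lookup-matrix : ∀ x j i → lookup (lookup (matrix x) j) i ≡ entry x j i
    lookup-matrix x j i = trans (cong (λ v → lookup v i) (lookup∘tabulate (λ j → tabulate (entry x j)) j)) (lookup∘tabulate (entry x j) i)

    entry-top : ∀ x j l → entry x j (l ↑ˡ suc e) ≡ top x j l
    entry-top x j l = cong [ top x j , (λ i → bottom x i j) ]′ (splitAt-↑ˡ K l (suc e))

    entry-bottom : ∀ x j i → entry x j (K ↑ʳ i) ≡ bottom x i j
    entry-bottom x j i = cong [ top x j , (λ i → bottom x i j) ]′ (splitAt-↑ʳ K (suc e) i)

    -- To avoid subtraction, the multiple of q = `suc p` discarded by the remainder is added back.
    -- With s = `partial c j off` the total is s + s (q - 1) + q z, which `q` divides.
    congruence : ∀ p c j off z → suc p ∣ upper (suc p) c j (off , z) zero + ℕΣ.sum (λ l → lookup c l * upperTail j off l)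
    congruence p c j off z = ∣m+n∣m⇒∣n (divides (s + z) (begin-equality
        s * p / suc p * suc p + (base j zero + suc (r + suc p * z) + σ)
          ≡⟨ lemma (s * p / suc p * suc p) (base j zero) r (suc p * z) σ ⟩
        s + (r + s * p / suc p * suc p) + suc p * z
          ≡⟨ cong (λ y → s + y + suc p * z) (m≡m%n+[m/n]*n (s * p) (suc p)) ⟨
        s + s * p + suc p * z ≡⟨ lemma₂ s p z ⟩
        (s + z) * suc p ∎))
      (n∣m*n (s * p / suc p))
      where
      open ≤-Reasoning
      σ = ℕΣ.sum (λ l → lookup c l * upperTail j off l)
      s = partial c j off
      r = (s * p) % suc p
      lemma : ∀ a b r z σ → a + (b + suc (r + z) + σ) ≡ suc b + σ + (r + a) + z
      lemma = solve-∀
      lemma₂ : ∀ s p z → s + s * p + suc p * z ≡ (s + z) * suc p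
      lemma₂ = solve-∀

    -- This is τ times the congruence of the column, after splitting off the multiples of `suc p`
    -- discarded in `num`.
    numerator-divisible : ∀ p t c ts cols i j → let x = ((t , suc p) , c , ts , cols) in suc p ∣ numerator x i j
    numerator-divisible p t c ts cols i j = divisible i
      where
      x = ((t , suc p) , c , ts , cols)
      v = top x j
      combine : ∀ τ → suc p ∣ τ * v zero + ℕΣ.sum (λ l → ((τ * lookup c l) % suc p) * v (suc l))
      combine τ = ∣m+n∣m⇒∣n (subst (suc p ∣_) (begin-equality
          τ * (v zero + ℕΣ.sum (λ l → lookup c l * v (suc l)))
            ≡⟨ *-distribˡ-+ τ (v zero) _ ⟩
          τ * v zero + τ * ℕΣ.sum (λ l → lookup c l * v (suc l))
            ≡⟨ cong (τ * v zero +_) (ℕΣ.*-distribˡ-sum τ (λ l → lookup c l * v (suc l))) ⟩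
          τ * v zero + ℕΣ.sum (λ l → τ * (lookup c l * v (suc l)))
            ≡⟨ cong (τ * v zero +_) (ℕΣ.sum-cong-≗ {κ} split) ⟩
          τ * v zero + ℕΣ.sum (λ l → suc p * quo l + rem l)
            ≡⟨ cong (τ * v zero +_) (ℕΣ.∑-distrib-+ (λ l → suc p * quo l) rem) ⟩
          τ * v zero + (ℕΣ.sum (λ l → suc p * quo l) + ℕΣ.sum rem)
            ≡⟨ cong (λ y → τ * v zero + (y + ℕΣ.sum rem)) (ℕΣ.*-distribˡ-sum (suc p) quo) ⟨
          τ * v zero + (suc p * ℕΣ.sum quo + ℕΣ.sum rem)
            ≡⟨ lemma (τ * v zero) (suc p * ℕΣ.sum quo) (ℕΣ.sum rem) ⟩
          suc p * ℕΣ.sum quo + (τ * v zero + ℕΣ.sum rem) ∎)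
          (∣n⇒∣m*n τ (congruence p c j (proj₁ (lookup cols j)) (proj₂ (lookup cols j)))))
        (m∣m*n (ℕΣ.sum quo))
        where
        open ≤-Reasoning
        quo rem : Fin κ → ℕ
        quo l = (τ * lookup c l) / suc p * v (suc l)
        rem l = ((τ * lookup c l) % suc p) * v (suc l)
        lemma : ∀ a b c → a + (b + c) ≡ b + (a + c)
        lemma = solve-∀
        lemma′ : ∀ r a q v → (r + a * q) * v ≡ q * (a * v) + r * v
        lemma′ = solve-∀
        split : ∀ l → τ * (lookup c l * v (suc l)) ≡ suc p * quo l + rem l
        split l = trans (sym (*-assoc τ (lookup c l) (v (suc l))))
          (trans (cong (_* v (suc l)) (m≡m%n+[m/n]*n (τ * lookup c l) (suc p)))
            (lemma′ ((τ * lookup c l) % suc p) ((τ * lookup c l) / suc p) (suc p) (v (suc l))))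
      divisible : ∀ i → suc p ∣ numerator x i j
      divisible zero    = combine t
      divisible (suc i) = combine (lookup ts i)

    -- With `c` below `q`, residues modulo `q` determine it; `z-bound` keeps the first offset within
    -- `m`.
    record Valid (Q : ℕ) (x : Parameter) : Set where
      constructor valid
      t = proj₁ (proj₁ x)
      q = proj₂ (proj₁ x)
      c = proj₁ (proj₂ x)
      ts = proj₁ (proj₂ (proj₂ x))
      cols = proj₂ (proj₂ (proj₂ x))
      field
        1≤t   : 1 ≤ t
        t≤8Q  : t ≤ 8 * Q
        Q<q   : Q < q
        q≤8Q  : q ≤ 8 * Q
        t⊥q   : gcd t q ≡ 1
        c∈    : ∀ l → 1 ≤ lookup c l × lookup c l ≤ Q
        ts∈   : ∀ i → 1 ≤ lookup ts i × lookup ts i ≤ Q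
        off<m : ∀ j l → lookup (proj₁ (lookup cols j)) l < m
        z-bound : ∀ j → q * suc (proj₂ (lookup cols j)) ≤ m

      suc-pred-q : suc (pred q) ≡ q
      suc-pred-q = suc-pred q {{>-nonZero (≤-<-trans z≤n Q<q)}}

      top-offset : ∀ j l → ∃[ o ] top x j l ≡ base j l + o × 1 ≤ o × o ≤ m
      top-offset j (suc l) = _ , refl , s≤s z≤n , off<m j l
      top-offset j zero    = _ , refl , s≤s z≤n , (begin
        suc (residue q c j (proj₁ (lookup cols j)) + suc (pred q) * z)
          ≤⟨ +-monoˡ-≤ (suc (pred q) * z) (m%n<n (partial c j (proj₁ (lookup cols j)) * pred q) (suc (pred q))) ⟩
        suc (pred q) + suc (pred q) * z ≡⟨ *-suc (suc (pred q)) z ⟨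
        suc (pred q) * suc z ≡⟨ cong (_* suc z) suc-pred-q ⟩
        q * suc z ≤⟨ z-bound j ⟩
        m ∎)
        where
        open ≤-Reasoning
        z = proj₂ (lookup cols j)

      1≤top : ∀ j l → 1 ≤ top x j l
      1≤top j l = let o , eq , 1≤o , _ = top-offset j l in ≤-trans 1≤o (≤-trans (m≤n+m o (base j l)) (≤-reflexive (sym eq)))

      top≤ : ∀ j l → top x j l ≤ suc K * m
      top≤ j l = let o , eq , _ , o≤m = top-offset j l in
        ≤-trans (≤-reflexive eq) (≤-trans (+-mono-≤ (base≤ j l) o≤m) (≤-reflexive (+-comm (K * m) m)))

      num≤ : ∀ i l → num x i l ≤ 8 * suc (pred q)
      num≤ zero    zero    = ≤-trans t≤8Q (*-monoʳ-≤ 8 (<⇒≤ (<-≤-trans Q<q (≤-reflexive (sym suc-pred-q)))))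
      num≤ (suc i) zero    = ≤-trans (proj₂ (ts∈ i)) (≤-trans (<⇒≤ (<-≤-trans Q<q (≤-reflexive (sym suc-pred-q)))) (m≤n*m (suc (pred q)) 8))
      num≤ zero    (suc l) = ≤-trans (<⇒≤ (m%n<n (t * lookup c l) (suc (pred q)))) (m≤n*m (suc (pred q)) 8)
      num≤ (suc i) (suc l) = ≤-trans (<⇒≤ (m%n<n (lookup ts i * lookup c l) (suc (pred q)))) (m≤n*m (suc (pred q)) 8)

      bottom*q : ∀ i j → bottom x i j * suc (pred q) ≡ numerator x i j
      bottom*q i j = m/n*n≡m (subst (λ r → suc (pred q) ∣ numerator ((t , r) , c , ts , cols) i j) suc-pred-q (numerator-divisible (pred q) t c ts cols i j))

      1≤num₀ : ∀ i → 1 ≤ num x i zero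
      1≤num₀ zero    = 1≤t
      1≤num₀ (suc i) = proj₁ (ts∈ i)

      1≤bottom : ∀ i j → 1 ≤ bottom x i j
      1≤bottom i j = n≢0⇒n>0 λ bottom≡0 → contradiction
        (≤-trans (≤-trans (*-mono-≤ (1≤num₀ i) (1≤top j zero)) (m≤m+n (num x i zero * top x j zero) _))
          (≤-reflexive (trans (sym (bottom*q i j)) (cong (_* suc (pred q)) bottom≡0))))
        (λ ())

      -- Coefficients are at most 8 q, so division by `q` leaves a bound that is the same at every
      -- scale.
      bottom≤ : ∀ i j → bottom x i j ≤ K * (8 * (suc K * m))
      bottom≤ i j = *-cancelʳ-≤ (bottom x i j) (K * (8 * (suc K * m))) (suc (pred q)) (begin
        bottom x i j * suc (pred q) ≡⟨ bottom*q i j ⟩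
        numerator x i j ≤⟨ sum-mono (λ l → num x i l * top x j l) (8 * suc (pred q) * (suc K * m)) (λ l → *-mono-≤ (num≤ i l) (top≤ j l)) ⟩
        K * (8 * suc (pred q) * (suc K * m)) ≡⟨ lemma K (suc (pred q)) (suc K * m) ⟩
        K * (8 * (suc K * m)) * suc (pred q) ∎)
        where
        open ≤-Reasoning
        lemma : ∀ k q y → k * (8 * q * y) ≡ k * (8 * y) * q
        lemma = solve-∀

      entry∈ : ∀ {n} → K * (8 * (suc K * m)) ≤ n → ∀ j i → entry x j i ∈ [1⋯ n ]
      entry∈ {n} ≤n j i with splitAt K i
      ... | inj₁ l = ∈-[1⋯]⁺ (1≤top j l) (≤-trans (top≤ j l) (≤-trans (≤-trans (m≤n*m (suc K * m) 8) (m≤n*m (8 * (suc K * m)) K)) ≤n))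
      ... | inj₂ i = ∈-[1⋯]⁺ (1≤bottom i j) (≤-trans (bottom≤ i j) ≤n)

      -- The lower rows are rational combinations, with denominator `q`, of the `K` upper ones.
      rank-matrix : rank (matrix x) ≤ K
      rank-matrix = rank≤ (matrix x) K (λ l j → fromℕ (top x j l)) λ b Bb≡0 i →
        trans (ℚΣ.sum-cong-≗ {d} (λ j → cong (λ y → b j ℚ.* fromℕ y) (lookup-matrix x j i))) (row b Bb≡0 (splitAt K i))
        where
        row : ∀ b → (∀ l → ℚΣ.sum (λ j → b j ℚ.* fromℕ (top x j l)) ≡ 0ℚ) → ∀ s →
          ℚΣ.sum (λ j → b j ℚ.* fromℕ ([ top x j , (λ i → bottom x i j) ]′ s)) ≡ 0ℚ
        row b Bb≡0 (inj₁ l) = Bb≡0 l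
        row b Bb≡0 (inj₂ i) = orthogonal-combination b (λ l → fromℕ (num x i l)) (λ j l → fromℕ (top x j l))
          (λ j → fromℕ (bottom x i j)) (fromℕ-≢0 (suc (pred q))) scaled Bb≡0
          where
          scaled : ∀ j → fromℕ (suc (pred q)) ℚ.* fromℕ (bottom x i j) ≡ ℚΣ.sum (λ l → fromℕ (num x i l) ℚ.* fromℕ (top x j l))
          scaled j = trans (sym (fromℕ-* (suc (pred q)) (bottom x i j)))
            (trans (cong fromℕ (trans (*-comm (suc (pred q)) (bottom x i j)) (bottom*q i j)))
              (trans (fromℕ-sum (λ l → num x i l * top x j l)) (ℚΣ.sum-cong-≗ {K} (λ l → fromℕ-* (num x i l) (top x j l)))))

      dominant : ∀ l → κ * m < top x (l ↑ˡ suc e) l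
      dominant l with toℕ (l ↑ˡ suc e) ≟ toℕ l | top-offset (l ↑ˡ suc e) l
      ... | yes _ | o , eq , 1≤o , _ = begin-strict
        κ * m ≤⟨ m≤n+m (κ * m) m ⟩
        K * m <⟨ m<m+n (K * m) 1≤o ⟩
        K * m + o ≡⟨ eq ⟨
        top x (l ↑ˡ suc e) l ∎
        where open ≤-Reasoning
      ... | no l≢l | _ = contradiction (toℕ-↑ˡ l (suc e)) l≢l

      off-diagonal : ∀ j l → j ≢ l → top x (j ↑ˡ suc e) l ≤ m
      off-diagonal j l j≢l with toℕ (j ↑ˡ suc e) ≟ toℕ l | top-offset (j ↑ˡ suc e) l
      ... | yes eq | _ = contradiction (toℕ-injective (trans (sym (toℕ-↑ˡ j (suc e))) eq)) j≢l
      ... | no  _  | o , eq , _ , o≤m = ≤-trans (≤-reflexive eq) o≤m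


    -- The first `K` columns of the upper rows form a diagonally dominant matrix, so the
    -- coefficients of a lower row in terms of the upper rows are determined. Cross-multiplication
    -- replaces fractions.
    proportional : ∀ {Q Q′ x x′} → Valid Q x → Valid Q′ x′ → (∀ j l → top x j l ≡ top x′ j l) →
      (∀ i j → bottom x i j ≡ bottom x′ i j) →
      ∀ i l → denominator x′ * num x i l ≡ denominator x * num x′ i l
    proportional {x = x} {x′} X X′ top≡ bottom≡ i l =
      ℤ.+-injective (ℤ.i-j≡0⇒i≡j (ℤ.+ (q′ * num x i l)) (ℤ.+ (q * num x′ i l))
        (diagonallyDominant⇒injective m (λ j → top x (j ↑ˡ suc e)) (Valid.off-diagonal X) (Valid.dominant X) y orthogonal l))
      where
      q = denominator x
      q′ = denominator x′
      y : Fin K → ℤ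
      y l = ℤ.+ (q′ * num x i l) ℤ.+ ℤ.- ℤ.+ (q * num x′ i l)
      scaled : ∀ c (a : Fin K → ℕ) j → ℤΣ.sum (λ l → ℤ.+ (c * a l) ℤ.* ℤ.+ top x j l) ≡ ℤ.+ (c * ℕΣ.sum (λ l → a l * top x j l))
      scaled c a j = trans (ℤΣ.sum-cong-≗ {K} (λ l → trans (sym (ℤ.pos-* (c * a l) (top x j l))) (cong ℤ.+_ (*-assoc c (a l) (top x j l)))))
        (trans (sym (+sum (λ l → c * (a l * top x j l)))) (cong ℤ.+_ (sym (ℕΣ.*-distribˡ-sum c (λ l → a l * top x j l)))))
      balanced : ∀ j → q′ * ℕΣ.sum (λ l → num x i l * top x j l) ≡ q * ℕΣ.sum (λ l → num x′ i l * top x j l)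
      balanced j = begin-equality
        q′ * numerator x i j ≡⟨ cong (q′ *_) (Valid.bottom*q X i j) ⟨
        q′ * (bottom x i j * q) ≡⟨ lemma q′ (bottom x i j) q ⟩
        q * (bottom x i j * q′) ≡⟨ cong (λ b → q * (b * q′)) (bottom≡ i j) ⟩
        q * (bottom x′ i j * q′) ≡⟨ cong (q *_) (Valid.bottom*q X′ i j) ⟩
        q * ℕΣ.sum (λ l → num x′ i l * top x′ j l) ≡⟨ cong (q *_) (ℕΣ.sum-cong-≗ {K} (λ l → cong (num x′ i l *_) (top≡ j l))) ⟨
        q * ℕΣ.sum (λ l → num x′ i l * top x j l) ∎
        where
        open ≤-Reasoning
        lemma : ∀ a b c → a * (b * c) ≡ c * (b * a)
        lemma = solve-∀
      orthogonal : ∀ j → ℤΣ.sum (λ l → y l ℤ.* ℤ.+ top x (j ↑ˡ suc e) l) ≡ 0ℤ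
      orthogonal j = trans (ℤΣ.sum-cong-≗ {K} (λ l → expand (ℤ.+ (q′ * num x i l)) (ℤ.+ (q * num x′ i l)) (ℤ.+ top x j′ l)))
        (trans (ℤΣ.sum-linear ℤ.1ℤ (ℤ.- ℤ.1ℤ) (λ l → ℤ.+ (q′ * num x i l) ℤ.* ℤ.+ top x j′ l) (λ l → ℤ.+ (q * num x′ i l) ℤ.* ℤ.+ top x j′ l))
          (trans (cong₂ (λ u v → ℤ.1ℤ ℤ.* u ℤ.+ ℤ.- ℤ.1ℤ ℤ.* v) (trans (scaled q′ (num x i) j′) (cong ℤ.+_ (balanced j′))) (scaled q (num x′ i) j′))
            (cancel (ℤ.+ (q * ℕΣ.sum (λ l → num x′ i l * top x j′ l))))))
        where
        j′ = j ↑ˡ suc e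
        expand : ∀ a b v → (a ℤ.+ ℤ.- b) ℤ.* v ≡ ℤ.1ℤ ℤ.* (a ℤ.* v) ℤ.+ ℤ.- ℤ.1ℤ ℤ.* (b ℤ.* v)
        expand = ℤSolver.solve-∀
        cancel : ∀ u → ℤ.1ℤ ℤ.* u ℤ.+ ℤ.- ℤ.1ℤ ℤ.* u ≡ 0ℤ
        cancel = ℤSolver.solve-∀

    same-denominator : ∀ {t q t′ q′} → gcd t q ≡ 1 → gcd t′ q′ ≡ 1 → q′ * t ≡ q * t′ → q ≡ q′
    same-denominator {t} {q} {t′} {q′} t⊥q t′⊥q′ eq = ∣-antisym
      (coprime-divisor {n = t} (Coprime.sym (gcd≡1⇒coprime t⊥q)) (divides t′ (trans (*-comm t q′) (trans eq (*-comm q t′)))))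
      (coprime-divisor {n = t′} (Coprime.sym (gcd≡1⇒coprime t′⊥q′)) (divides t (trans (*-comm t′ q) (trans (sym eq) (*-comm q′ t)))))

    -- `t` is invertible modulo `suc p`, and two numbers below the modulus are congruent only if
    -- equal.
    same-residue : ∀ {t p a b} → gcd t (suc p) ≡ 1 → a < suc p → b < suc p →
      (t * a) % suc p ≡ (t * b) % suc p → a ≡ b
    same-residue {t} {p} {a} {b} t⊥q a<q b<q eq with ∣ a - b ∣ in ∣a-b∣≡
    ... | zero  = ∣m-n∣≡0⇒m≡n ∣a-b∣≡
    ... | suc r = contradiction (∣⇒≤ (subst (suc p ∣_) ∣a-b∣≡ q∣∣a-b∣))
        (<⇒≱ (≤-<-trans (≤-trans (≤-reflexive (sym ∣a-b∣≡)) (∣m-n∣≤m⊔n a b)) (⊔-lub a<q b<q)))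
      where
      q∣∣a-b∣ : suc p ∣ ∣ a - b ∣
      q∣∣a-b∣ = coprime-divisor {n = t} (Coprime.sym (gcd≡1⇒coprime t⊥q))
        (subst (suc p ∣_) (sym (*-distribˡ-∣-∣ t a b)) (%≡⇒∣ (suc p) (t * a) (t * b) eq))

    column-injective : ∀ p c j (z z′ : Column) → (∀ l → upper (suc p) c j z l ≡ upper (suc p) c j z′ l) → z ≡ z′
    column-injective p c j (off , z) (off′ , z′) eq = cong₂ _,_ off≡off′ (*-cancelˡ-≡ z z′ (suc p)
        (+-cancelˡ-≡ (residue (suc p) c j off) (suc p * z) (suc p * z′)
          (suc-injective (+-cancelˡ-≡ (base j zero) _ _ (trans (eq zero) (cong (λ o → upper (suc p) c j (o , z′) zero) (sym off≡off′)))))))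
      where
      off≡off′ : off ≡ off′
      off≡off′ = lookup-ext (λ l → suc-injective (+-cancelˡ-≡ (base j (suc l)) (suc (lookup off l)) (suc (lookup off′ l)) (eq (suc l))))

    assemble : ∀ {t p t′ p′ : ℕ} {c c′ : Vec ℕ κ} {ts ts′ : Vec ℕ e} {cols cols′ : Vec Column d} → t ≡ t′ → suc p ≡ suc p′ → c ≡ c′ → ts ≡ ts′ →
      (∀ j l → upper (suc p) c j (lookup cols j) l ≡ upper (suc p′) c′ j (lookup cols′ j) l) →
      _≡_ {A = Parameter} ((t , suc p) , c , ts , cols) ((t′ , suc p′) , c′ , ts′ , cols′)
    assemble {t} {p} {c = c} {ts = ts} {cols = cols} {cols′} refl refl refl refl top≡ =
      cong (λ cols → (t , suc p) , c , ts , cols)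
        (lookup-ext λ j → column-injective p c j (lookup cols j) (lookup cols′ j) (top≡ j))

    -- The value of the reduced fraction t / q gives `t` and `q`, the other first coefficients then
    -- give `ts`, and the remainders of t cₗ give `c`. Once these agree, the upper rows give back
    -- the columns.
    parameter-injective : ∀ {Q Q′ x x′} → Valid Q x → Valid Q′ x′ → (∀ j l → top x j l ≡ top x′ j l) →
      (∀ i j → bottom x i j ≡ bottom x′ i j) → x ≡ x′
    parameter-injective {x = (t , zero) , _} X X′ top≡ bottom≡ with () ← Valid.Q<q X
    parameter-injective {x = (t , suc p) , _} {x′ = (t′ , zero) , _} X X′ top≡ bottom≡ with () ← Valid.Q<q X′
    parameter-injective {x = x@((t , suc p) , c , ts , cols)} {x′ = x′@((t′ , suc p′) , c′ , ts′ , cols′)} X X′ top≡ bottom≡ =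
      assemble {ts = ts} {ts′} {cols} {cols′} (num≡ zero zero) q≡q′ (lookup-ext c≡c′) (lookup-ext (λ i → num≡ (suc i) zero)) top≡
      where
      q≡q′ : suc p ≡ suc p′
      q≡q′ = same-denominator (Valid.t⊥q X) (Valid.t⊥q X′) (proportional X X′ top≡ bottom≡ zero zero)
      num≡ : ∀ i l → num x i l ≡ num x′ i l
      num≡ i l = *-cancelˡ-≡ (num x i l) (num x′ i l) (suc p)
        (trans (cong (_* num x i l) q≡q′) (proportional X X′ top≡ bottom≡ i l))
      c≡c′ : ∀ l → lookup c l ≡ lookup c′ l
      c≡c′ l = same-residue {t} (Valid.t⊥q X) (≤-<-trans (proj₂ (Valid.c∈ X l)) (Valid.Q<q X))
        (<-≤-trans (≤-<-trans (proj₂ (Valid.c∈ X′ l)) (Valid.Q<q X′)) (≤-reflexive (sym q≡q′)))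
        (trans (num≡ zero (suc l)) (transport (lookup c′ l) (num≡ zero zero) q≡q′))
        where
        transport : ∀ a {t t′ p p′} → t ≡ t′ → suc p ≡ suc p′ → (t′ * a) % suc p′ ≡ (t * a) % suc p
        transport a refl refl = refl

    matrix-injective : ∀ {Q Q′ x x′} → Valid Q x → Valid Q′ x′ → matrix x ≡ matrix x′ → x ≡ x′
    matrix-injective {x = x} {x′} X X′ eq = parameter-injective X X′
      (λ j l → trans (sym (entry-top x j l)) (trans (entries≡ j (l ↑ˡ suc e)) (entry-top x′ j l)))
      (λ i j → trans (sym (entry-bottom x j i)) (trans (entries≡ j (K ↑ʳ i)) (entry-bottom x′ j i)))
      where
      entries≡ : ∀ j i → entry x j i ≡ entry x′ j i
      entries≡ j i = trans (sym (lookup-matrix x j i)) (trans (cong (λ M → lookup (lookup M j) i) eq) (lookup-matrix x′ j i))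

    module _ (Q : ℕ) .{{_ : NonZero Q}} where
      -- Chosen so that `z-bound` holds for every `q` up to `8 * Q`.
      width : ℕ
      width = (m / (8 * Q)) {{m*n≢0 8 Q}}

      columnList : List Column
      columnList = cartesianProduct (vectorsOver (upTo m) κ) (upTo width)

      parameters : List Parameter
      parameters = cartesianProduct (fractions Q) (cartesianProduct (vectorsOver [1⋯ Q ] κ)
        (cartesianProduct (vectorsOver [1⋯ Q ] e) (vectorsOver columnList d)))

      parameters-unique : Unique parameters
      parameters-unique = Unique.cartesianProduct⁺ (fractions-unique Q)
        (Unique.cartesianProduct⁺ (vectorsOver-unique κ ([1⋯]-unique Q))
          (Unique.cartesianProduct⁺ (vectorsOver-unique e ([1⋯]-unique Q))
            (vectorsOver-unique d (Unique.cartesianProduct⁺ (vectorsOver-unique κ (Unique.upTo⁺ m)) (Unique.upTo⁺ width)))))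

      parameters-valid : ∀ {x} → x ∈ parameters → Valid Q x
      parameters-valid {(t , q) , c , ts , cols} x∈
        with ∈-cartesianProduct⁻ (fractions Q) _ x∈
      ... | f∈ , r∈ with ∈-cartesianProduct⁻ (vectorsOver [1⋯ Q ] κ) _ r∈ | ∈-fractions⁻ Q f∈
      ... | c∈ , s∈ | 1≤t , t≤8Q , Q<q , q≤8Q , t⊥q with ∈-cartesianProduct⁻ (vectorsOver [1⋯ Q ] e) (vectorsOver columnList d) s∈
      ... | ts∈ , cols∈ = valid 1≤t t≤8Q Q<q q≤8Q t⊥q
          (λ l → ∈-[1⋯]⁻ (∈-vectorsOver⁻ [1⋯ Q ] c∈ l)) (λ i → ∈-[1⋯]⁻ (∈-vectorsOver⁻ [1⋯ Q ] ts∈ i))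
          (λ j l → ∈-upTo⁻ (∈-vectorsOver⁻ (upTo m) (proj₁ (column∈ j)) l))
          (λ j → ≤-trans (*-mono-≤ q≤8Q (∈-upTo⁻ (proj₂ (column∈ j))))
            (≤-trans (≤-reflexive (*-comm (8 * Q) width)) (m/n*n≤m m (8 * Q) {{m*n≢0 8 Q}})))
        where
        column∈ : ∀ j → proj₁ (lookup cols j) ∈ vectorsOver (upTo m) κ × proj₂ (lookup cols j) ∈ upTo width
        column∈ j = ∈-cartesianProduct⁻ (vectorsOver (upTo m) κ) (upTo width) (∈-vectorsOver⁻ columnList cols∈ j)

      length-parameters : length parameters ≡ length (fractions Q) * (Q ^ κ * (Q ^ e * (m ^ κ * width) ^ d))
      length-parameters = begin-equality
        length parameters
          ≡⟨ length-cartesianProductWith _,_ (fractions Q) _ ⟩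
        length (fractions Q) * length (cartesianProduct (vectorsOver [1⋯ Q ] κ) (cartesianProduct (vectorsOver [1⋯ Q ] e) (vectorsOver columnList d)))
          ≡⟨ cong (length (fractions Q) *_) (length-cartesianProductWith _,_ (vectorsOver [1⋯ Q ] κ) _) ⟩
        length (fractions Q) * (length (vectorsOver [1⋯ Q ] κ) * length (cartesianProduct (vectorsOver [1⋯ Q ] e) (vectorsOver columnList d)))
          ≡⟨ cong₂ (λ a b → length (fractions Q) * (a * b)) (length-box κ)
               (trans (length-cartesianProductWith _,_ (vectorsOver [1⋯ Q ] e) (vectorsOver columnList d)) (cong₂ _*_ (length-box e) (length-vectorsOver columnList d))) ⟩
        length (fractions Q) * (Q ^ κ * (Q ^ e * length columnList ^ d))
          ≡⟨ cong (λ y → length (fractions Q) * (Q ^ κ * (Q ^ e * y ^ d)))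
               (trans (length-cartesianProductWith _,_ (vectorsOver (upTo m) κ) (upTo width))
                 (cong₂ _*_ (trans (length-vectorsOver (upTo m) κ) (cong (_^ κ) (length-upTo m))) (length-upTo width))) ⟩
        length (fractions Q) * (Q ^ κ * (Q ^ e * (m ^ κ * width) ^ d)) ∎
        where
        open ≤-Reasoning
        length-box : ∀ k → length (vectorsOver [1⋯ Q ] k) ≡ Q ^ k
        length-box k = trans (length-vectorsOver [1⋯ Q ] k) (cong (_^ k) (length-[1⋯] Q))

      -- At least Q² fractions, Q^κ vectors `c` and Q^e vectors `ts` make Q^d, which cancels the
      -- factor 1 / Q that the congruence costs in each of the `d` columns. Hence all scales
      -- contribute equally, and their number becomes the logarithm.
      parameters-count : 8 * Q ≤ m → m ^ (K * d) ≤ 16 ^ d * length parameters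
      parameters-count 8Q≤m = begin
        m ^ (K * d) ≡⟨ ^-*-assoc m K d ⟨
        (m * m ^ κ) ^ d ≤⟨ ^-monoˡ-≤ d (*-monoˡ-≤ (m ^ κ) m≤16Qw) ⟩
        (16 * (Q * width) * m ^ κ) ^ d ≡⟨ cong (_^ d) (lemma₁ 16 Q width (m ^ κ)) ⟩
        (16 * (Q * (m ^ κ * width))) ^ d ≡⟨ trans (^-distribˡ-* 16 (Q * (m ^ κ * width)) d) (cong (16 ^ d *_) (^-distribˡ-* Q (m ^ κ * width) d)) ⟩
        16 ^ d * (Q ^ d * (m ^ κ * width) ^ d) ≡⟨ cong (λ y → 16 ^ d * (y * (m ^ κ * width) ^ d)) (^-distribˡ-+-* Q K (suc e)) ⟩
        16 ^ d * (Q ^ K * Q ^ suc e * (m ^ κ * width) ^ d) ≡⟨ cong (16 ^ d *_) (lemma₂ Q (Q ^ κ) (Q ^ e) ((m ^ κ * width) ^ d)) ⟩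
        16 ^ d * (Q * Q * (Q ^ κ * (Q ^ e * (m ^ κ * width) ^ d)))
          ≤⟨ *-monoʳ-≤ (16 ^ d) (*-monoˡ-≤ _ (≤-trans (m≤n*m (Q * Q) 8) (fractions-count Q))) ⟩
        16 ^ d * (length (fractions Q) * (Q ^ κ * (Q ^ e * (m ^ κ * width) ^ d))) ≡⟨ cong (16 ^ d *_) length-parameters ⟨
        16 ^ d * length parameters ∎
        where
        open ≤-Reasoning
        lemma₁ : ∀ c q w y → c * (q * w) * y ≡ c * (q * (y * w))
        lemma₁ = solve-∀
        lemma₂ : ∀ q a b y → q * a * (q * b) * y ≡ q * q * (a * (b * y))
        lemma₂ = solve-∀
        1≤width : 1 ≤ width
        1≤width = ≤-trans (≤-reflexive (sym (ℕ.n/n≡1 (8 * Q) {{m*n≢0 8 Q}}))) (ℕ./-monoˡ-≤ (8 * Q) {{m*n≢0 8 Q}} 8Q≤m)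
        -- Since `8 * Q` fits into `m`, rounding in `width` loses at most a factor 2; hence 16.
        m≤16Qw : m ≤ 16 * (Q * width)
        m≤16Qw = begin
          m ≡⟨ m≡m%n+[m/n]*n m (8 * Q) {{m*n≢0 8 Q}} ⟩
          (m % (8 * Q)) {{m*n≢0 8 Q}} + width * (8 * Q) ≤⟨ +-monoˡ-≤ (width * (8 * Q)) (<⇒≤ (m%n<n m (8 * Q) {{m*n≢0 8 Q}})) ⟩
          8 * Q + width * (8 * Q) ≤⟨ +-monoˡ-≤ (width * (8 * Q)) (m≤n*m (8 * Q) width {{>-nonZero 1≤width}}) ⟩
          width * (8 * Q) + width * (8 * Q) ≡⟨ lemma width Q ⟩
          16 * (Q * width) ∎
          where
          lemma : ∀ w q → w * (8 * q) + w * (8 * q) ≡ 16 * (q * w)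
          lemma = solve-∀

    -- Successive scales share only an endpoint, excluded on the left, so no parameter is counted at
    -- two scales.
    scale-unique : ∀ {i j q} → 8 ^ i < q → q ≤ 8 * 8 ^ i → 8 ^ j < q → q ≤ 8 * 8 ^ j → i ≡ j
    scale-unique {i} {j} i< ≤i j< ≤j with <-cmp i j
    ... | tri≈ _ i≡j _ = i≡j
    ... | tri< i<j _ _ = contradiction (≤-trans ≤i (^-monoʳ-≤ 8 i<j)) (<⇒≱ j<)
    ... | tri> _ _ j<i = contradiction (≤-trans ≤j (^-monoʳ-≤ 8 j<i)) (<⇒≱ i<)

    scaled-parameters : ℕ → List Parameter
    scaled-parameters j = parameters (8 ^ j) {{m^n≢0 8 j}}

    family-count : ∀ {n} J → 8 ^ J ≤ m → K * (8 * (suc K * m)) ≤ n →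
      J * m ^ (K * d) ≤ 16 ^ d * L n d K d
    family-count {n} J 8^J≤m ≤n = begin
      J * m ^ (K * d) ≡⟨ cong (_* m ^ (K * d)) (length-upTo J) ⟨
      length (upTo J) * m ^ (K * d) ≡⟨ ∑-const (upTo J) (m ^ (K * d)) ⟨
      ∑ (upTo J) (λ _ → m ^ (K * d)) ≤⟨ ∑-mono-∈ (upTo J) (λ {j} j∈ → parameters-count (8 ^ j) {{m^n≢0 8 j}} (≤-trans (^-monoʳ-≤ 8 (∈-upTo⁻ j∈)) 8^J≤m)) ⟩
      ∑ (upTo J) (λ j → 16 ^ d * length (scaled-parameters j)) ≡⟨ *-distribˡ-∑ (16 ^ d) (upTo J) (length ∘ scaled-parameters) ⟨
      16 ^ d * ∑ (upTo J) (length ∘ scaled-parameters) ≡⟨ cong (16 ^ d *_) (length-concatMap scaled-parameters (upTo J)) ⟨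
      16 ^ d * length (concatMap scaled-parameters (upTo J)) ≤⟨ *-monoʳ-≤ (16 ^ d) (length-injection matrix unique
                                                                       (λ x∈ → let X = proj₂ (all-valid x∈) in
                                                                         ∈-lowRank⁺ (λ j i → subst (_∈ [1⋯ n ]) (sym (lookup-matrix _ j i)) (Valid.entry∈ X ≤n j i)) (Valid.rank-matrix X))
                                                                       (λ x∈ y∈ → matrix-injective (proj₂ (all-valid x∈)) (proj₂ (all-valid y∈)))) ⟩
      16 ^ d * L n d K d ∎
      where
      open ≤-Reasoning
      unique : Unique (concatMap scaled-parameters (upTo J))
      unique = concatMap-unique scaled-parameters (Unique.upTo⁺ J) (λ j → parameters-unique (8 ^ j) {{m^n≢0 8 j}})
        λ {i} {j} z∈i z∈j → let Zi = parameters-valid (8 ^ i) {{m^n≢0 8 i}} z∈i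
                                Zj = parameters-valid (8 ^ j) {{m^n≢0 8 j}} z∈j
                            in scale-unique (Valid.Q<q Zi) (Valid.q≤8Q Zi) (Valid.Q<q Zj) (Valid.q≤8Q Zj)
      all-valid : ∀ {x} → x ∈ concatMap scaled-parameters (upTo J) → ∃[ j ] Valid (8 ^ j) x
      all-valid x∈ = let j , _ , x∈j = find (∈-concatMap⁻ scaled-parameters {xs = upTo J} x∈)
                     in j , parameters-valid (8 ^ j) {{m^n≢0 8 j}} x∈j

-- Constants, and the wide, tall and square cases

module Asymptotics where
  open Counting
  open Arithmetic
  open Rank using (fromℤ; fromℕ≡fromℤ; toℚᵘ-fromℤ)
  open CodeCount using (^-distribˡ-*; codesUpToRank; PowerSumBound; powerBound; codesUpToRank-bound; n≤2^n)
  open RankCount using (L-upper-rows; L-upper-columns; L-lower-rows; L-lower-columns)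
  open SingularFamily using (fromℕ-*; fromℕ-≢0; module Family)
  open import Data.Bool.Base using (if_then_else_)
  import Data.Integer.Base as ℤ
  import Data.Integer.Properties as ℤ
  open import Data.List.Base using (upTo)
  open import Data.Nat.Base
  open import Data.Nat.DivMod using (_/_; _%_; m%n<n; m≡m%n+[m/n]*n; m/n*n≤m; m*n/n≡m; /-monoˡ-≤)
  open import Data.Nat.Logarithm using (⌊log₂_⌋; ⌊log₂⌋-mono-≤; ⌊log₂[2^n]⌋≡n)
  open import Data.Nat.Properties
  open import Data.Nat.Tactic.RingSolver using (solve-∀)
  open import Data.Rational.Base as ℚ using (ℚ; 0ℚ; 1ℚ; 1/_; toℚᵘ)
  import Data.Rational.Properties as ℚ
  open import Data.Rational.Unnormalised.Base as ℚᵘ using (mkℚᵘ)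
  import Data.Rational.Unnormalised.Properties as ℚᵘ
  open import Relation.Nullary.Decidable using (dec-true; dec-false)

  toℚᵘ-fromℕ : ∀ m → toℚᵘ (fromℕ m) ℚᵘ.≃ mkℚᵘ (ℤ.+ m) 0
  toℚᵘ-fromℕ m = ℚᵘ.≃-trans (ℚᵘ.≃-reflexive (cong toℚᵘ (fromℕ≡fromℤ m))) (toℚᵘ-fromℤ (ℤ.+ m))

  fromℕ-mono-≤ : ∀ {m n} → m ≤ n → fromℕ m ℚ.≤ fromℕ n
  fromℕ-mono-≤ {m} {n} m≤n = ℚ.toℚᵘ-cancel-≤ (ℚᵘ.≤-trans (ℚᵘ.≤-reflexive (toℚᵘ-fromℕ m))
    (ℚᵘ.≤-trans (ℚᵘ.*≤* (ℤ.*-monoʳ-≤-nonNeg (ℤ.+ 1) (ℤ.+≤+ m≤n))) (ℚᵘ.≤-reflexive (ℚᵘ.≃-sym (toℚᵘ-fromℕ n)))))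

  0<fromℕ : ∀ n .{{_ : NonZero n}} → 0ℚ ℚ.< fromℕ n
  0<fromℕ n = ℚ.≰⇒> λ n≤0 → fromℕ-≢0 n (ℚ.≤-antisym n≤0 (fromℕ-mono-≤ {0} {n} z≤n))

  -- Replacing the lower constant by its inverse `A` keeps all other estimates in the natural
  -- numbers.
  Θ-fromℕ : ∀ {f g : ℕ → ℕ} A B N → .{{_ : NonZero A}} → .{{_ : NonZero B}} →
    (∀ n → N ≤ n → g n ≤ A * f n × f n ≤ B * g n) → f =Θ g
  Θ-fromℕ {f} {g} A B N bounds = 1/ a , fromℕ B , N , ℚ.positive⁻¹ (1/ a) , 0<fromℕ B , λ n N≤n →
    (begin
      1/ a ℚ.* fromℕ (g n) ≤⟨ ℚ.*-monoˡ-≤-nonNeg (1/ a) (fromℕ-mono-≤ (proj₁ (bounds n N≤n))) ⟩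
      1/ a ℚ.* fromℕ (A * f n) ≡⟨ cong (1/ a ℚ.*_) (fromℕ-* A (f n)) ⟩
      1/ a ℚ.* (a ℚ.* fromℕ (f n)) ≡⟨ ℚ.*-assoc (1/ a) a (fromℕ (f n)) ⟨
      1/ a ℚ.* a ℚ.* fromℕ (f n) ≡⟨ cong (ℚ._* fromℕ (f n)) (ℚ.*-inverseˡ a) ⟩
      1ℚ ℚ.* fromℕ (f n) ≡⟨ ℚ.*-identityˡ (fromℕ (f n)) ⟩
      fromℕ (f n) ∎) ,
    ℚ.≤-trans (fromℕ-mono-≤ (proj₂ (bounds n N≤n))) (ℚ.≤-reflexive (fromℕ-* B (g n)))
    where
    open ℚ.≤-Reasoning
    a = fromℕ A
    instance
      a-positive : ℚ.Positive a
      a-positive = ℚ.positive (0<fromℕ A)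
      a-nonZero : ℚ.NonZero a
      a-nonZero = ℚ.pos⇒nonZero a
      1/a-positive : ℚ.Positive (1/ a)
      1/a-positive = ℚ.1/pos⇒pos a
      1/a-nonNegative : ℚ.NonNegative (1/ a)
      1/a-nonNegative = ℚ.pos⇒nonNeg (1/ a)

  l-≡ : ∀ d k n → l d k d n ≡ n ^ (k * d) * ⌊log₂ n ⌋
  l-≡ d k n = cong (λ b → if b then n ^ (k * d) * ⌊log₂ n ⌋ else n ^ (k * (d ⊔ d))) (dec-true (d ≟ d) refl)

  l-≢ : ∀ d k r n → r ≢ d → l d k r n ≡ n ^ (k * (r ⊔ d))
  l-≢ d k r n r≢d = cong (λ b → if b then n ^ (k * d) * ⌊log₂ n ⌋ else n ^ (k * (r ⊔ d))) (dec-false (r ≟ d) r≢d)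

  powerSumBound₁ : ∀ J → PowerSumBound (2 ^ J) 1 (suc J)
  powerSumBound₁ J Q = begin
    ∑ (upTo (2 ^ J)) (λ i → (Q / suc i) ^ 1) ≡⟨ ∑-cong (upTo (2 ^ J)) (λ i → *-identityʳ (Q / suc i)) ⟩
    ∑ (upTo (2 ^ J)) (λ i → Q / suc i) ≤⟨ ∑-floor J Q ⟩
    suc J * Q ≡⟨ cong (suc J *_) (*-identityʳ Q) ⟨
    suc J * Q ^ 1 ∎
    where open ≤-Reasoning

  -- Here every exponent in the sum over Hermite forms is at least 2, so `Z` = 2 serves.
  nonsquare : ∀ {f g : ℕ → ℕ} p k x → suc k < p → (∀ n → g n ≡ n ^ (suc k * (p + suc x))) →
    (∀ n → n ^ (suc k * (p + suc x)) ≤ f n) → (∀ n → f n ≤ codesUpToRank n p (p + suc x) (suc k)) → f =Θ g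
  nonsquare {f} {g} p k x k<p g≡ lower upper = Θ-fromℕ {f} {g} 1 (suc (C * 2)) 1 λ n 1≤n →
      ≤-trans (≤-reflexive (g≡ n)) (≤-trans (lower n) (≤-reflexive (sym (+-identityʳ (f n))))) ,
      (begin
        f n ≤⟨ upper n ⟩
        codesUpToRank n p q (suc k) ≤⟨ C-bound n 2 1≤n (s≤s z≤n) (λ k _ → ∑-floor^ x (powerBound n k)) ⟩
        C * (n ^ (suc k * q) * 2) ≡⟨ lemma C (n ^ (suc k * q)) ⟩
        C * 2 * n ^ (suc k * q) ≤⟨ *-monoˡ-≤ (n ^ (suc k * q)) (n≤1+n (C * 2)) ⟩
        suc (C * 2) * n ^ (suc k * q) ≡⟨ cong (suc (C * 2) *_) (g≡ n) ⟨
        suc (C * 2) * g n ∎)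
    where
    open ≤-Reasoning
    q = p + suc x
    C = proj₁ (codesUpToRank-bound p (suc x) (suc k) (<⇒≤ k<p))
    C-bound = proj₂ (codesUpToRank-bound p (suc x) (suc k) (<⇒≤ k<p))
    lemma : ∀ c y → c * (y * 2) ≡ c * 2 * y
    lemma = solve-∀

  wide : ∀ d k r x → suc k < d → d + suc x ≡ r → (λ n → L n d (suc k) r) =Θ l d (suc k) r
  wide d k r x k<d refl = nonsquare {λ n → L n d (suc k) r} {l d (suc k) r} d k x k<d
    (λ n → trans (l-≢ d (suc k) r n (λ eq → m≢1+m+n d (trans (sym eq) (+-suc d x))))
      (cong (λ r → n ^ (suc k * r)) (m≥n⇒m⊔n≡m (m≤m+n d (suc x)))))
    (λ n → L-lower-rows n d k r (<⇒≤ k<d))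
    (λ n → L-upper-rows n d (suc k) r {{>-nonZero (<-≤-trans (s≤s z≤n) (m≤n+m (suc x) d))}})

  tall : ∀ d k r x → suc k < r → r + suc x ≡ d → (λ n → L n d (suc k) r) =Θ l d (suc k) r
  tall d k r x k<r refl = nonsquare {λ n → L n d (suc k) r} {l d (suc k) r} r k x k<r
    (λ n → trans (l-≢ d (suc k) r n (λ eq → m≢1+m+n r (trans eq (+-suc r x))))
      (cong (λ q → n ^ (suc k * q)) (m≤n⇒m⊔n≡n (m≤m+n r (suc x)))))
    (λ n → L-lower-columns n d k r (<⇒≤ k<r))
    (λ n → L-upper-columns n d (suc k) r {{>-nonZero (<-≤-trans (s≤s z≤n) (m≤n+m (suc x) r))}})

  -- The last exponent is 1, so `Z` must bound the logarithm of `powerBound`, uniformly for all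
  -- ranks up to `k`.
  square-upper : ∀ d k .{{_ : NonZero d}} → k ≤ d → ∃[ C ] (∀ n → 1 ≤ ⌊log₂ n ⌋ → L n d k d ≤ C * (n ^ (k * d) * ⌊log₂ n ⌋))
  square-upper d k k≤d = C * W , λ n 1≤log → begin
      L n d k d ≤⟨ L-upper-rows n d k d ⟩
      codesUpToRank n d d k ≡⟨ cong (λ r → codesUpToRank n d r k) (+-identityʳ d) ⟨
      codesUpToRank n d (d + 0) k ≤⟨ upper n (W * ⌊log₂ n ⌋) (1≤n n 1≤log) (*-mono-≤ {1} {W} (s≤s z≤n) 1≤log) (bound n 1≤log) ⟩
      C * (n ^ (k * (d + 0)) * (W * ⌊log₂ n ⌋)) ≡⟨ cong (λ r → C * (n ^ (k * r) * (W * ⌊log₂ n ⌋))) (+-identityʳ d) ⟩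
      C * (n ^ (k * d) * (W * ⌊log₂ n ⌋)) ≡⟨ lemma C (n ^ (k * d)) W ⌊log₂ n ⌋ ⟩
      C * W * (n ^ (k * d) * ⌊log₂ n ⌋) ∎
    where
    open ≤-Reasoning
    C = proj₁ (codesUpToRank-bound d 0 k k≤d)
    upper = proj₂ (codesUpToRank-bound d 0 k k≤d)
    -- 1 + k (2 + k + log n) is at most W log n as soon as log n is at least 1.
    W = suc (k * (3 + k))
    lemma : ∀ c a w l → c * (a * (w * l)) ≡ c * w * (a * l)
    lemma = solve-∀
    1≤n : ∀ n → 1 ≤ ⌊log₂ n ⌋ → 1 ≤ n
    1≤n (suc n) _ = s≤s z≤n
    bound : ∀ n → 1 ≤ ⌊log₂ n ⌋ → ∀ k′ → k′ ≤ k → PowerSumBound (powerBound n k′) 1 (W * ⌊log₂ n ⌋)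
    bound n 1≤log k′ k′≤k Q = ≤-trans (powerSumBound₁ (k′ * (suc k′ + suc Λ)) Q) (*-monoˡ-≤ (Q ^ 1) (begin
      suc (k′ * (suc k′ + suc Λ)) ≤⟨ s≤s (*-mono-≤ k′≤k (+-monoˡ-≤ (suc Λ) (s≤s k′≤k))) ⟩
      suc (k * (suc k + suc Λ)) ≡⟨ cong (λ y → suc (k * y)) (lemma₁ k Λ) ⟩
      1 + k * ((2 + k) * 1 + Λ) ≤⟨ +-mono-≤ 1≤log (*-monoʳ-≤ k (+-monoˡ-≤ Λ (*-monoʳ-≤ (2 + k) 1≤log))) ⟩
      Λ + k * ((2 + k) * Λ + Λ) ≡⟨ lemma₂ k Λ ⟩
      W * Λ ∎))
      where
      Λ = ⌊log₂ n ⌋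
      lemma₁ : ∀ k l → suc k + suc l ≡ (2 + k) * 1 + l
      lemma₁ = solve-∀
      lemma₂ : ∀ k l → l + k * ((2 + k) * l + l) ≡ suc (k * (3 + k)) * l
      lemma₂ = solve-∀

  -- Cutting `n` down to `m = n / 2 ^ b` makes room for entries up to 8 k (k + 1) m at the cost of a
  -- constant factor. The number `J` of scales with 8^J ≤ m is about a third of the logarithm.
  square-lower : ∀ κ e → let k = suc κ ; d = k + suc e in
    ∃[ A ] ∃[ N ] NonZero A × (∀ n → N ≤ n → n ^ (k * d) * ⌊log₂ n ⌋ ≤ A * L n d k d × 1 ≤ ⌊log₂ n ⌋)
  square-lower κ e = A , 2 ^ (2 * b + 6) , m*n≢0 (D * 6) (16 ^ d) {{m*n≢0 D 6 {{m^n≢0 (2 ^ suc b) (k * d) {{m^n≢0 2 (suc b)}}}}}} {{m^n≢0 16 d}} , bounds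
    where
    k = suc κ
    d = k + suc e
    -- By j ≤ 2^j, the product k · 8 · (k + 1) is at most `2 ^ b`.
    b = k + (3 + suc k)
    D = (2 ^ suc b) ^ (k * d)
    A = D * 6 * 16 ^ d
    instance
      2^b≢0 : NonZero (2 ^ b)
      2^b≢0 = m^n≢0 2 b
    bounds : ∀ n → 2 ^ (2 * b + 6) ≤ n → n ^ (k * d) * ⌊log₂ n ⌋ ≤ A * L n d k d × 1 ≤ ⌊log₂ n ⌋
    bounds n N≤n = (begin
        n ^ (k * d) * Λ ≤⟨ *-mono-≤ (^-monoˡ-≤ (k * d) n≤) Λ≤6J ⟩
        (2 ^ suc b * m) ^ (k * d) * (6 * J) ≡⟨ cong (_* (6 * J)) (^-distribˡ-* (2 ^ suc b) m (k * d)) ⟩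
        D * m ^ (k * d) * (6 * J) ≡⟨ lemma₁ D (m ^ (k * d)) J ⟩
        D * 6 * (J * m ^ (k * d)) ≤⟨ *-monoʳ-≤ (D * 6) (Family.family-count κ e m J 8^J≤m m-fits) ⟩
        D * 6 * (16 ^ d * L n d k d) ≡⟨ *-assoc (D * 6) (16 ^ d) (L n d k d) ⟨
        A * L n d k d ∎) , ≤-trans (≤-trans (s≤s z≤n) (m≤n+m 6 (2 * b))) 2b+6≤Λ
      where
      open ≤-Reasoning
      Λ = ⌊log₂ n ⌋
      m = n / 2 ^ b
      J = (Λ ∸ b) / 3
      lemma₁ : ∀ d y j → d * y * (6 * j) ≡ d * 6 * (j * y)
      lemma₁ = solve-∀
      n≢0 : NonZero n
      n≢0 = >-nonZero (≤-trans (m^n>0 2 (2 * b + 6)) N≤n)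
      2b+6≤Λ : 2 * b + 6 ≤ Λ
      2b+6≤Λ = ≤-trans (≤-reflexive (sym (⌊log₂[2^n]⌋≡n (2 * b + 6)))) (⌊log₂⌋-mono-≤ N≤n)
      b≤Λ : b ≤ Λ
      b≤Λ = ≤-trans (≤-trans (m≤n*m b 2) (m≤m+n (2 * b) 6)) 2b+6≤Λ
      2^[Λ∸b]≤m : 2 ^ (Λ ∸ b) ≤ m
      2^[Λ∸b]≤m = begin
        2 ^ (Λ ∸ b) ≡⟨ m*n/n≡m (2 ^ (Λ ∸ b)) (2 ^ b) ⟨
        2 ^ (Λ ∸ b) * 2 ^ b / 2 ^ b ≡⟨ cong (_/ 2 ^ b) (^-distribˡ-+-* 2 (Λ ∸ b) b) ⟨
        2 ^ (Λ ∸ b + b) / 2 ^ b ≡⟨ cong (λ y → 2 ^ y / 2 ^ b) (m∸n+n≡m b≤Λ) ⟩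
        2 ^ Λ / 2 ^ b ≤⟨ /-monoˡ-≤ (2 ^ b) (2^log≤n n {{n≢0}}) ⟩
        m ∎
      8^J≤m : 8 ^ J ≤ m
      8^J≤m = begin
        8 ^ J ≡⟨ ^-*-assoc 2 3 J ⟩
        2 ^ (3 * J) ≤⟨ ^-monoʳ-≤ 2 (≤-trans (≤-reflexive (*-comm 3 J)) (m/n*n≤m (Λ ∸ b) 3)) ⟩
        2 ^ (Λ ∸ b) ≤⟨ 2^[Λ∸b]≤m ⟩
        m ∎
      n≤ : n ≤ 2 ^ suc b * m
      n≤ = begin
        n ≡⟨ m≡m%n+[m/n]*n n (2 ^ b) ⟩
        n % 2 ^ b + m * 2 ^ b ≤⟨ +-monoˡ-≤ (m * 2 ^ b) (<⇒≤ (m%n<n n (2 ^ b))) ⟩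
        2 ^ b + m * 2 ^ b ≤⟨ +-monoˡ-≤ (m * 2 ^ b) (m≤n*m (2 ^ b) m {{>-nonZero (≤-trans (m^n>0 2 (Λ ∸ b)) 2^[Λ∸b]≤m)}}) ⟩
        m * 2 ^ b + m * 2 ^ b ≡⟨ lemma (2 ^ b) m ⟩
        2 * 2 ^ b * m ∎
        where
        lemma : ∀ y m → m * y + m * y ≡ 2 * y * m
        lemma = solve-∀
      -- Rounding gives 6 J ≥ 2 (Λ - b) - 6, and the threshold 2 b + 6 ≤ Λ is what brings this up to
      -- Λ.
      Λ≤6J : Λ ≤ 6 * J
      Λ≤6J = +-cancelʳ-≤ (Λ + 6) Λ (6 * J) (begin
        Λ + (Λ + 6) ≡⟨ lemma₂ Λ ⟩
        2 * Λ + 6 ≡⟨ cong (λ y → 2 * y + 6) (m∸n+n≡m b≤Λ) ⟨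
        2 * (Λ ∸ b + b) + 6 ≡⟨ cong (λ y → 2 * (y + b) + 6) (m≡m%n+[m/n]*n (Λ ∸ b) 3) ⟩
        2 * ((Λ ∸ b) % 3 + J * 3 + b) + 6 ≤⟨ +-monoˡ-≤ 6 (*-monoʳ-≤ 2 (+-monoˡ-≤ b (+-monoˡ-≤ (J * 3) (<⇒≤ (m%n<n (Λ ∸ b) 3))))) ⟩
        2 * (3 + J * 3 + b) + 6 ≡⟨ lemma₃ J b ⟩
        6 * J + (2 * b + 6 + 6) ≤⟨ +-monoʳ-≤ (6 * J) (+-monoˡ-≤ 6 2b+6≤Λ) ⟩
        6 * J + (Λ + 6) ∎)
        where
        lemma₂ : ∀ l → l + (l + 6) ≡ 2 * l + 6
        lemma₂ = solve-∀
        lemma₃ : ∀ j b → 2 * (3 + j * 3 + b) + 6 ≡ 6 * j + (2 * b + 6 + 6)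
        lemma₃ = solve-∀
      m-fits : k * (8 * (suc k * m)) ≤ n
      m-fits = begin
        k * (8 * (suc k * m)) ≤⟨ *-mono-≤ (n≤2^n k) (*-monoʳ-≤ 8 (*-monoˡ-≤ m (n≤2^n (suc k)))) ⟩
        2 ^ k * (2 ^ 3 * (2 ^ suc k * m)) ≡⟨ lemma (2 ^ k) (2 ^ 3) (2 ^ suc k) m ⟩
        m * (2 ^ k * (2 ^ 3 * 2 ^ suc k)) ≡⟨ cong (λ y → m * (2 ^ k * y)) (^-distribˡ-+-* 2 3 (suc k)) ⟨
        m * (2 ^ k * 2 ^ (3 + suc k)) ≡⟨ cong (m *_) (^-distribˡ-+-* 2 k (3 + suc k)) ⟨
        m * 2 ^ b ≤⟨ m/n*n≤m n (2 ^ b) ⟩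
        n ∎
        where
        lemma : ∀ a b c m → a * (b * (c * m)) ≡ m * (a * (b * c))
        lemma = solve-∀

  square : ∀ κ e d → suc κ + suc e ≡ d → (λ n → L n d (suc κ) d) =Θ l d (suc κ) d
  square κ e d refl = Θ-fromℕ {λ n → L n d k d} {l d k d} A (suc C) N {{A≢0}} λ n N≤n →
    ≤-trans (≤-reflexive (l-≡ d k n)) (proj₁ (lower n N≤n)) ,
    ≤-trans (upper n (proj₂ (lower n N≤n))) (≤-trans (*-monoˡ-≤ (n ^ (k * d) * ⌊log₂ n ⌋) (n≤1+n C)) (≤-reflexive (cong (suc C *_) (sym (l-≡ d k n)))))
    where
    k = suc κ
    C = proj₁ (square-upper d k (m≤m+n k (suc e)))
    upper = proj₂ (square-upper d k (m≤m+n k (suc e)))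
    A = proj₁ (square-lower κ e)
    N = proj₁ (proj₂ (square-lower κ e))
    A≢0 = proj₁ (proj₂ (proj₂ (square-lower κ e)))
    lower = proj₂ (proj₂ (proj₂ (square-lower κ e)))

open Asymptotics
open import Data.Nat.Base using (suc)
open import Data.Nat.Properties using (<-cmp; <-≤-trans; m⊓n≤m; m⊓n≤n; m≤n⇒∃[o]m+o≡n; +-suc)
open import Relation.Binary.Definitions using (tri<; tri≈; tri>)

proposition1p9 : (d k r : ℕ) → 0 < d → 0 < k → 0 < r → k < d ⊓ r →
    (λ n → L n d k r) =Θ l d k r
proposition1p9 d (suc κ) r 0<d 0<k 0<r k<d⊓r = case <-cmp d r of λ where
    (tri< d<r _ _) → let x , 1+d+x≡r = m≤n⇒∃[o]m+o≡n d<r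
                     in wide d κ r x k<d (trans (+-suc d x) 1+d+x≡r)
    (tri> _ _ r<d) → let x , 1+r+x≡d = m≤n⇒∃[o]m+o≡n r<d
                     in tall d κ r x k<r (trans (+-suc r x) 1+r+x≡d)
    (tri≈ _ d≡r _) → let e , 1+k+e≡d = m≤n⇒∃[o]m+o≡n k<d
                     in subst (λ r → (λ n → L n d (suc κ) r) =Θ l d (suc κ) r) d≡r
                          (square κ e d (trans (+-suc (suc κ) e) 1+k+e≡d))
  where
  k<d : suc κ < d
  k<d = <-≤-trans k<d⊓r (m⊓n≤m d r)
  k<r : suc κ < r
  k<r = <-≤-trans k<d⊓r (m⊓n≤n d r)
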